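{- Let $\mathfrak{a}, \mathfrak{b} \in \langle \Sigma \rangle$. Then \[ \Delta(\mathfrak{a}\sqcup\!\sqcup \mathfrak{b})=\Delta(\mathfrak{a})\sqcup\!\sqcup\Delta(\mathfrak{b}). \]
   Context: Let $\mathbb F_q$ be the finite field with $q$ elements, of characteristic $p$. Let $\Sigma=\{x_n\}_{n\geq 1}$ be an alphabet with weight $w(x_n)=n$; let $\langle\Sigma\rangle$ be the set of words over $\Sigma$ (the empty word is denoted $1$; the weight of a word is the sum of the weights of its letters), and let $\mathfrak C=\mathbb F_q\langle\Sigma\rangle$ be the $\mathbb F_q$-vector space with basis $\langle\Sigma\rangle$, equipped with concatenation. A nonempty word is written $\mathfrak a=x_a\mathfrak a_-$, where $x_a$ is its first letter. For $a,b,i\in\mathbb N$ put $\Delta^i_{a,b}=(-1)^{a-1}\binom{i-1}{a-1}+(-1)^{b-1}\binom{i-1}{b-1}\in\mathbb F_p$ if $(q-1)\mid i$ and $0<i<a+b$, and $\Delta^i_{a,b}=0$ otherwise. Define $\mathbb F_q$-bilinear products $\diamond$ (diamond) and $\sqcup\!\sqcup$ (shuffle) on $\mathfrak C$ recursively by $1\diamond\mathfrak a=\mathfrak a\diamond 1=\mathfrak a$, $1\sqcup\!\sqcup\mathfrak a=\mathfrak a\sqcup\!\sqcup 1=\mathfrak a$, and for nonempty words $\mathfrak a,\mathfrak b$: $\mathfrak a\diamond\mathfrak b=x_{a+b}(\mathfrak a_-\sqcup\!\sqcup\mathfrak b_-)+\sum_{i+j=a+b}\Delta^j_{a,b}\,x_i(x_j\sqcup\!\sqcup(\mathfrak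 a_-\sqcup\!\sqcup\mathfrak b_-))$, $\mathfrak a\sqcup\!\sqcup\mathfrak b=x_a(\mathfrak a_-\sqcup\!\sqcup\mathfrak b)+x_b(\mathfrak a\sqcup\!\sqcup\mathfrak b_-)+\mathfrak a\diamond\mathfrak b$ (a commutative associative product). The triangle product is $1\triangleright\mathfrak a=\mathfrak a\triangleright 1=\mathfrak a$ and $\mathfrak a\triangleright\mathfrak b=x_a(\mathfrak a_-\sqcup\!\sqcup\mathfrak b)$ for nonempty $\mathfrak a,\mathfrak b$. On $\mathfrak C\otimes\mathfrak C$ the shuffle product is taken componentwise: $(\mathfrak a_1\otimes\mathfrak b_1)\sqcup\!\sqcup(\mathfrak a_2\otimes\mathfrak b_2)=(\mathfrak a_1\sqcup\!\sqcup\mathfrak a_2)\otimes(\mathfrak b_1\sqcup\!\sqcup\mathfrak b_2)$. The coproduct $\Delta:\mathfrak C\to\mathfrak C\otimes\mathfrak C$ is the $\mathbb F_q$-linear map defined on words by induction on weight: $\Delta(1)=1\otimes 1$, $\Delta(x_1)=1\otimes x_1+x_1\otimes 1$; if $\mathfrak u=x_u\mathfrak v$ has depth $>1$ and $\Delta(x_u)=1\otimes x_u+\sum a_u\otimes b_u$, $\Delta(\mathfrak v)=\sum a_{\mathfrak v}\otimes b_{\mathfrak v}$, then $\Delta(\mathfrak u)=1\otimes\mathfrak u+\sum(a_u\triangleright a_{\mathfrak v})\otimes(b_u\sqcup\!\sqcup b_{\mathfrak v})$; and for $w\geq 2$, $\Delta(x_w)=\Delta(x_1)\sqcup\!\sqcup\Delta(x_{w-1})-\Delta(x_1x_{w-1})-\Delta(x_{w-1}x_1)-\sum_{0<j<w}\Delta^j_{1,w-1}\Delta(x_{w-j}x_j)$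 (mirroring $x_1\sqcup\!\sqcup x_{w-1}=x_w+x_1x_{w-1}+x_{w-1}x_1+\sum_{0<j<w}\Delta^j_{1,w-1}x_{w-j}x_j$). -}

module Defs where

open import Level using (Level; _⊔_)
open import Algebra.Bundles using (CommutativeRing)
open import Data.Nat using (ℕ; zero; suc; _∸_; _<_; _≟_) renaming (_+_ to _+ℕ_)
open import Data.Nat.Divisibility using (_∣?_)
open import Data.Nat.Combinatorics using (_C_)
open import Data.Nat.Properties using (_<?_)
open import Data.Fin using (Fin)
open import Data.List using (List; []; _∷_; _++_; map; concatMap; upTo; length)
open import Data.List.Properties using (≡-dec)
open import Data.List.Relation.Unary.All using (All)
open import Data.Product using (_×_; _,_; Σ; ∃)
open import Data.Bool using (if_then_else_; _∧_)
open import Relation.Nullary using (¬_; does)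
open import Relation.Binary.PropositionalEquality using (_≡_)

-- Words over Σ = {x_n}_{n ≥ 1}: the letter x_n is represented by the natural number n.
Word : Set
Word = List ℕ

IsWord : Word → Set
IsWord = All (0 <_)

record FiniteField (c ℓ : Level) (q : ℕ) : Set (Level.suc (c ⊔ ℓ)) where
  field
    ring : CommutativeRing c ℓ
  open CommutativeRing ring
  field
    1≉0     : ¬ (1# ≈ 0#)
    inverse : ∀ x → ¬ (x ≈ 0#) → ∃ λ y → x * y ≈ 1#
    enum    : Fin q → Carrier
    enum-injective  : ∀ i j → enum i ≈ enum j → i ≡ j
    enum-surjective : ∀ x → ∃ λ i → enum i ≈ x

-- The algebra 𝔉 = F⟨Σ⟩ and 𝔉 ⊗ 𝔉 over a commutative ring R, with the parameter q
-- entering only through the condition (q-1) ∣ i in Δ^i_{a,b}.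
module Coalg {c ℓ : Level} (R : CommutativeRing c ℓ) (q : ℕ) where
  open CommutativeRing R

  -- formal linear combinations (elements of 𝔉), compared coefficientwise
  Lin : Set c
  Lin = List (Carrier × Word)

  -- elements of 𝔉 ⊗ 𝔉 : formal combinations of pure tensors of words
  Lin2 : Set c
  Lin2 = List (Carrier × Word × Word)

  coeff : Lin → Word → Carrier
  coeff [] w = 0#
  coeff ((k , u) ∷ l) w = if does (≡-dec _≟_ u w) then k + coeff l w else coeff l w

  coeff2 : Lin2 → Word → Word → Carrier
  coeff2 [] w v = 0#
  coeff2 ((k , u , u') ∷ l) w v =
    if does (≡-dec _≟_ u w) ∧ does (≡-dec _≟_ u' v) then k + coeff2 l w v else coeff2 l w v

  _≈L_ : Lin → Lin → Set ℓ
  l ≈L l' = ∀ w → coeff l w ≈ coeff l' w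

  _≈T_ : Lin2 → Lin2 → Set ℓ
  t ≈T t' = ∀ w v → coeff2 t w v ≈ coeff2 t' w v

  natR : ℕ → Carrier
  natR zero = 0#
  natR (suc n) = 1# + natR n

  alt : ℕ → Carrier → Carrier
  alt zero x = x
  alt (suc k) x = - alt k x

  Δc : ℕ → ℕ → ℕ → Carrier
  Δc a b i =
    if does ((q ∸ 1) ∣? i) ∧ does (0 <? i) ∧ does (i <? a +ℕ b)
    then alt (a ∸ 1) (natR ((i ∸ 1) C (a ∸ 1))) + alt (b ∸ 1) (natR ((i ∸ 1) C (b ∸ 1)))
    else 0#

  single : Word → Lin
  single w = (1# , w) ∷ []

  scale : Carrier → Lin → Lin
  scale k = map (λ { (k' , w) → (k * k' , w) })

  prefix : ℕ → Lin → Lin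
  prefix x = map (λ { (k , w) → (k , x ∷ w) })

  linL : (Word → Lin) → Lin → Lin
  linL f = concatMap (λ { (k , w) → scale k (f w) })

  -- shuffle with fuel; the fuel length 𝔞 + length 𝔟 is always sufficient,
  -- so the zero-fuel clause is never reached from `_⧢_`.
  -- Third summand of the last clause is 𝔞 ⋄ 𝔟.
  sh : ℕ → Word → Word → Lin
  sh n [] b = single b
  sh n (x ∷ as) [] = single (x ∷ as)
  sh zero (_ ∷ _) (_ ∷ _) = []
  sh (suc n) (a ∷ as) (b ∷ bs) =
    prefix a (sh n as (b ∷ bs)) ++ prefix b (sh n (a ∷ as) bs)
    ++ (prefix (a +ℕ b) (sh n as bs)
        ++ concatMap (λ j → scale (Δc a b j)
                               (prefix ((a +ℕ b) ∸ j) (linL (sh n (j ∷ []) ) (sh n as bs))))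
                     (map suc (upTo ((a +ℕ b) ∸ 1))))

  _⧢_ : Word → Word → Lin
  a ⧢ b = sh (length a +ℕ length b) a b

  _⧢L_ : Lin → Lin → Lin
  l ⧢L l' = concatMap (λ { (k , u) → concatMap (λ { (k' , u') → scale (k * k') (u ⧢ u') }) l' }) l

  _▷_ : Word → Word → Lin
  [] ▷ b = single b
  (a ∷ as) ▷ [] = single (a ∷ as)
  (a ∷ as) ▷ (b ∷ bs) = prefix a (as ⧢ (b ∷ bs))

  _⊗L_ : Lin → Lin → Lin2
  l ⊗L l' = concatMap (λ { (k , u) → map (λ { (k' , u') → (k * k' , u , u') }) l' }) l

  scaleT : Carrier → Lin2 → Lin2
  scaleT k = map (λ { (k' , u , v) → (k * k' , u , v) })

  negT : Lin2 → Lin2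
  negT = scaleT (- 1#)

  bilT : (Word → Word → Lin) → (Word → Word → Lin) → Lin2 → Lin2 → Lin2
  bilT f g t t' =
    concatMap (λ { (k , u , v) →
      concatMap (λ { (k' , u' , v') → scaleT (k * k') (f u u' ⊗L g v v') }) t' }) t

  _⧢T_ : Lin2 → Lin2 → Lin2
  _⧢T_ = bilT _⧢_ _⧢_

  combT : Lin2 → Lin2 → Lin2
  combT = bilT _▷_ _⧢_

  oneT : Word → Lin2
  oneT u = (1# , [] , u) ∷ []

  rest : ℕ → Lin2 → Lin2
  rest u t = negT (oneT (u ∷ [])) ++ t

  ΔW : (ℕ → Lin2) → Word → Lin2
  ΔW dl [] = (1# , [] , []) ∷ []
  ΔW dl (a ∷ []) = dl a
  ΔW dl (a ∷ v@(_ ∷ _)) = oneT (a ∷ v) ++ combT (rest a (dl a)) (ΔW dl v)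

  -- Δ on letters, by induction on weight (with fuel; fuel ≥ weight suffices).
  -- The letter index 0 is not a letter of Σ; its value is irrelevant.
  ΔLf : ℕ → ℕ → Lin2
  ΔLf f zero = []
  ΔLf f (suc zero) = (1# , [] , 1 ∷ []) ∷ (1# , 1 ∷ [] , []) ∷ []
  ΔLf zero (suc (suc w)) = []
  ΔLf (suc f) (suc (suc w)) =
    (ΔLf f 1 ⧢T ΔLf f (suc w))
    ++ negT (ΔW (ΔLf f) (1 ∷ suc w ∷ []))
    ++ negT (ΔW (ΔLf f) (suc w ∷ 1 ∷ []))
    ++ negT (concatMap (λ j → scaleT (Δc 1 (suc w) j) (ΔW (ΔLf f) ((suc (suc w) ∸ j) ∷ j ∷ [])))
                       (map suc (upTo (suc w))))

  ΔL : ℕ → Lin2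
  ΔL w = ΔLf w w

  Δ : Word → Lin2
  Δ = ΔW ΔL

  ΔLin : Lin → Lin2
  ΔLin = concatMap (λ { (k , w) → scaleT k (Δ w) })

{-# OPTIONS --safe #-}
module Submission where

-- Write x_0 = 1 and Q(u) = Σ x_m u^m over (q-1) ∣ m.  With x(s) = Σ x_{n+1} s^n, the diamond product
-- of letters reads x(s) ⋄ x(t) = (x(s) - x(t)) P(s - t), where P(u) = Q(u)/u.  The key identity is
--     P(s) ⧢ P(t) = P(s + t) ⧢ (P(s) + P(t)).
-- Its depth 2 part follows by writing the coefficients as sums over (ρ,σ) ∈ F_q² (power sums in F_q)
-- and changing variables there, its depth 1 part by multiplying with the Moore determinant
-- s^q t - s t^q.  It makes x(s) ⋄ x(t) ⋄ x(r) symmetric, hence ⧢ associative, and it says that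
-- E(u) = u/Q(u), a series over the shuffle algebra, is additive.
-- The coproduct is Δ(x(s)) = 1 ⊗ x(s) + Σ_k x_{k+1} ⊗ E(s)^k, extended to words by
-- Δ(x_a v) = 1 ⊗ x_a v + Δ⁺(x_a) ▷ Δ(v); additivity of E gives Δ⁺(x_a ⋄ x_b) = Δ⁺(x_a) ⋄ Δ⁺(x_b), and
-- multiplicativity follows by induction on depth.  In particular this map satisfies the recursion
-- that defines Δ on letters.

open import Level using (Level; _⊔_)
open import Algebra.Bundles using (CommutativeRing; RawRing; CommutativeMonoid)
open import Algebra.Solver.Ring.AlmostCommutativeRing using (fromCommutativeRing; _-Raw-AlmostCommutative⟶_)
import Algebra.Solver.Ring as RingSolver
import Algebra.Properties.Ring as RingProperties
import Algebra.Properties.AbelianGroup as AbelianGroupProperties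
import Algebra.Properties.CommutativeSemiring.Exp as Exp
import Algebra.Properties.CommutativeSemigroup as CommutativeSemigroupProperties
open import Data.Nat as ℕ using (ℕ; zero; suc; s≤s; z≤n; _≤_) renaming (_+_ to _+ℕ_)
import Data.Nat.Properties as ℕₚ
open import Data.Nat.Combinatorics using (_C_; nCk+nC[k+1]≡[n+1]C[k+1]; k>n⇒nCk≡0; nCn≡1)
open import Data.Product using (_×_; _,_; proj₁; proj₂; ∃)
open import Data.Maybe using (Maybe; just; nothing)
open import Relation.Nullary using (yes; no; ¬_; Dec; does)
open import Relation.Binary.PropositionalEquality as ≡ using (_≡_)
import Relation.Binary.Reasoning.Setoid as SetoidReasoning
import Algebra.Properties.CommutativeMonoid.Sum as MonoidSum
open import Data.Nat.DivMod using (_/_; _%_; m≡m%n+[m/n]*n; m%n<n)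
open import Data.Nat.Divisibility using (_∣_; _∣?_; divides; m%n≡0⇒n∣m; ∣m+n∣m⇒∣n; ∣m∣n⇒∣m+n; ∣⇒≤)
open import Data.Bool using (if_then_else_; true; false; _∧_)
open import Data.Fin using (Fin; zero; suc; punchIn)
import Data.Fin.Properties as Finₚ
open import Data.Fin.Permutation using (Permutation; permutation)
open import Data.List using (List; []; _∷_; length; _++_; map; concatMap; upTo; applyUpTo)
open import Data.List.Relation.Unary.All as All using (All; []; _∷_)
open import Data.Empty using (⊥-elim)
open import Function.Base using (_∘_)
open import Relation.Nullary.Decidable using (¬?; _×-dec_; map′; dec-true; dec-false)
open import Defs
import Data.List as List
open import Data.Nat.Solver using (module +-*-Solver)
open import Data.List.Properties using (≡-dec; length-map)

-- Two difficulties shape the argument. The identity for P is needed for associativity, before `⧢`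
-- is known to give a ring, and again inside that ring for E. It is therefore proved for a table of
-- values (`Pair`) in an arbitrary commutative F_q-algebra: associativity fills the table with the
-- values of a scalar functional, additivity of E with the words themselves. Secondly P has a pole,
-- and the shuffle algebra is not known to be a domain. Denominators are therefore cleared (`Star`),
-- and over coefficient rings that need not be domains only elements like s - t or the Moore
-- determinant are cancelled, which are visibly non-zero-divisors among power series. The shape of
-- the coproduct comes from asking that x(s) ↦ Σ x_{k+1} ⊗ E(s)^k respect `⋄`: comparing the two
-- sides of (x(s) - x(t)) P(s - t) leads to E = 1/P and E(s) - E(t) = E(s - t). Dividing the
-- identity for P by P(s) P(t) P(s + t) gives precisely this additivity.

-- Commutative rings: a solver, finite convolution sums, non-zero-divisors, homomorphisms.

module RingKit {c ℓ : Level} (R : CommutativeRing c ℓ) where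
  open CommutativeRing R public hiding (zero)
  open RingProperties ring public using (-‿distribˡ-*; -‿distribʳ-*; -1*x≈-x)
  open AbelianGroupProperties +-abelianGroup public using () renaming (⁻¹-∙-comm to -‿+-comm; ⁻¹-involutive to -‿involutive; ε⁻¹≈ε to -0≈0)
  open Exp commutativeSemiring public
  open CommutativeSemigroupProperties +-commutativeSemigroup public using () renaming (interchange to +-interchange)
  open SetoidReasoning setoid public

  natR : ℕ → Carrier
  natR zero    = 0#
  natR (suc n) = 1# + natR n

  natR-+ : ∀ m n → natR (m +ℕ n) ≈ natR m + natR n
  natR-+ zero    n = sym (+-identityˡ _)
  natR-+ (suc m) n = trans (+-congˡ (natR-+ m n)) (sym (+-assoc _ _ _))

  natR-* : ∀ m n → natR (m ℕ.* n) ≈ natR m * natR n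
  natR-* zero    n = sym (zeroˡ _)
  natR-* (suc m) n = begin
    natR (n +ℕ m ℕ.* n)              ≈⟨ natR-+ n (m ℕ.* n) ⟩
    natR n + natR (m ℕ.* n)          ≈⟨ +-cong (sym (*-identityˡ _)) (natR-* m n) ⟩
    1# * natR n + natR m * natR n    ≈⟨ distribʳ _ _ _ ⟨
    (1# + natR m) * natR n           ∎

  -- Formal differences of naturals: enough for the ring solver to see cancellation.
  private
    reduce : ℕ × ℕ → ℕ × ℕ
    reduce (a , b) = a ℕ.∸ b , b ℕ.∸ a

    Coeff : RawRing _ _
    Coeff = record
      { Carrier = ℕ × ℕ
      ; _≈_ = _≡_
      ; _+_ = λ (a , b) (c , d) → reduce (a +ℕ c , b +ℕ d)
      ; _*_ = λ (a , b) (c , d) → reduce (a ℕ.* c +ℕ b ℕ.* d , a ℕ.* d +ℕ b ℕ.* c)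
      ; -_ = λ (a , b) → b , a
      ; 0# = 0 , 0
      ; 1# = 1 , 0
      }

    -- The separate clauses make the constants (0 , 0) and (1 , 0) evaluate to `0#` and `1#` on the
    -- nose, so that solver equations match goals containing them.
    ⟦_⟧ᶜ : ℕ × ℕ → Carrier
    ⟦ 0 , 0 ⟧ᶜ = 0#
    ⟦ 1 , 0 ⟧ᶜ = 1#
    ⟦ a , b ⟧ᶜ = natR a - natR b

    ⟦⟧-natR : ∀ x → ⟦ x ⟧ᶜ ≈ natR (proj₁ x) - natR (proj₂ x)
    ⟦⟧-natR (0 , 0) = sym (-‿inverseʳ 0#)
    ⟦⟧-natR (1 , 0) = sym (trans (+-congˡ -0≈0) (trans (+-identityʳ _) (+-identityʳ _)))
    ⟦⟧-natR (0 , suc _) = refl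
    ⟦⟧-natR (1 , suc _) = refl
    ⟦⟧-natR (suc (suc _) , _) = refl

    via : ∀ x {y} → natR (proj₁ x) - natR (proj₂ x) ≈ y → ⟦ x ⟧ᶜ ≈ y
    via x = trans (⟦⟧-natR x)

    -‿swap : ∀ x y → y - x ≈ - (x - y)
    -‿swap x y = begin
      y - x        ≈⟨ +-comm _ _ ⟩
      - x + y      ≈⟨ +-congˡ (-‿involutive y) ⟨
      - x - - y    ≈⟨ -‿+-comm _ _ ⟩
      - (x - y)    ∎

    sub-+ : ∀ a b c d → (a + c) - (b + d) ≈ (a - b) + (c - d)
    sub-+ a b c d = trans (+-congˡ (sym (-‿+-comm b d))) (+-interchange a c (- b) (- d))

    sub-* : ∀ a b c d → (a * c + b * d) - (a * d + b * c) ≈ (a - b) * (c - d)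
    sub-* a b c d = begin
      (a * c + b * d) - (a * d + b * c)          ≈⟨ sub-+ _ _ _ _ ⟩
      (a * c - a * d) + (b * d - b * c)          ≈⟨ +-congˡ (-‿swap _ _) ⟩
      (a * c - a * d) - (b * c - b * d)          ≈⟨ +-cong (fac a c d) (-‿cong (fac b c d)) ⟩
      a * (c - d) - b * (c - d)                  ≈⟨ +-congˡ (-‿distribˡ-* b (c - d)) ⟩
      a * (c - d) + - b * (c - d)                ≈⟨ distribʳ _ _ _ ⟨
      (a - b) * (c - d)                          ∎
      where
      fac : ∀ x y z → x * y - x * z ≈ x * (y - z)
      fac x y z = trans (+-congˡ (-‿distribʳ-* x z)) (sym (distribˡ x y (- z)))

    reduce-natR : ∀ a b → natR (a ℕ.∸ b) - natR (b ℕ.∸ a) ≈ natR a - natR b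
    reduce-natR zero    zero    = refl
    reduce-natR zero    (suc b) = refl
    reduce-natR (suc a) zero    = refl
    reduce-natR (suc a) (suc b) = begin
      natR (a ℕ.∸ b) - natR (b ℕ.∸ a)      ≈⟨ reduce-natR a b ⟩
      natR a - natR b                      ≈⟨ +-identityˡ _ ⟨
      0# + (natR a - natR b)               ≈⟨ +-congʳ (-‿inverseʳ 1#) ⟨
      (1# - 1#) + (natR a - natR b)        ≈⟨ sub-+ _ _ _ _ ⟨
      (1# + natR a) - (1# + natR b)        ∎

    via-reduce : ∀ x {y} → natR (proj₁ x) - natR (proj₂ x) ≈ y → ⟦ reduce x ⟧ᶜ ≈ y
    via-reduce (a , b) e = via (reduce (a , b)) (trans (reduce-natR a b) e)

    morphism : Coeff -Raw-AlmostCommutative⟶ fromCommutativeRing R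
    morphism = record
      { ⟦_⟧ = ⟦_⟧ᶜ
      ; +-homo = λ x@(a , b) y@(c , d) → via-reduce (a +ℕ c , b +ℕ d)
          (trans (trans (+-cong (natR-+ a c) (-‿cong (natR-+ b d))) (sub-+ _ _ _ _))
                 (+-cong (sym (⟦⟧-natR x)) (sym (⟦⟧-natR y))))
      ; *-homo = λ x@(a , b) y@(c , d) → via-reduce (a ℕ.* c +ℕ b ℕ.* d , a ℕ.* d +ℕ b ℕ.* c)
          (trans (trans (+-cong (trans (natR-+ (a ℕ.* c) (b ℕ.* d)) (+-cong (natR-* a c) (natR-* b d)))
                        (-‿cong (trans (natR-+ (a ℕ.* d) (b ℕ.* c)) (+-cong (natR-* a d) (natR-* b c)))))
                (sub-* _ _ _ _))
                (*-cong (sym (⟦⟧-natR x)) (sym (⟦⟧-natR y))))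
      ; -‿homo = λ x@(a , b) → via (b , a) (trans (-‿swap _ _) (-‿cong (sym (⟦⟧-natR x))))
      ; 0-homo = refl
      ; 1-homo = refl
      }

    -- Cross addition in ℕ. A failed test proves nothing, since the ring may have positive
    -- characteristic.
    dec : ∀ x y → Maybe (⟦ x ⟧ᶜ ≈ ⟦ y ⟧ᶜ)
    dec x@(a , b) (c , d) with a +ℕ d ℕₚ.≟ c +ℕ b
    ... | no _  = nothing
    ... | yes e = just (via x (trans (begin
      natR a - natR b                                  ≈⟨ +-identityʳ _ ⟨
      (natR a - natR b) + 0#                           ≈⟨ +-congˡ (-‿inverseʳ (natR d)) ⟨
      (natR a - natR b) + (natR d - natR d)            ≈⟨ sub-+ _ _ _ _ ⟨
      (natR a + natR d) - (natR b + natR d)            ≈⟨ +-cong (trans (sym (natR-+ a d)) (trans (reflexive (≡.cong natR e)) (natR-+ c b))) (-‿cong (+-comm _ _)) ⟩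
      (natR c + natR b) - (natR d + natR b)            ≈⟨ sub-+ _ _ _ _ ⟩
      (natR c - natR d) + (natR b - natR b)            ≈⟨ +-congˡ (-‿inverseʳ (natR b)) ⟩
      (natR c - natR d) + 0#                           ≈⟨ +-identityʳ _ ⟩
      natR c - natR d                                  ∎) (sym (⟦⟧-natR (c , d)))))

  open RingSolver Coeff (fromCommutativeRing R) morphism dec public
    using (solve; _:=_; _:+_; _:*_; _:-_; :-_; con; _:^_)

  -- Sum over the antidiagonal a + b = N. Passing both indices to the summand avoids truncated
  -- subtraction, and all generating functions below are sums of this shape.
  anti : ℕ → (ℕ → ℕ → Carrier) → Carrier
  anti zero    F = F 0 0
  anti (suc N) F = F 0 (suc N) + anti N (λ a → F (suc a))

  anti-cong′ : ∀ N {F G : ℕ → ℕ → Carrier} → (∀ a b → a +ℕ b ≡ N → F a b ≈ G a b) → anti N F ≈ anti N G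
  anti-cong′ zero    h = h 0 0 ≡.refl
  anti-cong′ (suc N) h = +-cong (h 0 (suc N) ≡.refl) (anti-cong′ N λ a b e → h (suc a) b (≡.cong suc e))

  anti-cong : ∀ N {F G : ℕ → ℕ → Carrier} → (∀ a b → F a b ≈ G a b) → anti N F ≈ anti N G
  anti-cong N h = anti-cong′ N (λ a b _ → h a b)

  anti-+ : ∀ N F G → anti N (λ a b → F a b + G a b) ≈ anti N F + anti N G
  anti-+ zero    F G = refl
  anti-+ (suc N) F G = trans (+-congˡ (anti-+ N _ _)) (+-interchange _ _ _ _)

  anti-*ˡ : ∀ N x F → x * anti N F ≈ anti N (λ a b → x * F a b)
  anti-*ˡ zero    x F = refl
  anti-*ˡ (suc N) x F = trans (distribˡ _ _ _) (+-congˡ (anti-*ˡ N x _))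

  anti-*ʳ : ∀ N x F → anti N F * x ≈ anti N (λ a b → F a b * x)
  anti-*ʳ N x F = trans (*-comm _ _) (trans (anti-*ˡ N x F) (anti-cong N λ _ _ → *-comm _ _))

  anti-0 : ∀ N → anti N (λ _ _ → 0#) ≈ 0#
  anti-0 zero    = refl
  anti-0 (suc N) = trans (+-identityˡ _) (anti-0 N)

  anti-0′ : ∀ N {F} → (∀ a b → a +ℕ b ≡ N → F a b ≈ 0#) → anti N F ≈ 0#
  anti-0′ N h = trans (anti-cong′ N h) (anti-0 N)

  anti-neg : ∀ N F → - anti N F ≈ anti N (λ a b → - F a b)
  anti-neg zero    F = refl
  anti-neg (suc N) F = trans (sym (-‿+-comm _ _)) (+-congˡ (anti-neg N _))

  anti-last : ∀ N F → anti (suc N) F ≈ anti N (λ a b → F a (suc b)) + F (suc N) 0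
  anti-last zero    F = refl
  anti-last (suc N) F = trans (+-congˡ (anti-last N (λ a → F (suc a)))) (sym (+-assoc _ _ _))

  anti-flip : ∀ N F → anti N F ≈ anti N (λ a b → F b a)
  anti-flip zero    F = refl
  anti-flip (suc N) F = trans (trans (+-comm _ _) (+-congʳ (anti-flip N (λ a → F (suc a))))) (sym (anti-last N (λ a b → F b a)))

  anti-swap : ∀ N M (F : ℕ → ℕ → ℕ → ℕ → Carrier) → anti N (λ a b → anti M (λ c d → F a b c d)) ≈ anti M (λ c d → anti N (λ a b → F a b c d))
  anti-swap zero    M F = refl
  anti-swap (suc N) M F = trans (+-congˡ (anti-swap N M (λ a → F (suc a)))) (sym (anti-+ M _ _))

  -- Both sides run over all triples with sum N; this is what makes multiplication of power series
  -- associative.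
  anti-assoc : ∀ N (F : ℕ → ℕ → ℕ → Carrier) → anti N (λ a m → anti m (λ b c → F a b c)) ≈ anti N (λ m c → anti m (λ a b → F a b c))
  anti-assoc zero    F = refl
  anti-assoc (suc N) F = begin
    (F 0 0 (suc N) + anti N (λ b c → F 0 (suc b) c)) + anti N (λ a m → anti m (F (suc a)))
      ≈⟨ +-assoc _ _ _ ⟩
    F 0 0 (suc N) + (anti N (λ b c → F 0 (suc b) c) + anti N (λ a m → anti m (F (suc a))))
      ≈⟨ +-congˡ (+-congˡ (anti-assoc N (λ a → F (suc a)))) ⟩
    F 0 0 (suc N) + (anti N (λ b c → F 0 (suc b) c) + anti N (λ m c → anti m (λ a b → F (suc a) b c)))
      ≈⟨ +-congˡ (anti-+ N _ _) ⟨
    F 0 0 (suc N) + anti N (λ m c → anti (suc m) (λ a b → F a b c)) ∎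

  anti-drop : ∀ d N F → (∀ i j → i ℕ.< d → F i j ≈ 0#) → anti (d +ℕ N) F ≈ anti N (λ i j → F (d +ℕ i) j)
  anti-drop zero    N F h = refl
  anti-drop (suc d) N F h = trans (+-congʳ (h 0 _ (s≤s z≤n)))
    (trans (+-identityˡ _) (anti-drop d N (λ i → F (suc i)) (λ i j i<d → h (suc i) j (s≤s i<d))))

  anti-trunc : ∀ n m F → (∀ a b → m ℕ.< a → F a b ≈ 0#) → anti (n +ℕ m) F ≈ anti m (λ k l → F k (n +ℕ l))
  anti-trunc zero    m F h = refl
  anti-trunc (suc n) m F h = trans (anti-last (n +ℕ m) F)
    (trans (+-congˡ (h (suc (n +ℕ m)) 0 (s≤s (ℕₚ.m≤n+m m n))))
      (trans (+-identityʳ _) (anti-trunc n m (λ a b → F a (suc b)) λ a b → h a (suc b))))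

  -- The bound is included: n + 1 summands, as many as in `anti n`.
  sumTo : ℕ → (ℕ → Carrier) → Carrier
  sumTo zero    f = f 0
  sumTo (suc n) f = f 0 + sumTo n (λ k → f (suc k))

  sumTo-cong : ∀ n {f g : ℕ → Carrier} → (∀ k → f k ≈ g k) → sumTo n f ≈ sumTo n g
  sumTo-cong zero    h = h 0
  sumTo-cong (suc n) h = +-cong (h 0) (sumTo-cong n λ k → h (suc k))

  sumTo-+ : ∀ n f g → sumTo n (λ k → f k + g k) ≈ sumTo n f + sumTo n g
  sumTo-+ zero    f g = refl
  sumTo-+ (suc n) f g = trans (+-congˡ (sumTo-+ n _ _)) (+-interchange _ _ _ _)

  sumTo-0 : ∀ n → sumTo n (λ _ → 0#) ≈ 0#
  sumTo-0 zero    = refl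
  sumTo-0 (suc n) = trans (+-identityˡ _) (sumTo-0 n)

  anti-fst : ∀ N f → anti N (λ k _ → f k) ≈ sumTo N f
  anti-fst zero    f = refl
  anti-fst (suc N) f = +-congˡ (anti-fst N _)

  sumTo-extend : ∀ a b f → (∀ k → a ℕ.< k → f k ≈ 0#) → sumTo (a +ℕ b) f ≈ sumTo a f
  sumTo-extend zero    zero    f h = refl
  sumTo-extend zero    (suc b) f h = trans (+-congˡ (trans (sumTo-cong b λ k → h (suc k) (s≤s z≤n)) (sumTo-0 b))) (+-identityʳ _)
  sumTo-extend (suc a) b       f h = +-congˡ (sumTo-extend a b _ λ k a<k → h (suc k) (s≤s a<k))

  -- Two ways of sweeping the triangle k + l ≤ L: by antidiagonals and by rows.
  sumTo-anti : ∀ L F → sumTo L (λ p → anti p F) ≈ anti L (λ k r → sumTo r (F k))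
  sumTo-anti zero    F = refl
  sumTo-anti (suc L) F = begin
    F 0 0 + sumTo L (λ p → F 0 (suc p) + anti p (λ k → F (suc k)))
      ≈⟨ +-congˡ (sumTo-+ L _ _) ⟩
    F 0 0 + (sumTo L (λ p → F 0 (suc p)) + sumTo L (λ p → anti p (λ k → F (suc k))))
      ≈⟨ +-assoc _ _ _ ⟨
    sumTo (suc L) (F 0) + sumTo L (λ p → anti p (λ k → F (suc k)))
      ≈⟨ +-congˡ (sumTo-anti L _) ⟩
    sumTo (suc L) (F 0) + anti L (λ k r → sumTo r (F (suc k))) ∎

  -- The rectangle lies in the triangle k + l ≤ a + b, and F vanishes on the rest of the triangle;
  -- the triangle can then be sorted by k + l.
  rectangle : ∀ a b (F : ℕ → ℕ → Carrier) → (∀ k l → a ℕ.< k → F k l ≈ 0#) → (∀ k l → b ℕ.< l → F k l ≈ 0#) →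
    sumTo a (λ k → sumTo b (F k)) ≈ sumTo (a +ℕ b) (λ p → anti p F)
  rectangle a b F ha hb = sym (begin
    sumTo (a +ℕ b) (λ p → anti p F)                 ≈⟨ sumTo-anti (a +ℕ b) F ⟩
    anti (a +ℕ b) (λ k r → sumTo r (F k))           ≈⟨ anti-cong′ (a +ℕ b) row ⟩
    anti (a +ℕ b) (λ k _ → sumTo b (F k))           ≈⟨ anti-fst (a +ℕ b) _ ⟩
    sumTo (a +ℕ b) (λ k → sumTo b (F k))            ≈⟨ sumTo-extend a b _ (λ k a<k → zero-row b k a<k) ⟩
    sumTo a (λ k → sumTo b (F k))                   ∎)
    where
    zero-row : ∀ n k → a ℕ.< k → sumTo n (F k) ≈ 0#
    zero-row n k a<k = trans (sumTo-cong n λ l → ha k l a<k) (sumTo-0 n)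
    row : ∀ k r → k +ℕ r ≡ a +ℕ b → sumTo r (F k) ≈ sumTo b (F k)
    row k r eq with k ℕₚ.≤? a
    ... | no k≰a  = trans (zero-row r k (ℕₚ.≰⇒> k≰a)) (sym (zero-row b k (ℕₚ.≰⇒> k≰a)))
    ... | yes k≤a = trans (reflexive (≡.cong (λ n → sumTo n (F k)) r≡)) (sumTo-extend b (a ℕ.∸ k) (F k) (hb k))
      where
      r≡ : r ≡ b +ℕ (a ℕ.∸ k)
      r≡ = ℕₚ.+-cancelˡ-≡ k r _ (≡.trans eq (≡.trans (≡.cong (_+ℕ b) (≡.sym (ℕₚ.m+[n∸m]≡n k≤a)))
        (≡.trans (ℕₚ.+-assoc k _ b) (≡.cong (k +ℕ_) (ℕₚ.+-comm (a ℕ.∸ k) b)))))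

  1^ : ∀ n → 1# ^ n ≈ 1#
  1^ zero    = refl
  1^ (suc n) = trans (*-identityˡ _) (1^ n)

  binomial : ∀ m s t → (s + t) ^ m ≈ anti m (λ k l → natR (m C k) * (s ^ k * t ^ l))
  binomial zero    s t = sym (trans (*-congʳ (+-identityʳ 1#)) (trans (*-identityˡ _) (*-identityˡ _)))
  binomial (suc m) s t = begin
    (s + t) * (s + t) ^ m
      ≈⟨ *-congˡ (binomial m s t) ⟩
    (s + t) * B
      ≈⟨ distribʳ _ _ _ ⟩
    s * B + t * B
      ≈⟨ +-cong (trans (anti-*ˡ m s _) (anti-cong m λ k l → solve 4 (λ s c p q → s :* (c :* (p :* q)) := c :* ((s :* p) :* q)) refl s _ _ _))
                (trans (anti-*ˡ m t _) (anti-cong m λ k l → solve 4 (λ t c p q → t :* (c :* (p :* q)) := c :* (p :* (t :* q))) refl t _ _ _)) ⟩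
    anti m (λ k l → natR (m C k) * (s ^ suc k * t ^ l)) + anti m (λ k l → natR (m C k) * (s ^ k * t ^ suc l))
      -- The vanishing term with k = m + 1 is added, so that the second sum becomes one of length m
      -- + 1 from which k = 0 can be split off; then Pascal's rule applies termwise.
      ≈⟨ +-congˡ (trans (sym (+-identityʳ _)) (trans (+-congˡ (sym last0)) (sym (anti-last m (λ k l → natR (m C k) * (s ^ k * t ^ l)))))) ⟩
    anti m (λ k l → natR (m C k) * (s ^ suc k * t ^ l)) + (natR (m C 0) * (s ^ 0 * t ^ suc m) + anti m (λ k l → natR (m C suc k) * (s ^ suc k * t ^ l)))
      ≈⟨ solve 3 (λ a b c → a :+ (b :+ c) := b :+ (a :+ c)) refl _ _ _ ⟩
    natR (m C 0) * (s ^ 0 * t ^ suc m) + (anti m (λ k l → natR (m C k) * (s ^ suc k * t ^ l)) + anti m (λ k l → natR (m C suc k) * (s ^ suc k * t ^ l)))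
      ≈⟨ +-congˡ (anti-+ m _ _) ⟨
    natR (m C 0) * (s ^ 0 * t ^ suc m) + anti m (λ k l → natR (m C k) * (s ^ suc k * t ^ l) + natR (m C suc k) * (s ^ suc k * t ^ l))
      ≈⟨ +-cong refl (anti-cong m λ k l → trans (sym (distribʳ _ _ _)) (*-congʳ (trans (sym (natR-+ (m C k) (m C suc k))) (reflexive (≡.cong natR (nCk+nC[k+1]≡[n+1]C[k+1] m k)))))) ⟩
    anti (suc m) (λ k l → natR (suc m C k) * (s ^ k * t ^ l)) ∎
    where
    B = anti m (λ k l → natR (m C k) * (s ^ k * t ^ l))
    last0 : natR (m C suc m) * (s ^ suc m * t ^ 0) ≈ 0#
    last0 = trans (*-congʳ (reflexive (≡.cong natR (k>n⇒nCk≡0 (ℕₚ.n<1+n m))))) (zeroˡ _)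

  geometric : ∀ N s t → (s - t) * anti N (λ a b → s ^ a * t ^ b) ≈ s ^ suc N - t ^ suc N
  geometric zero    s t = solve 2 (λ s t → (s :- t) :* (con (1 , 0) :* con (1 , 0)) := s :* con (1 , 0) :- t :* con (1 , 0)) refl s t
  geometric (suc N) s t = begin
    (s - t) * (1# * t ^ suc N + anti N (λ a b → s ^ suc a * t ^ b))
      ≈⟨ *-congˡ (+-congˡ (trans (anti-cong N λ a b → *-assoc _ _ _) (sym (anti-*ˡ N s _)))) ⟩
    (s - t) * (1# * t ^ suc N + s * A)
      ≈⟨ solve 4 (λ s t T A → (s :- t) :* (con (1 , 0) :* T :+ s :* A) := (s :- t) :* T :+ s :* ((s :- t) :* A)) refl s t (t ^ suc N) A ⟩
    (s - t) * t ^ suc N + s * ((s - t) * A)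
      ≈⟨ +-congˡ (*-congˡ (geometric N s t)) ⟩
    (s - t) * t ^ suc N + s * (s ^ suc N - t ^ suc N)
      ≈⟨ solve 4 (λ s t S T → (s :- t) :* T :+ s :* (S :- T) := s :* S :- t :* T) refl s t (s ^ suc N) (t ^ suc N) ⟩
    s ^ suc (suc N) - t ^ suc (suc N) ∎
    where A = anti N (λ a b → s ^ a * t ^ b)

  -- Non-zero-divisors. Cancellation is a property of single elements because the coefficient rings,
  -- such as the shuffle algebra, are not assumed to be domains.
  Cancellable : Carrier → Set (c ⊔ ℓ)
  Cancellable x = ∀ y → x * y ≈ 0# → y ≈ 0#

  cancel : ∀ {x} → Cancellable x → ∀ {y z} → x * y ≈ x * z → y ≈ z
  cancel {x} cx {y} {z} e = begin
    y            ≈⟨ solve 2 (λ y z → y := (y :- z) :+ z) refl y z ⟩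
    (y - z) + z  ≈⟨ +-congʳ (cx (y - z) (trans (solve 3 (λ x y z → x :* (y :- z) := x :* y :- x :* z) refl x y z) (trans (+-congʳ e) (-‿inverseʳ _)))) ⟩
    0# + z       ≈⟨ +-identityˡ z ⟩
    z            ∎

  Cancellable-* : ∀ {x y} → Cancellable x → Cancellable y → Cancellable (x * y)
  Cancellable-* cx cy z e = cy z (cx _ (trans (sym (*-assoc _ _ _)) e))

  Cancellable-resp : ∀ {x y} → x ≈ y → Cancellable x → Cancellable y
  Cancellable-resp e cx z h = cx z (trans (*-congʳ e) h)

record Hom {a ℓ₁ b ℓ₂ : Level} (R : CommutativeRing a ℓ₁) (S : CommutativeRing b ℓ₂) : Set (a ⊔ ℓ₁ ⊔ b ⊔ ℓ₂) where
  private
    module R = RingKit R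
    module S = RingKit S
  field
    ⟦_⟧    : R.Carrier → S.Carrier
    ⟦⟧-cong : ∀ {x y} → x R.≈ y → ⟦ x ⟧ S.≈ ⟦ y ⟧
    ⟦⟧-+    : ∀ x y → ⟦ x R.+ y ⟧ S.≈ ⟦ x ⟧ S.+ ⟦ y ⟧
    ⟦⟧-*    : ∀ x y → ⟦ x R.* y ⟧ S.≈ ⟦ x ⟧ S.* ⟦ y ⟧
    ⟦⟧-1    : ⟦ R.1# ⟧ S.≈ S.1#

  ⟦⟧-0 : ⟦ R.0# ⟧ S.≈ S.0#
  ⟦⟧-0 = begin
    z              ≈⟨ solve 1 (λ z → z := (z :+ z) :- z) S.refl z ⟩
    (z S.+ z) S.- z ≈⟨ S.+-congʳ (S.trans (S.sym (⟦⟧-+ R.0# R.0#)) (⟦⟧-cong (R.+-identityˡ R.0#))) ⟩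
    z S.- z        ≈⟨ S.-‿inverseʳ z ⟩
    S.0#           ∎
    where
    open S
    z = ⟦ R.0# ⟧

  ⟦⟧-neg : ∀ x → ⟦ R.- x ⟧ S.≈ S.- ⟦ x ⟧
  ⟦⟧-neg x = begin
    ⟦ R.- x ⟧                        ≈⟨ solve 2 (λ y x → y := (x :+ y) :- x) S.refl ⟦ R.- x ⟧ ⟦ x ⟧ ⟩
    (⟦ x ⟧ S.+ ⟦ R.- x ⟧) S.- ⟦ x ⟧  ≈⟨ S.+-congʳ (S.trans (S.sym (⟦⟧-+ _ _)) (S.trans (⟦⟧-cong (R.-‿inverseʳ x)) ⟦⟧-0)) ⟩
    S.0# S.- ⟦ x ⟧                   ≈⟨ S.+-identityˡ _ ⟩
    S.- ⟦ x ⟧                        ∎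
    where open S

  ⟦⟧-natR : ∀ n → ⟦ R.natR n ⟧ S.≈ S.natR n
  ⟦⟧-natR zero    = ⟦⟧-0
  ⟦⟧-natR (suc n) = S.trans (⟦⟧-+ _ _) (S.+-cong ⟦⟧-1 (⟦⟧-natR n))

  ⟦⟧-^ : ∀ x n → ⟦ x R.^ n ⟧ S.≈ ⟦ x ⟧ S.^ n
  ⟦⟧-^ x zero    = ⟦⟧-1
  ⟦⟧-^ x (suc n) = S.trans (⟦⟧-* _ _) (S.*-congˡ (⟦⟧-^ x n))

  ⟦⟧-anti : ∀ N F → ⟦ R.anti N F ⟧ S.≈ S.anti N (λ a b → ⟦ F a b ⟧)
  ⟦⟧-anti zero    F = S.refl
  ⟦⟧-anti (suc N) F = S.trans (⟦⟧-+ _ _) (S.+-congˡ (⟦⟧-anti N _))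

_∘ʰ_ : ∀ {a ℓ₁ b ℓ₂ c ℓ₃} {R : CommutativeRing a ℓ₁} {S : CommutativeRing b ℓ₂} {T : CommutativeRing c ℓ₃} → Hom S T → Hom R S → Hom R T
_∘ʰ_ {T = T} g f = record
  { ⟦_⟧ = λ x → G.⟦ F.⟦ x ⟧ ⟧
  ; ⟦⟧-cong = λ e → G.⟦⟧-cong (F.⟦⟧-cong e)
  ; ⟦⟧-+ = λ x y → trans (G.⟦⟧-cong (F.⟦⟧-+ x y)) (G.⟦⟧-+ _ _)
  ; ⟦⟧-* = λ x y → trans (G.⟦⟧-cong (F.⟦⟧-* x y)) (G.⟦⟧-* _ _)
  ; ⟦⟧-1 = trans (G.⟦⟧-cong F.⟦⟧-1) G.⟦⟧-1
  }
  where
  module F = Hom f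
  module G = Hom g
  open CommutativeRing T

-- Formal power series in one, two and three variables.

module PowerSeries {c ℓ : Level} (R : CommutativeRing c ℓ) where
  open RingKit R

  PS : CommutativeRing c ℓ
  PS = record
    { Carrier = ℕ → Carrier
    ; _≈_ = λ f g → ∀ n → f n ≈ g n
    ; _+_ = λ f g n → f n + g n
    ; _*_ = _⊛_
    ; -_ = λ f n → - f n
    ; 0# = λ _ → 0#
    ; 1# = one
    ; isCommutativeRing = record
      { isRing = record
        { +-isAbelianGroup = record
          { isGroup = record
            { isMonoid = record
              { isSemigroup = record
                { isMagma = record
                  { isEquivalence = record
                    { refl = λ _ → refl
                    ; sym = λ e n → sym (e n)
                    ; trans = λ e f n → trans (e n) (f n)
                    }
                  ; ∙-cong = λ e f n → +-cong (e n) (f n)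
                  }
                ; assoc = λ f g h n → +-assoc _ _ _
                }
              ; identity = (λ f n → +-identityˡ _) , (λ f n → +-identityʳ _)
              }
            ; inverse = (λ f n → -‿inverseˡ _) , (λ f n → -‿inverseʳ _)
            ; ⁻¹-cong = λ e n → -‿cong (e n)
            }
          ; comm = λ f g n → +-comm _ _
          }
        ; *-cong = λ e f n → anti-cong n λ a b → *-cong (e a) (f b)
        ; *-assoc = ⊛-assoc
        ; *-identity = identˡ , λ f n → trans (⊛-comm f one n) (identˡ f n)
        ; distrib = (λ f g h n → trans (anti-cong n λ a b → distribˡ _ _ _) (anti-+ n _ _))
                  , (λ f g h n → trans (anti-cong n λ a b → distribʳ _ _ _) (anti-+ n _ _))
        }
      ; *-comm = ⊛-comm
      }
    }
    where
    _⊛_ : (ℕ → Carrier) → (ℕ → Carrier) → ℕ → Carrier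
    (f ⊛ g) n = anti n (λ a b → f a * g b)

    one : ℕ → Carrier
    one zero    = 1#
    one (suc _) = 0#

    ⊛-comm : ∀ f g n → (f ⊛ g) n ≈ (g ⊛ f) n
    ⊛-comm f g n = trans (anti-flip n _) (anti-cong n λ a b → *-comm _ _)

    ⊛-assoc : ∀ f g h n → ((f ⊛ g) ⊛ h) n ≈ (f ⊛ (g ⊛ h)) n
    ⊛-assoc f g h n = begin
      anti n (λ m k → anti m (λ a b → f a * g b) * h k)
        ≈⟨ anti-cong n (λ m k → trans (anti-*ʳ m _ _) (anti-cong m λ a b → *-assoc _ _ _)) ⟩
      anti n (λ m k → anti m (λ a b → f a * (g b * h k)))
        ≈⟨ anti-assoc n (λ a b k → f a * (g b * h k)) ⟨
      anti n (λ a m → anti m (λ b k → f a * (g b * h k)))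
        ≈⟨ anti-cong n (λ a m → anti-*ˡ m _ _) ⟨
      anti n (λ a m → f a * anti m (λ b k → g b * h k)) ∎

    identˡ : ∀ f n → (one ⊛ f) n ≈ f n
    identˡ f zero    = *-identityˡ _
    identˡ f (suc n) = trans (+-cong (*-identityˡ _) (anti-0′ n λ a b _ → zeroˡ _)) (+-identityʳ _)

  module PS = RingKit PS

  const : Carrier → PS.Carrier
  const x zero    = x
  const x (suc _) = 0#

  X : PS.Carrier
  X zero          = 0#
  X (suc zero)    = 1#
  X (suc (suc _)) = 0#

  const-* : ∀ x f n → (const x PS.* f) n ≈ x * f n
  const-* x f zero    = refl
  const-* x f (suc n) = trans (+-congˡ (anti-0′ n λ a b _ → zeroˡ _)) (+-identityʳ _)

  X-*-zero : ∀ f → (X PS.* f) 0 ≈ 0#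
  X-*-zero f = zeroˡ _

  X-*-suc : ∀ f n → (X PS.* f) (suc n) ≈ f n
  X-*-suc f zero    = trans (+-cong (zeroˡ _) (*-identityˡ _)) (+-identityˡ _)
  X-*-suc f (suc n) = trans (+-cong (zeroˡ _) (trans (+-cong (*-identityˡ _) (anti-0′ n λ a b _ → zeroˡ _)) (+-identityʳ _))) (+-identityˡ _)

  constʰ : Hom R PS
  constʰ = record
    { ⟦_⟧ = const
    ; ⟦⟧-cong = λ { e zero → e ; e (suc _) → refl }
    ; ⟦⟧-+ = λ { x y zero → refl ; x y (suc _) → sym (+-identityˡ _) }
    ; ⟦⟧-* = λ { x y zero → refl ; x y (suc n) → sym (trans (const-* x (const y) (suc n)) (zeroʳ _)) }
    ; ⟦⟧-1 = λ { zero → refl ; (suc _) → refl }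
    }

  anti-coeff : ∀ N F k → PS.anti N F k ≡ anti N (λ a b → F a b k)
  anti-coeff zero    F k = ≡.refl
  anti-coeff (suc N) F k = ≡.cong (F 0 (suc N) k +_) (anti-coeff N _ k)

  -- Once the lower coefficients of g are known to vanish, degree k of f g is f 0 times g k; the
  -- coefficients of g die one after the other.
  cancellable-const : ∀ f → Cancellable (f 0) → PS.Cancellable f
  cancellable-const f c₀ g e n = below (suc n) n ℕₚ.≤-refl
    where
    below : ∀ m k → k ℕ.< m → g k ≈ 0#
    below (suc m) k (s≤s k≤m) = c₀ (g k) (begin
      f 0 * g k                                     ≈⟨ lead k (λ j j<k → below m j (ℕₚ.<-≤-trans j<k k≤m)) ⟩
      anti k (λ a b → f a * g b)                    ≈⟨ e k ⟩
      0#                                            ∎)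
      where
      lead : ∀ k → (∀ j → j ℕ.< k → g j ≈ 0#) → f 0 * g k ≈ anti k (λ a b → f a * g b)
      lead zero    _ = refl
      lead (suc k) h = sym (trans (+-congˡ (anti-0′ k λ a b eq → trans (*-congˡ (h b (s≤s (ℕₚ.≤-trans (ℕₚ.m≤n+m b a) (ℕₚ.≤-reflexive eq))))) (zeroʳ _))) (+-identityʳ _))

  cancellable-X : PS.Cancellable X
  cancellable-X g e n = trans (sym (X-*-suc g n)) (e (suc n))

  X^-diag : ∀ k → (X PS.^ k) k ≈ 1#
  X^-diag zero    = refl
  X^-diag (suc k) = trans (X-*-suc (X PS.^ k) k) (X^-diag k)

  X^-above : ∀ k n → n ℕ.< k → (X PS.^ k) n ≈ 0#
  X^-above (suc k) zero    _         = X-*-zero (X PS.^ k)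
  X^-above (suc k) (suc n) (s≤s n<k) = trans (X-*-suc (X PS.^ k) n) (X^-above k n n<k)

  -- `X ^ c` is concentrated in degree c, so only c = k contributes, and the total index then forces
  -- a = j.
  coeff-extract : ∀ j k (F : ℕ → ℕ → Carrier) → PS.anti (k +ℕ j) (λ a c → const (F a c) PS.* X PS.^ c) k ≈ F j k
  coeff-extract j k F = begin
    PS.anti (k +ℕ j) (λ a c → const (F a c) PS.* X PS.^ c) k  ≈⟨ reflexive (anti-coeff (k +ℕ j) _ k) ⟩
    anti (k +ℕ j) (λ a c → (const (F a c) PS.* X PS.^ c) k)   ≈⟨ anti-cong (k +ℕ j) (λ a c → const-* (F a c) (X PS.^ c) k) ⟩
    anti (k +ℕ j) (λ a c → F a c * (X PS.^ c) k)              ≈⟨ anti-flip (k +ℕ j) _ ⟩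
    anti (k +ℕ j) (λ c a → F a c * (X PS.^ c) k)              ≈⟨ go k (λ c a → F a c) ⟩
    F j k ∎
    where
    go : ∀ k G → anti (k +ℕ j) (λ c a → G c a * (X PS.^ c) k) ≈ G k j
    go zero G = first j
      where
      first : ∀ j → anti j (λ c a → G c a * (X PS.^ c) 0) ≈ G 0 j
      first zero    = *-identityʳ _
      first (suc j) = trans (+-cong (*-identityʳ _) (anti-0′ j λ a b _ → trans (*-congˡ (X-*-zero (X PS.^ a))) (zeroʳ _))) (+-identityʳ _)
    go (suc k) G = trans (+-cong (zeroʳ _) (trans (anti-cong (k +ℕ j) λ c a → *-congˡ (X-*-suc (X PS.^ c) k)) (go k (λ c → G (suc c))))) (+-identityˡ _)

  -- f(τh) as a power series in h.
  at : Carrier → PS.Carrier → PS.Carrier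
  at τ f n = f n * τ ^ n

  at-cong : ∀ τ {f g} → f PS.≈ g → at τ f PS.≈ at τ g
  at-cong τ e n = *-congʳ (e n)

  at-cong-τ : ∀ {σ τ} f → σ ≈ τ → at σ f PS.≈ at τ f
  at-cong-τ f e n = *-congˡ (^-congˡ n e)

  at-* : ∀ τ f g → at τ (f PS.* g) PS.≈ at τ f PS.* at τ g
  at-* τ f g n = trans (anti-*ʳ n _ _) (anti-cong′ n λ a b e →
    trans (*-congˡ (trans (reflexive (≡.cong (τ ^_) (≡.sym e))) (^-homo-* τ a b)))
          (solve 4 (λ x y p q → (x :* y) :* (p :* q) := (x :* p) :* (y :* q)) refl _ _ _ _))

  at-1 : ∀ τ → at τ PS.1# PS.≈ PS.1#
  at-1 τ zero    = *-identityˡ _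
  at-1 τ (suc n) = zeroˡ _

  at-X : ∀ τ → at τ X PS.≈ const τ PS.* X
  at-X τ n = trans (go n) (sym (const-* τ X n))
    where
    go : ∀ n → X n * τ ^ n ≈ τ * X n
    go zero          = trans (zeroˡ _) (sym (zeroʳ _))
    go (suc zero)    = solve 1 (λ t → con (1 , 0) :* (t :* con (1 , 0)) := t :* con (1 , 0)) refl τ
    go (suc (suc n)) = trans (zeroˡ _) (sym (zeroʳ _))

module TwoVar {c ℓ : Level} (R : CommutativeRing c ℓ) where
  module P₁ = PowerSeries R
  module P₂ = PowerSeries P₁.PS
  private
    module R = RingKit R
    module R₁ = P₁.PS
    module R₂ = P₂.PS

  ι : Hom R P₂.PS
  ι = P₂.constʰ ∘ʰ P₁.constʰ
  open Hom ι

  s t : R₂.Carrier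
  s = P₂.const P₁.X
  t = P₂.X

  -- The part of degree N of the generating function Σ F a b s^a t^b; working degree by degree keeps
  -- every sum finite.
  GF : ℕ → (ℕ → ℕ → R.Carrier) → R₂.Carrier
  GF N F = R₂.anti N (λ a b → ⟦ F a b ⟧ R₂.* (s R₂.^ a R₂.* t R₂.^ b))

  private
    regroup : ∀ N F → GF N F R₂.≈ R₂.anti N (λ a b → P₂.const (P₁.const (F a b) R₁.* P₁.X R₁.^ a) R₂.* t R₂.^ b)
    regroup N F = R₂.anti-cong N λ a b → R₂.trans (R₂.sym (R₂.*-assoc _ _ _)) (R₂.*-congʳ
      (R₂.trans (R₂.*-congˡ (R₂.sym (Hom.⟦⟧-^ P₂.constʰ P₁.X a))) (R₂.sym (Hom.⟦⟧-* P₂.constʰ _ _))))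

    coeff : ∀ a b F → GF (b +ℕ a) F b a R.≈ F a b
    coeff a b F = R.trans (regroup (b +ℕ a) F b a)
      (R.trans (P₂.coeff-extract a b (λ a b → P₁.const (F a b) R₁.* P₁.X R₁.^ a) a)
        (R.trans (P₁.const-* (F a b) (P₁.X R₁.^ a) a) (R.trans (R.*-congˡ (P₁.X^-diag a)) (R.*-identityʳ _))))

  -- The monomial s^a t^b occurs in degree b + a only, so the homogeneous parts determine the table
  -- F. Identities between structure constants are proved in this way.
  GF-injective : ∀ F G → (∀ N → GF N F R₂.≈ GF N G) → ∀ a b → F a b R.≈ G a b
  GF-injective F G e a b = R.trans (R.sym (coeff a b F)) (R.trans (e (b +ℕ a) b a) (coeff a b G))

  cancellable-s : R₂.Cancellable s
  cancellable-s = P₂.cancellable-const s P₁.cancellable-X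

  -- The constant term with respect to the outer variable t is the inner variable s.
  cancellable-s-t : R₂.Cancellable (s R₂.- t)
  cancellable-s-t = P₂.cancellable-const (s R₂.- t) (R₁.Cancellable-resp (R₁.sym (R₁.trans (R₁.+-congˡ {P₁.X} R₁.-0≈0) (R₁.+-identityʳ P₁.X))) P₁.cancellable-X)

  cancellable-t : R₂.Cancellable t
  cancellable-t = P₂.cancellable-X

module ThreeVar {c ℓ : Level} (R : CommutativeRing c ℓ) where
  open TwoVar R public
  module P₃ = PowerSeries P₂.PS
  private
    module R = RingKit R
    module R₂ = P₂.PS
    module R₃ = P₃.PS

  ι₃ : Hom R P₃.PS
  ι₃ = P₃.constʰ ∘ʰ ι
  open Hom ι₃

  s₃ t₃ r₃ : R₃.Carrier
  s₃ = P₃.const s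
  t₃ = P₃.const t
  r₃ = P₃.X

  GF₃ : ℕ → (ℕ → ℕ → ℕ → R.Carrier) → R₃.Carrier
  GF₃ N F = R₃.anti N (λ M k → R₃.anti M (λ a b → ⟦ F a b k ⟧ R₃.* (s₃ R₃.^ a R₃.* t₃ R₃.^ b)) R₃.* r₃ R₃.^ k)

  private
    regroup : ∀ N F → GF₃ N F R₃.≈ R₃.anti N (λ M k → P₃.const (GF M (λ a b → F a b k)) R₃.* r₃ R₃.^ k)
    regroup N F = R₃.anti-cong N λ M k → R₃.*-congʳ (R₃.sym (R₃.trans (Hom.⟦⟧-anti P₃.constʰ M _) (R₃.anti-cong M λ a b →
      R₃.trans (Hom.⟦⟧-* P₃.constʰ _ _) (R₃.*-congˡ (R₃.trans (Hom.⟦⟧-* P₃.constʰ _ _) (R₃.*-cong (Hom.⟦⟧-^ P₃.constʰ s a) (Hom.⟦⟧-^ P₃.constʰ t b)))))))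

  GF₃-injective : ∀ F G → (∀ N → GF₃ N F R₃.≈ GF₃ N G) → ∀ a b k → F a b k R.≈ G a b k
  GF₃-injective F G e a b k = GF-injective (λ a b → F a b k) (λ a b → G a b k) (λ M →
    R₂.trans (R₂.sym (P₃.coeff-extract M k _))
      (R₂.trans (R₂.sym (regroup (k +ℕ M) F k)) (R₂.trans (e (k +ℕ M) k) (R₂.trans (regroup (k +ℕ M) G k) (P₃.coeff-extract M k _))))) a b

-- Sums and products over a finite field: Fermat's theorem, power sums, binomial coefficients.

module SumLemmas {c ℓ} (M : CommutativeMonoid c ℓ) where
  open CommutativeMonoid M renaming (_∙_ to _+_; ε to 0#; ∙-cong to +-cong; ∙-congˡ to +-congˡ; assoc to +-assoc; comm to +-comm)
  open MonoidSum M public using (sum; sum-cong-≋; sum-remove; sum-permute; ∑-distrib-+)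

  copies : ℕ → Carrier → Carrier
  copies zero    x = 0#
  copies (suc n) x = x + copies n x

  sum-constant : ∀ n {f : Fin n → Carrier} {x} → (∀ i → f i ≈ x) → sum f ≈ copies n x
  sum-constant zero    h = refl
  sum-constant (suc n) h = +-cong (h zero) (sum-constant n λ i → h (suc i))

  sum-except : ∀ n (f : Fin (suc n) → Carrier) {x} i → (∀ j → ¬ (i ≡ j) → f j ≈ x) → sum f ≈ f i + copies n x
  sum-except n f i h = trans (sum-remove {i = i} f) (+-congˡ (sum-constant n λ j → h (punchIn i j) λ e → Finₚ.punchInᵢ≢i i j (≡.sym e)))

module FieldFacts {c ℓ : Level} (e : ℕ) (F : FiniteField c ℓ (suc (suc e))) where
  open FiniteField F using (1≉0; inverse; enum; enum-injective; enum-surjective) renaming (ring to K) public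
  open RingKit K

  d q : ℕ
  d = suc e
  q = suc d

  index : Carrier → Fin q
  index x = proj₁ (enum-surjective x)

  enum-index : ∀ x → enum (index x) ≈ x
  enum-index x = proj₂ (enum-surjective x)

  infix 4 _≈?_

  abstract
    _≈?_ : ∀ x y → Dec (x ≈ y)
    x ≈? y = map′ (λ eq → trans (sym (enum-index x)) (trans (reflexive (≡.cong enum eq)) (enum-index y)))
                  (λ eq → enum-injective _ _ (trans (enum-index x) (trans eq (sym (enum-index y)))))
                  (index x Finₚ.≟ index y)

  domain : ∀ {x y} → ¬ (x ≈ 0#) → x * y ≈ 0# → y ≈ 0#
  domain {x} {y} x≉0 xy≈0 with inverse x x≉0
  ... | z , xz≈1 = begin
    y             ≈⟨ *-identityˡ y ⟨
    1# * y        ≈⟨ *-congʳ xz≈1 ⟨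
    (x * z) * y   ≈⟨ solve 3 (λ x y z → (x :* z) :* y := z :* (x :* y)) refl x y z ⟩
    z * (x * y)   ≈⟨ *-congˡ xy≈0 ⟩
    z * 0#        ≈⟨ zeroʳ z ⟩
    0#            ∎

  module Over {m ℓ′} (M : CommutativeMonoid m ℓ′) where
    private module M = CommutativeMonoid M
    open SumLemmas M

    abstract
      ∑F : (Carrier → M.Carrier) → M.Carrier
      ∑F f = sum (λ i → f (enum i))

      ∑F-unfold : ∀ f → ∑F f ≡ sum (λ i → f (enum i))
      ∑F-unfold f = ≡.refl

      ∑F-cong : ∀ {f g} → (∀ x → f x M.≈ g x) → ∑F f M.≈ ∑F g
      ∑F-cong h = sum-cong-≋ (λ i → h (enum i))

      -- Conjugation with `enum` turns the bijection h of the field into a permutation of `Fin q`.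
      ∑F-reindex : ∀ f → (∀ {x y} → x ≈ y → f x M.≈ f y) → (h h⁻¹ : Carrier → Carrier) →
        (∀ {x y} → x ≈ y → h x ≈ h y) → (∀ {x y} → x ≈ y → h⁻¹ x ≈ h⁻¹ y) →
        (∀ x → h (h⁻¹ x) ≈ x) → (∀ x → h⁻¹ (h x) ≈ x) → ∑F (λ x → f (h x)) M.≈ ∑F f
      ∑F-reindex f f-cong h h⁻¹ h-cong h⁻¹-cong hh⁻¹ h⁻¹h =
        M.trans (sum-cong-≋ λ i → f-cong (sym (enum-index (h (enum i))))) (M.sym (sum-permute (λ i → f (enum i)) π))
        where
        π : Permutation q q
        π = permutation (λ i → index (h (enum i))) (λ i → index (h⁻¹ (enum i)))
          (λ i → enum-injective _ _ (trans (enum-index _) (trans (h-cong (enum-index _)) (hh⁻¹ _))))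
          (λ i → enum-injective _ _ (trans (enum-index _) (trans (h⁻¹-cong (enum-index _)) (h⁻¹h _))))

      ∑F-except : ∀ f x y → (∀ {x y} → x ≈ y → f x M.≈ f y) → (∀ z → ¬ (z ≈ x) → f z M.≈ y) → ∑F f M.≈ f x M.∙ copies d y
      ∑F-except f x y f-cong h = M.trans
        (sum-except d (λ i → f (enum i)) (index x) λ j ne → h (enum j) λ eq → ne (enum-injective _ _ (trans (enum-index x) (sym eq))))
        (M.∙-congʳ (f-cong (enum-index x)))

      ∑F-distrib : ∀ f g → ∑F (λ x → f x M.∙ g x) M.≈ ∑F f M.∙ ∑F g
      ∑F-distrib f g = ∑-distrib-+ (λ i → f (enum i)) (λ i → g (enum i))

  module ∏ where
    open Over *-commutativeMonoid public
    open SumLemmas *-commutativeMonoid public using (copies)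

  private
    -- A neutral value at 0 lets sums and products over the nonzero elements run over the whole
    -- field.
    ifZero : Carrier → Carrier → Carrier → Carrier
    ifZero x y z = if does (x ≈? 0#) then y else z

    ifZero-yes : ∀ {x y z} → x ≈ 0# → ifZero x y z ≈ y
    ifZero-yes {x} x≈0 with x ≈? 0#
    ... | yes _  = refl
    ... | no x≉0 = ⊥-elim (x≉0 x≈0)

    ifZero-no : ∀ {x y z} → ¬ (x ≈ 0#) → ifZero x y z ≈ z
    ifZero-no {x} x≉0 with x ≈? 0#
    ... | yes x≈0 = ⊥-elim (x≉0 x≈0)
    ... | no _    = refl

  copies-^ : ∀ n g → ∏.copies n g ≈ g ^ n
  copies-^ zero    g = refl
  copies-^ (suc n) g = *-congˡ (copies-^ n g)

  nonzero-* : ∀ {x y} → ¬ (x ≈ 0#) → ¬ (y ≈ 0#) → ¬ (x * y ≈ 0#)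
  nonzero-* x≉0 y≉0 e = y≉0 (domain x≉0 e)

  module _ (g g⁻¹ : Carrier) (inv : g * g⁻¹ ≈ 1#) where
    private
      cancelˡ : ∀ x → g * (g⁻¹ * x) ≈ x
      cancelˡ x = trans (sym (*-assoc _ _ _)) (trans (*-congʳ inv) (*-identityˡ x))

      cancelʳ : ∀ x → g⁻¹ * (g * x) ≈ x
      cancelʳ x = trans (solve 3 (λ g h x → h :* (g :* x) := g :* (h :* x)) refl g g⁻¹ x) (cancelˡ x)

      cancel-0 : ∀ {x} → g * x ≈ 0# → x ≈ 0#
      cancel-0 {x} e = trans (sym (cancelʳ x)) (trans (*-congˡ e) (zeroʳ _))

    module Dilation {m ℓ′} (M : CommutativeMonoid m ℓ′) where
      ∑F-dilate : ∀ f → (∀ {x y} → x ≈ y → CommutativeMonoid._≈_ M (f x) (f y)) → CommutativeMonoid._≈_ M (Over.∑F M (λ x → f (g * x))) (Over.∑F M f)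
      ∑F-dilate f f-cong = Over.∑F-reindex M f f-cong (g *_) (g⁻¹ *_) *-congˡ *-congˡ cancelˡ cancelʳ

    -- Multiplication by g permutes the nonzero elements, so their product W satisfies W g^d = W,
    -- and W is nonzero. Both `u` and `w` take the value 1 at 0.
    unit-^d : g ^ d ≈ 1#
    unit-^d = begin
      g ^ d                      ≈⟨ copies-^ d g ⟨
      ∏.copies d g               ≈⟨ *-identityˡ _ ⟨
      1# * ∏.copies d g          ≈⟨ *-congʳ (ifZero-yes refl) ⟨
      u 0# * ∏.copies d g        ≈⟨ ∏.∑F-except u 0# g (λ {x} {y} → u-cong x y) (λ z z≉0 → ifZero-no z≉0) ⟨
      U                          ≈⟨ lemma ⟩
      1#                         ∎
      where
      u w : Carrier → Carrier
      u x = ifZero x 1# g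
      w x = ifZero x 1# x
      U = ∏.∑F u
      W = ∏.∑F w

      u-cong : ∀ x y → x ≈ y → u x ≈ u y
      u-cong x y x≈y with x ≈? 0#
      ... | yes x≈0 = sym (ifZero-yes (trans (sym x≈y) x≈0))
      ... | no x≉0  = sym (ifZero-no (λ y≈0 → x≉0 (trans x≈y y≈0)))

      w-cong : ∀ x y → x ≈ y → w x ≈ w y
      w-cong x y x≈y with x ≈? 0#
      ... | yes x≈0 = sym (ifZero-yes (trans (sym x≈y) x≈0))
      ... | no x≉0  = trans x≈y (sym (ifZero-no (λ y≈0 → x≉0 (trans x≈y y≈0))))

      w-dilate : ∀ x → w (g * x) ≈ u x * w x
      w-dilate x with x ≈? 0#
      ... | yes x≈0 = trans (ifZero-yes (trans (*-congˡ x≈0) (zeroʳ g))) (sym (*-identityˡ _))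
      ... | no x≉0  = ifZero-no (λ gx≈0 → x≉0 (cancel-0 gx≈0))

      w-nonzero : ∀ x → ¬ (w x ≈ 0#)
      w-nonzero x with x ≈? 0#
      ... | yes _  = 1≉0
      ... | no x≉0 = x≉0

      product-nonzero : ∀ n (f : Fin n → Carrier) → (∀ i → ¬ (f i ≈ 0#)) → ¬ (SumLemmas.sum *-commutativeMonoid f ≈ 0#)
      product-nonzero zero    f h = 1≉0
      product-nonzero (suc n) f h = nonzero-* (h zero) (product-nonzero n (f ∘ suc) (h ∘ suc))

      UW≈W : W * U ≈ W * 1#
      UW≈W = begin
        W * U                      ≈⟨ *-comm _ _ ⟩
        U * W                      ≈⟨ ∏.∑F-distrib u w ⟨
        ∏.∑F (λ x → u x * w x)     ≈⟨ ∏.∑F-cong (λ x → sym (w-dilate x)) ⟩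
        ∏.∑F (λ x → w (g * x))     ≈⟨ Dilation.∑F-dilate *-commutativeMonoid w (λ {x} {y} → w-cong x y) ⟩
        W                          ≈⟨ *-identityʳ W ⟨
        W * 1#                     ∎

      lemma : U ≈ 1#
      lemma = cancel (λ y → domain (λ z → product-nonzero q (w ∘ enum) (w-nonzero ∘ enum) (trans (reflexive (≡.sym (∏.∑F-unfold w))) z))) UW≈W

  fermat : ∀ {x} → ¬ (x ≈ 0#) → x ^ d ≈ 1#
  fermat {x} x≉0 = unit-^d x (proj₁ (inverse x x≉0)) (proj₂ (inverse x x≉0))

  fermat′ : ∀ x → x ^ q ≈ x
  fermat′ x with x ≈? 0#
  ... | yes x≈0 = trans (*-congʳ x≈0) (trans (zeroˡ _) (sym x≈0))
  ... | no x≉0  = trans (*-congˡ (fermat x≉0)) (*-identityʳ x)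

  -- Fermat settles both parities at once: for even q the exponent d is odd, but then -1 = 1.
  -1^d : (- 1#) ^ d ≈ 1#
  -1^d = fermat (λ e → 1≉0 (trans (sym (-‿involutive 1#)) (trans (-‿cong e) -0≈0)))

  eval : List Carrier → Carrier → Carrier
  eval []       x = 0#
  eval (k ∷ ks) x = k + x * eval ks x

  -- Horner's scheme: for the polynomial H with coefficient list ks this is the quotient of X H(X) -
  -- a H(a) by X - a.
  quotient : Carrier → List Carrier → List Carrier
  quotient a []         = []
  quotient a (k ∷ ks) = eval (k ∷ ks) a ∷ quotient a ks

  length-quotient : ∀ a ks → length (quotient a ks) ≡ length ks
  length-quotient a []       = ≡.refl
  length-quotient a (k ∷ ks) = ≡.cong suc (length-quotient a ks)

  eval-quotient : ∀ a ks x → x * eval ks x - a * eval ks a ≈ (x - a) * eval (quotient a ks) x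
  eval-quotient a []       x = solve 2 (λ a x → x :* con (0 , 0) :- a :* con (0 , 0) := (x :- a) :* con (0 , 0)) refl a x
  eval-quotient a (k ∷ ks) x = begin
    x * (k + x * p) - a * (k + a * r)
      ≈⟨ solve 5 (λ a x k p r → x :* (k :+ x :* p) :- a :* (k :+ a :* r) := (x :- a) :* (k :+ a :* r) :+ x :* (x :* p :- a :* r)) refl a x k p r ⟩
    (x - a) * (k + a * r) + x * (x * p - a * r)
      ≈⟨ +-congˡ (*-congˡ (eval-quotient a ks x)) ⟩
    (x - a) * (k + a * r) + x * ((x - a) * Q)
      ≈⟨ solve 5 (λ a x k r Q → (x :- a) :* (k :+ a :* r) :+ x :* ((x :- a) :* Q) := (x :- a) :* ((k :+ a :* r) :+ x :* Q)) refl a x k r Q ⟩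
    (x - a) * ((k + a * r) + x * Q) ∎
    where
    p = eval ks x
    r = eval ks a
    Q = eval (quotient a ks) x

  quotient-zero : ∀ a ks → All (_≈ 0#) (quotient a ks) → eval ks a ≈ 0# × All (_≈ 0#) ks
  quotient-zero a []       _ = refl , []
  quotient-zero a (k ∷ ks) (h ∷ hs) with quotient-zero a ks hs
  ... | r≈0 , ks≈0 = h , (begin
    k                  ≈⟨ +-identityʳ k ⟨
    k + 0#             ≈⟨ +-congˡ (trans (*-congˡ r≈0) (zeroʳ a)) ⟨
    k + a * eval ks a  ≈⟨ h ⟩
    0#                 ∎) ∷ ks≈0

  -- Dividing by X - a for the root a = x 0 leaves one coefficient less, and the quotient still
  -- vanishes at the other points because x i - a is nonzero there.
  many-roots : ∀ n p (x : Fin n → Carrier) → (∀ i j → x i ≈ x j → i ≡ j) → length p ℕ.≤ n →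
    (∀ i → eval p (x i) ≈ 0#) → All (_≈ 0#) p
  many-roots n       []       x inj len roots = []
  many-roots (suc n) (k ∷ ks) x inj (s≤s len) roots = k≈0 ∷ proj₂ rest
    where
    a = x zero
    rest : eval ks a ≈ 0# × All (_≈ 0#) ks
    rest = quotient-zero a ks (many-roots n (quotient a ks) (x ∘ suc)
      (λ i j eq → Finₚ.suc-injective (inj _ _ eq))
      (≡.subst (ℕ._≤ n) (≡.sym (length-quotient a ks)) len)
      λ i → domain (λ x-a≈0 → nope i (trans (solve 2 (λ x a → x := (x :- a) :+ a) refl (x (suc i)) a) (trans (+-congʳ x-a≈0) (+-identityˡ a))))
        (trans (sym (eval-quotient a ks (x (suc i)))) (begin
          x (suc i) * eval ks (x (suc i)) - a * eval ks a
            ≈⟨ solve 3 (λ k y z → y :- z := (k :+ y) :- (k :+ z)) refl k _ _ ⟩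
          eval (k ∷ ks) (x (suc i)) - eval (k ∷ ks) a
            ≈⟨ +-cong (roots (suc i)) (-‿cong (roots zero)) ⟩
          0# - 0#
            ≈⟨ -‿inverseʳ 0# ⟩
          0# ∎)))
      where
      nope : ∀ i → ¬ (x (suc i) ≈ a)
      nope i eq with () ← inj (suc i) zero eq
    k≈0 : k ≈ 0#
    k≈0 = trans (sym (+-identityʳ k)) (trans (+-congˡ (sym (trans (*-congˡ (proj₁ rest)) (zeroʳ a)))) (roots zero))

  monomial : ℕ → List Carrier
  monomial zero    = 1# ∷ []
  monomial (suc k) = 0# ∷ monomial k

  eval-monomial : ∀ k x → eval (monomial k) x ≈ x ^ k
  eval-monomial zero    x = trans (+-congˡ (zeroʳ x)) (+-identityʳ 1#)
  eval-monomial (suc k) x = trans (+-identityˡ _) (*-congˡ (eval-monomial k x))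

  length-monomial : ∀ k → length (monomial k) ≡ suc k
  length-monomial zero    = ≡.refl
  length-monomial (suc k) = ≡.cong suc (length-monomial k)

  -- Otherwise X^(k+2) - X, which has at most q coefficients, would vanish at all q elements of the
  -- field.
  non-root-of-unity : ∀ k → suc k ℕ.< d → ∃ λ g → ¬ (g ≈ 0#) × ¬ (g ^ suc k ≈ 1#)
  non-root-of-unity k k<d with Finₚ.any? (λ i → ¬? (enum i ≈? 0#) ×-dec ¬? (enum i ^ suc k ≈? 1#))
  ... | yes (i , h) = enum i , h
  ... | no none = ⊥-elim (minus-one (many-roots q (0# ∷ - 1# ∷ monomial k) enum enum-injective
    (s≤s (≡.subst (λ n → suc n ℕ.≤ d) (≡.sym (length-monomial k)) k<d)) roots))
    where
    minus-one : ¬ All (_≈ 0#) (0# ∷ - 1# ∷ monomial k)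
    minus-one (_ ∷ e ∷ _) = 1≉0 (trans (sym (-‿involutive 1#)) (trans (-‿cong e) -0≈0))
    roots : ∀ i → 0# + enum i * (- 1# + enum i * eval (monomial k) (enum i)) ≈ 0#
    roots i with enum i ≈? 0# | enum i ^ suc k ≈? 1#
    ... | yes z | _ = trans (+-identityˡ _) (trans (*-congʳ z) (zeroˡ _))
    ... | no z | no h = ⊥-elim (none (i , z , h))
    ... | no z | yes h = trans (+-identityˡ _) (trans (*-congˡ (trans (+-congˡ (trans (*-congˡ (eval-monomial k _)) h)) (-‿inverseˡ 1#))) (zeroʳ _))

  abstract
    -- The divisibility mask of the structure constants. It is 1 at 0 as well, which supplies the
    -- term x_0 = 1 of Q.
    χ : ℕ → Carrier
    χ i = if does (d ∣? i) then 1# else 0#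

    χ-yes : ∀ {i} → d ∣ i → χ i ≡ 1#
    χ-yes {i} h = ≡.cong (if_then 1# else 0#) (dec-true (d ∣? i) h)

    χ-no : ∀ {i} → ¬ (d ∣ i) → χ i ≡ 0#
    χ-no {i} h = ≡.cong (if_then 1# else 0#) (dec-false (d ∣? i) h)

  δ : ℕ → Carrier
  δ zero    = 1#
  δ (suc _) = 0#

  private
    module ∑ where
      open Over +-commutativeMonoid public
      open SumLemmas +-commutativeMonoid public using (copies)

  ∑ : (Carrier → Carrier) → Carrier
  ∑ = ∑.∑F

  copies-0 : ∀ n → ∑.copies n 0# ≈ 0#
  copies-0 zero    = refl
  copies-0 (suc n) = trans (+-identityˡ _) (copies-0 n)

  -- Translation by 1 permutes the field, so Σ (x + 1) = Σ x; the characteristic is never mentioned.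
  ∑-1 : ∑ (λ _ → 1#) ≈ 0#
  ∑-1 = begin
    ∑ (λ _ → 1#)                          ≈⟨ solve 2 (λ a b → b := (a :+ b) :- a) refl _ _ ⟩
    (∑ (λ x → x) + ∑ (λ _ → 1#)) - ∑ (λ x → x)   ≈⟨ +-congʳ (∑.∑F-distrib (λ x → x) (λ _ → 1#)) ⟨
    ∑ (λ x → x + 1#) - ∑ (λ x → x)        ≈⟨ +-congʳ (∑.∑F-reindex (λ x → x) (λ z → z) (_+ 1#) (_- 1#) +-congʳ +-congʳ
                                                  (λ x → solve 2 (λ x o → (x :- o) :+ o := x) refl x 1#) (λ x → solve 2 (λ x o → (x :+ o) :- o := x) refl x 1#)) ⟩
    ∑ (λ x → x) - ∑ (λ x → x)             ≈⟨ -‿inverseʳ _ ⟩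
    0#                                    ∎

  ∑-*ˡ : ∀ k f → k * ∑ f ≈ ∑ (λ x → k * f x)
  ∑-*ˡ k f = trans (*-congˡ (reflexive (∑.∑F-unfold f))) (trans (go q (f ∘ enum)) (reflexive (≡.sym (∑.∑F-unfold (λ x → k * f x)))))
    where
    go : ∀ n (g : Fin n → Carrier) → k * SumLemmas.sum +-commutativeMonoid g ≈ SumLemmas.sum +-commutativeMonoid (λ i → k * g i)
    go zero    g = zeroʳ k
    go (suc n) g = trans (distribˡ _ _ _) (+-congˡ (go n (g ∘ suc)))

  -- By Fermat the summand is 1 except at 0, where the positive exponent makes it 0; adding the
  -- indicator of 0 makes it constant.
  ∑-^-multiple : ∀ m → ∑ (_^ (suc m ℕ.* d)) ≈ - 1#
  ∑-^-multiple m = begin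
    ∑ f                                        ≈⟨ solve 2 (λ a b → a := (a :+ b) :- b) refl _ _ ⟩
    (∑ f + ∑ g) - ∑ g                          ≈⟨ +-cong (trans (sym (∑.∑F-distrib f g)) (trans (∑.∑F-cong f+g) ∑-1)) (-‿cong ∑g) ⟩
    0# - 1#                                    ≈⟨ +-identityˡ _ ⟩
    - 1#                                       ∎
    where
    f g : Carrier → Carrier
    f x = x ^ (suc m ℕ.* d)
    g x = ifZero x 1# 0#
    g-cong : ∀ x y → x ≈ y → g x ≈ g y
    g-cong x y x≈y with x ≈? 0#
    ... | yes x≈0 = sym (ifZero-yes (trans (sym x≈y) x≈0))
    ... | no x≉0  = sym (ifZero-no (λ y≈0 → x≉0 (trans x≈y y≈0)))
    ∑g : ∑ g ≈ 1#
    ∑g = begin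
      ∑ g                       ≈⟨ ∑.∑F-except g 0# 0# (λ {x} {y} → g-cong x y) (λ z z≉0 → ifZero-no z≉0) ⟩
      g 0# + ∑.copies d 0#      ≈⟨ +-cong (ifZero-yes refl) (copies-0 d) ⟩
      1# + 0#                   ≈⟨ +-identityʳ 1# ⟩
      1#                        ∎
    f+g : ∀ x → f x + g x ≈ 1#
    f+g x with x ≈? 0#
    ... | yes x≈0 = trans (+-congʳ (trans (*-congʳ x≈0) (zeroˡ _))) (+-identityˡ 1#)
    ... | no x≉0  = trans (+-identityʳ _) (begin
      x ^ (suc m ℕ.* d)   ≈⟨ reflexive (≡.cong (x ^_) (ℕₚ.*-comm (suc m) d)) ⟩
      x ^ (d ℕ.* suc m)   ≈⟨ ^-assocʳ x d (suc m) ⟨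
      (x ^ d) ^ suc m     ≈⟨ ^-congˡ (suc m) (fermat x≉0) ⟩
      1# ^ suc m          ≈⟨ 1^ (suc m) ⟩
      1#                  ∎)

  -- Replacing x by g x gives g^i S = S. A unit g with g^i different from 1 exists because the
  -- remainder of i modulo d lies strictly between 0 and d.
  ∑-^-other : ∀ i → ¬ (d ∣ i) → ∑ (_^ i) ≈ 0#
  ∑-^-other i d∤i with i % d in eq
  ... | zero  = ⊥-elim (d∤i (m%n≡0⇒n∣m i d eq))
  ... | suc k with non-root-of-unity k (≡.subst (ℕ._< d) eq (m%n<n i d))
  ... | g , g≉0 , gk≉1 with inverse g g≉0
  ... | g⁻¹ , inv = domain {g ^ i - 1#} (λ z → gk≉1 (trans (sym g^i) (trans (solve 2 (λ x o → x := (x :- o) :+ o) refl (g ^ i) 1#) (trans (+-congʳ z) (+-identityˡ 1#))))) (begin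
      (g ^ i - 1#) * S                            ≈⟨ solve 2 (λ x S → (x :- con (1 , 0)) :* S := x :* S :- S) refl (g ^ i) S ⟩
      g ^ i * S - S                               ≈⟨ +-congʳ (∑-*ˡ (g ^ i) (_^ i)) ⟩
      ∑ (λ x → g ^ i * x ^ i) - S                 ≈⟨ +-congʳ (∑.∑F-cong (λ x → sym (^-distrib-* g x i))) ⟩
      ∑ (λ x → (g * x) ^ i) - S                   ≈⟨ +-congʳ (Dilation.∑F-dilate g g⁻¹ inv +-commutativeMonoid (_^ i) (^-congˡ i)) ⟩
      S - S                                       ≈⟨ -‿inverseʳ S ⟩
      0#                                          ∎)
    where
    S = ∑ (_^ i)
    g^i : g ^ i ≈ g ^ suc k
    g^i = begin
      g ^ i                                 ≈⟨ reflexive (≡.cong (g ^_) (≡.trans (m≡m%n+[m/n]*n i d) (≡.cong₂ _+ℕ_ eq (ℕₚ.*-comm (i / d) d)))) ⟩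
      g ^ (suc k +ℕ d ℕ.* (i / d))          ≈⟨ ^-homo-* g (suc k) (d ℕ.* (i / d)) ⟩
      g ^ suc k * g ^ (d ℕ.* (i / d))       ≈⟨ *-congˡ (trans (sym (^-assocʳ g d (i / d))) (trans (^-congˡ (i / d) (fermat g≉0)) (1^ (i / d)))) ⟩
      g ^ suc k * 1#                        ≈⟨ *-identityʳ _ ⟩
      g ^ suc k                             ∎

  -- With 0^0 = 1 the sum for i = 0 is q times 1, hence 0; this is the source of the correction `δ`.
  power-sum : ∀ i → ∑ (_^ i) ≈ δ i - χ i
  power-sum zero = trans ∑-1 (sym (trans (+-congˡ (-‿cong (reflexive (χ-yes (divides 0 ≡.refl))))) (-‿inverseʳ 1#)))
  power-sum (suc i) with d ∣? suc i
  ... | no ne = trans (∑-^-other (suc i) ne) (sym (trans (+-congˡ (-‿cong (reflexive (χ-no ne)))) (-‿inverseʳ 0#)))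
  ... | yes h@(divides (suc m) eq) = trans (reflexive (≡.cong (λ n → ∑ (_^ n)) eq))
    (trans (∑-^-multiple m) (sym (trans (+-identityˡ _) (-‿cong (reflexive (χ-yes h))))))

  -- Since (x + 1)^q = x + 1 on the field, the polynomial formed by the middle binomial terms has
  -- degree below q and q roots. No prime power factorisation of q is involved.
  binomial-q : ∀ k → 0 ℕ.< k → k ℕ.< q → natR (q C k) ≈ 0#
  binomial-q (suc k) _ (s≤s k<d) = select e (λ i → natR (q C suc i)) (All.tail coefficients) k k<d
    where
    tab : ℕ → (ℕ → Carrier) → List Carrier
    tab zero    f = f 0 ∷ []
    tab (suc n) f = f 0 ∷ tab n (λ k → f (suc k))
    length-tab : ∀ n f → length (tab n f) ≡ suc n
    length-tab zero    f = ≡.refl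
    length-tab (suc n) f = ≡.cong suc (length-tab n _)
    select : ∀ n f → All (_≈ 0#) (tab n f) → ∀ k → k ℕ.< suc n → f k ≈ 0#
    select zero    f (h ∷ _)  zero    _         = h
    select (suc n) f (h ∷ _)  zero    _         = h
    select (suc n) f (_ ∷ hs) (suc k) (s≤s k<n) = select n _ hs k k<n
    select zero    f _        (suc k) (s≤s ())
    eval-tab : ∀ n f x → eval (tab n f) x ≈ sumTo n (λ k → f k * x ^ k)
    eval-tab zero    f x = trans (+-congˡ (zeroʳ x)) (trans (+-identityʳ _) (sym (*-identityʳ _)))
    eval-tab (suc n) f x = +-cong (sym (*-identityʳ _)) (trans (*-congˡ (eval-tab n _ x)) (shift n (λ k → f (suc k))))
      where
      shift : ∀ n g → x * sumTo n (λ k → g k * x ^ k) ≈ sumTo n (λ k → g k * x ^ suc k)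
      shift n g = begin
        x * sumTo n (λ k → g k * x ^ k)            ≈⟨ *-congˡ (anti-fst n _) ⟨
        x * anti n (λ k _ → g k * x ^ k)           ≈⟨ anti-*ˡ n x _ ⟩
        anti n (λ k _ → x * (g k * x ^ k))         ≈⟨ anti-cong n (λ k _ → solve 3 (λ x g p → x :* (g :* p) := g :* (x :* p)) refl x (g k) (x ^ k)) ⟩
        anti n (λ k _ → g k * x ^ suc k)           ≈⟨ anti-fst n _ ⟩
        sumTo n (λ k → g k * x ^ suc k)            ∎
    roots : ∀ x → 0# + x * eval (tab e (λ i → natR (q C suc i))) x ≈ 0#
    roots x = begin
      0# + x * eval (tab e (λ i → natR (q C suc i))) x
        ≈⟨ +-identityˡ _ ⟩
      x * eval (tab e (λ i → natR (q C suc i))) x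
        ≈⟨ solve 2 (λ c y → y := (c :+ y) :- c) refl (natR (q C 0)) _ ⟩
      eval (tab d (λ i → natR (q C i))) x - natR (q C 0)
        ≈⟨ +-congʳ (trans (eval-tab d (λ i → natR (q C i)) x) (sym (anti-fst d (λ k → natR (q C k) * x ^ k)))) ⟩
      T - natR (q C 0)
        ≈⟨ solve 3 (λ T c y → T :- c := (T :+ y) :- (c :+ y)) refl T _ x ⟩
      (T + x) - (natR (q C 0) + x)
        ≈⟨ +-cong (begin
             T + x              ≈⟨ +-cong (anti-cong d {λ k _ → natR (q C k) * x ^ k} λ k l → *-congˡ {natR (q C k)} (sym (trans (*-congˡ (1^ (suc l))) (*-identityʳ (x ^ k))))) last ⟩
             anti d (λ k l → natR (q C k) * (x ^ k * 1# ^ suc l)) + natR (q C q) * (x ^ q * 1# ^ 0) ≈⟨ anti-last d (λ k l → natR (q C k) * (x ^ k * 1# ^ l)) ⟨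
             anti q (λ k l → natR (q C k) * (x ^ k * 1# ^ l)) ≈⟨ binomial q x 1# ⟨
             (x + 1#) ^ q       ≈⟨ fermat′ (x + 1#) ⟩
             x + 1#             ∎) (-‿cong (+-congʳ (+-identityʳ 1#))) ⟩
      (x + 1#) - (1# + x)
        ≈⟨ solve 2 (λ x o → (x :+ o) :- (o :+ x) := con (0 , 0)) refl x 1# ⟩
      0# ∎
      where
      T = anti d (λ k _ → natR (q C k) * x ^ k)
      last : x ≈ natR (q C q) * (x ^ q * 1# ^ 0)
      last = sym (trans (*-cong (trans (reflexive (≡.cong natR (nCn≡1 q))) (+-identityʳ 1#)) (trans (*-identityʳ _) (fermat′ x))) (*-identityˡ x))
    coefficients : All (_≈ 0#) (0# ∷ tab e (λ i → natR (q C suc i)))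
    coefficients = many-roots q _ enum enum-injective (≡.subst (λ n → suc n ℕ.≤ q) (≡.sym (length-tab e _)) ℕₚ.≤-refl) (λ i → roots (enum i))

-- The structure constants of the diamond product and their generating functions.

module Gamma {c ℓ : Level} (e : ℕ) (F : FiniteField c ℓ (suc (suc e))) where
  open FieldFacts e F
  open RingKit K

  sign : ℕ → Carrier
  sign a = (- 1#) ^ a

  -- With letters shifted by one this is the constant for x_{a+1}, x_{b+1} and j = m + 1. The range
  -- 0 < j < (a + 1) + (b + 1) is not tested here; it is encoded by summing over n + m = a + b.
  γ : ℕ → ℕ → ℕ → Carrier
  γ a b m = χ (suc m) * (sign a * natR (m C a) + sign b * natR (m C b))

  γ-sym : ∀ a b m → γ a b m ≈ γ b a m
  γ-sym a b m = *-congˡ (+-comm _ _)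

  χ-shift : ∀ {i} j → d ∣ i → χ (i +ℕ j) ≡ χ j
  χ-shift {i} j d∣i with d ∣? j
  ... | yes d∣j = ≡.trans (χ-yes (∣m∣n⇒∣m+n d∣i d∣j)) (≡.sym (χ-yes d∣j))
  ... | no d∤j  = ≡.trans (χ-no (λ h → d∤j (∣m+n∣m⇒∣n h d∣i))) (≡.sym (χ-no d∤j))

  χ-0 : χ 0 ≡ 1#
  χ-0 = χ-yes (divides 0 ≡.refl)

  χ-small : ∀ i → suc i ℕ.< d → χ (suc i) ≡ 0#
  χ-small i i<d = χ-no (λ h → ℕₚ.<⇒≱ i<d (∣⇒≤ h))

  χ-elim : ∀ {ℓ′} {A : Set ℓ′} i → (d ∣ i → A) → (χ i ≡ 0# → A) → A
  χ-elim i f g with d ∣? i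
  ... | yes h = f h
  ... | no h  = g (χ-no h)

  d∣d : d ∣ d
  d∣d = divides 1 (≡.sym (ℕₚ.+-identityʳ d))

module OverAlgebra {c ℓ p ℓp : Level} (e : ℕ) (F : FiniteField c ℓ (suc (suc e)))
                   (P : CommutativeRing p ℓp) (ι : Hom (FiniteField.ring F) P) where
  open FieldFacts e F using (K; d; q; χ; χ-yes; binomial-q; -1^d)
  open Gamma e F
  open RingKit P
  open Hom ι
  private module K = RingKit K

  χP : ℕ → Carrier
  χP i = ⟦ χ i ⟧

  χP-yes : ∀ {i} → d ∣ i → χP i ≈ 1#
  χP-yes h = trans (reflexive (≡.cong ⟦_⟧ (χ-yes h))) ⟦⟧-1

  χP-zero : ∀ {i} → χ i ≡ K.0# → χP i ≈ 0#
  χP-zero h = trans (reflexive (≡.cong ⟦_⟧ h)) ⟦⟧-0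

  -- A masked identity only has to hold when d divides i, which is where the sign rules below become
  -- available.
  χP-cong : ∀ i {x y} → (d ∣ i → x ≈ y) → χP i * x ≈ χP i * y
  χP-cong i h = χ-elim i (λ di → *-congˡ (h di)) (λ z → trans (trans (*-congʳ (χP-zero z)) (zeroˡ _)) (sym (trans (*-congʳ (χP-zero z)) (zeroˡ _))))

  χP-idem : ∀ i → χP i * χP i ≈ χP i
  χP-idem i = trans (χP-cong i χP-yes) (*-identityʳ _)

  χP-+ : ∀ i j → χP i * χP (i +ℕ j) ≈ χP i * χP j
  χP-+ i j = χP-cong i (λ di → reflexive (≡.cong ⟦_⟧ (χ-shift j di)))

  signP : ℕ → Carrier
  signP a = (- 1#) ^ a

  ⟦sign⟧ : ∀ a → ⟦ sign a ⟧ ≈ signP a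
  ⟦sign⟧ a = trans (⟦⟧-^ (K.- K.1#) a) (^-congˡ a (trans (⟦⟧-neg K.1#) (-‿cong ⟦⟧-1)))

  ⟦γ⟧ : ∀ a b m → ⟦ γ a b m ⟧ ≈ χP (suc m) * (signP a * natR (m C a) + signP b * natR (m C b))
  ⟦γ⟧ a b m = trans (⟦⟧-* _ _) (*-congˡ (trans (⟦⟧-+ _ _) (+-cong (half a) (half b))))
    where
    half : ∀ a → ⟦ sign a K.* K.natR (m C a) ⟧ ≈ signP a * natR (m C a)
    half a = trans (⟦⟧-* _ _) (*-cong (⟦sign⟧ a) (⟦⟧-natR (m C a)))

  sign-multiple : ∀ {i} → d ∣ i → signP i ≈ 1#
  sign-multiple {i} (divides k eq) = begin
    signP i              ≈⟨ reflexive (≡.cong signP (≡.trans eq (ℕₚ.*-comm k d))) ⟩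
    (- 1#) ^ (d ℕ.* k)   ≈⟨ ^-assocʳ (- 1#) d k ⟨
    signP d ^ k          ≈⟨ ^-congˡ k (trans (sym (⟦sign⟧ d)) (trans (⟦⟧-cong -1^d) ⟦⟧-1)) ⟩
    1# ^ k               ≈⟨ 1^ k ⟩
    1#                   ∎

  sign-pred : ∀ {i} → d ∣ suc i → signP i ≈ - 1#
  sign-pred {i} h = begin
    signP i                 ≈⟨ solve 1 (λ x → x := :- (:- con (1 , 0) :* x)) refl (signP i) ⟩
    - (- 1# * signP i)      ≈⟨ -‿cong (sign-multiple h) ⟩
    - 1#                    ∎

  neg-^ : ∀ x n → (- x) ^ n ≈ signP n * x ^ n
  neg-^ x n = trans (^-congˡ n (sym (-1*x≈-x x))) (^-distrib-* (- 1#) x n)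

  even-^ : ∀ {i} x → d ∣ i → (- x) ^ i ≈ x ^ i
  even-^ {i} x h = trans (neg-^ x i) (trans (*-congʳ (sign-multiple h)) (*-identityˡ _))

  odd-^ : ∀ {i} x → d ∣ suc i → (- x) ^ i ≈ - (x ^ i)
  odd-^ {i} x h = trans (neg-^ x i) (trans (*-congʳ (sign-pred h)) (-1*x≈-x _))

  natC-0 : ∀ {m k} → m ℕ.< k → natR (m C k) ≈ 0#
  natC-0 h = reflexive (≡.cong natR (k>n⇒nCk≡0 h))

  -- The binomial coefficient confines b to b ≤ m, so s^n factors out of every surviving term.
  binomial-half : ∀ n m s t → anti (n +ℕ m) (λ a b → signP b * natR (m C b) * (s ^ a * t ^ b)) ≈ s ^ n * (s - t) ^ m
  binomial-half n m s t = begin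
    anti (n +ℕ m) (λ a b → signP b * natR (m C b) * (s ^ a * t ^ b))
      ≈⟨ anti-flip (n +ℕ m) _ ⟩
    anti (n +ℕ m) (λ k l → signP k * natR (m C k) * (s ^ l * t ^ k))
      ≈⟨ anti-trunc n m _ (λ a b m<a → trans (*-congʳ (trans (*-congˡ (natC-0 m<a)) (zeroʳ _))) (zeroˡ _)) ⟩
    anti m (λ k l → signP k * natR (m C k) * (s ^ (n +ℕ l) * t ^ k))
      ≈⟨ anti-cong m (λ k l → begin
           signP k * natR (m C k) * (s ^ (n +ℕ l) * t ^ k)
             ≈⟨ *-congˡ (*-congʳ (^-homo-* s n l)) ⟩
           signP k * natR (m C k) * (s ^ n * s ^ l * t ^ k)
             ≈⟨ solve 5 (λ g c p r u → g :* c :* (p :* r :* u) := p :* (c :* ((g :* u) :* r))) refl (signP k) (natR (m C k)) (s ^ n) (s ^ l) (t ^ k) ⟩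
           s ^ n * (natR (m C k) * ((signP k * t ^ k) * s ^ l))
             ≈⟨ *-congˡ (*-congˡ (*-congʳ (neg-^ t k))) ⟨
           s ^ n * (natR (m C k) * ((- t) ^ k * s ^ l)) ∎) ⟩
    anti m (λ k l → s ^ n * (natR (m C k) * ((- t) ^ k * s ^ l)))
      ≈⟨ anti-*ˡ m (s ^ n) _ ⟨
    s ^ n * anti m (λ k l → natR (m C k) * ((- t) ^ k * s ^ l))
      ≈⟨ *-congˡ (binomial m (- t) s) ⟨
    s ^ n * (- t + s) ^ m
      ≈⟨ *-congˡ (^-congˡ m (+-comm _ _)) ⟩
    s ^ n * (s - t) ^ m ∎

  -- The two halves of `γ` give s^n (s - t)^m and t^n (t - s)^m; under the mask (-1)^m = -1, so they
  -- combine into a difference.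
  γ-formula : ∀ n m s t → anti (n +ℕ m) (λ a b → ⟦ γ a b m ⟧ * (s ^ a * t ^ b)) ≈ χP (suc m) * ((s ^ n - t ^ n) * (s - t) ^ m)
  γ-formula n m s t = begin
    anti (n +ℕ m) (λ a b → ⟦ γ a b m ⟧ * (s ^ a * t ^ b))
      ≈⟨ anti-cong (n +ℕ m) (λ a b → trans (*-congʳ (⟦γ⟧ a b m))
           (solve 5 (λ x A B p r → x :* (A :+ B) :* (p :* r) := x :* (B :* (p :* r) :+ A :* (r :* p))) refl (χP (suc m)) (signP a * natR (m C a)) (signP b * natR (m C b)) (s ^ a) (t ^ b))) ⟩
    anti (n +ℕ m) (λ a b → χP (suc m) * (signP b * natR (m C b) * (s ^ a * t ^ b) + signP a * natR (m C a) * (t ^ b * s ^ a)))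
      ≈⟨ anti-*ˡ (n +ℕ m) _ _ ⟨
    χP (suc m) * anti (n +ℕ m) (λ a b → signP b * natR (m C b) * (s ^ a * t ^ b) + signP a * natR (m C a) * (t ^ b * s ^ a))
      ≈⟨ *-congˡ (trans (anti-+ (n +ℕ m) _ _) (+-cong (binomial-half n m s t) (trans (anti-flip (n +ℕ m) _) (binomial-half n m t s)))) ⟩
    χP (suc m) * (s ^ n * (s - t) ^ m + t ^ n * (t - s) ^ m)
      ≈⟨ χP-cong (suc m) (λ h → begin
           s ^ n * (s - t) ^ m + t ^ n * (t - s) ^ m
             ≈⟨ +-congˡ (*-congˡ (trans (^-congˡ m (solve 2 (λ s t → t :- s := :- (s :- t)) refl s t)) (odd-^ (s - t) h))) ⟩
           s ^ n * (s - t) ^ m + t ^ n * - ((s - t) ^ m)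
             ≈⟨ solve 3 (λ S T U → S :* U :+ T :* :- U := (S :- T) :* U) refl (s ^ n) (t ^ n) ((s - t) ^ m) ⟩
           (s ^ n - t ^ n) * (s - t) ^ m ∎) ⟩
    χP (suc m) * ((s ^ n - t ^ n) * (s - t) ^ m) ∎

  γ-GF : ∀ N (G : ℕ → ℕ → Carrier) s t →
    anti N (λ a b → anti N (λ n m → ⟦ γ a b m ⟧ * G n m) * (s ^ a * t ^ b)) ≈ anti N (λ n m → χP (suc m) * G n m * ((s ^ n - t ^ n) * (s - t) ^ m))
  γ-GF N G s t = begin
    anti N (λ a b → anti N (λ n m → ⟦ γ a b m ⟧ * G n m) * (s ^ a * t ^ b))
      ≈⟨ anti-cong N (λ a b → anti-*ʳ N _ _) ⟩
    anti N (λ a b → anti N (λ n m → ⟦ γ a b m ⟧ * G n m * (s ^ a * t ^ b)))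
      ≈⟨ anti-swap N N (λ a b n m → ⟦ γ a b m ⟧ * G n m * (s ^ a * t ^ b)) ⟩
    anti N (λ n m → anti N (λ a b → ⟦ γ a b m ⟧ * G n m * (s ^ a * t ^ b)))
      ≈⟨ anti-cong′ N (λ n m eq → begin
           anti N (λ a b → ⟦ γ a b m ⟧ * G n m * (s ^ a * t ^ b))
             ≈⟨ anti-cong N (λ a b → solve 3 (λ g G p → g :* G :* p := G :* (g :* p)) refl _ _ _) ⟩
           anti N (λ a b → G n m * (⟦ γ a b m ⟧ * (s ^ a * t ^ b)))
             ≈⟨ anti-*ˡ N _ _ ⟨
           G n m * anti N (λ a b → ⟦ γ a b m ⟧ * (s ^ a * t ^ b))
             ≈⟨ *-congˡ (trans (reflexive (≡.cong (λ N → anti N (λ a b → ⟦ γ a b m ⟧ * (s ^ a * t ^ b))) (≡.sym eq))) (γ-formula n m s t)) ⟩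
           G n m * (χP (suc m) * ((s ^ n - t ^ n) * (s - t) ^ m))
             ≈⟨ solve 3 (λ G x p → G :* (x :* p) := x :* G :* p) refl _ _ _ ⟩
           χP (suc m) * G n m * ((s ^ n - t ^ n) * (s - t) ^ m) ∎) ⟩
    anti N (λ n m → χP (suc m) * G n m * ((s ^ n - t ^ n) * (s - t) ^ m)) ∎

  -- The diamond product of two letters under a functional: G n 0 is its value at x_{n+1}, and G n
  -- (m + 1) its value at x_{n+1} x_{m+1}.
  dia : ℕ → ℕ → (ℕ → ℕ → Carrier) → Carrier
  dia a b G = G (suc (a +ℕ b)) 0 + anti (a +ℕ b) (λ n m → ⟦ γ a b m ⟧ * G n (suc m))

  -- The factor s - t clears the pole of P(s - t). It also turns the geometric sum belonging to
  -- x_{a+b+2} into s^(N+1) - t^(N+1), which is the m = 0 term of the other sum.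
  dia-GF : ∀ N (G : ℕ → ℕ → Carrier) s t →
    (s - t) * anti N (λ a b → dia a b G * (s ^ a * t ^ b)) ≈ anti (suc N) (λ n m → χP m * G n m * ((s ^ n - t ^ n) * (s - t) ^ m))
  dia-GF N G s t = begin
    (s - t) * anti N (λ a b → dia a b G * (s ^ a * t ^ b))
      ≈⟨ *-congˡ (anti-cong′ N λ { a b ≡.refl → distribʳ _ _ _ }) ⟩
    (s - t) * anti N (λ a b → G (suc (a +ℕ b)) 0 * (s ^ a * t ^ b) + anti (a +ℕ b) (λ n m → ⟦ γ a b m ⟧ * G n (suc m)) * (s ^ a * t ^ b))
      ≈⟨ *-congˡ (trans (anti-+ N _ _) (+-cong (trans (anti-cong′ N λ { a b ≡.refl → refl }) (sym (anti-*ˡ N (G (suc N) 0) _))) (trans (anti-cong′ N λ { a b ≡.refl → refl }) (γ-GF N (λ n m → G n (suc m)) s t)))) ⟩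
    (s - t) * (G (suc N) 0 * anti N (λ a b → s ^ a * t ^ b) + anti N (λ n m → χP (suc m) * G n (suc m) * ((s ^ n - t ^ n) * (s - t) ^ m)))
      ≈⟨ solve 4 (λ x G A B → x :* (G :* A :+ B) := x :* B :+ G :* (x :* A)) refl (s - t) _ _ _ ⟩
    (s - t) * anti N (λ n m → χP (suc m) * G n (suc m) * ((s ^ n - t ^ n) * (s - t) ^ m)) + G (suc N) 0 * ((s - t) * anti N (λ a b → s ^ a * t ^ b))
      ≈⟨ +-cong (trans (anti-*ˡ N _ _) (anti-cong N λ n m → solve 4 (λ x c p r → x :* (c :* (p :* r)) := c :* (p :* (x :* r))) refl (s - t) _ _ _))
                (trans (*-congˡ (geometric N s t)) (sym (trans (*-congʳ (trans (*-congʳ (χP-yes (divides 0 ≡.refl))) (*-identityˡ _))) (*-congˡ (*-identityʳ _))))) ⟩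
    anti N (λ n m → χP (suc m) * G n (suc m) * ((s ^ n - t ^ n) * (s - t) ^ suc m)) + χP 0 * G (suc N) 0 * ((s ^ suc N - t ^ suc N) * 1#)
      ≈⟨ anti-last N (λ n m → χP m * G n m * ((s ^ n - t ^ n) * (s - t) ^ m)) ⟨
    anti (suc N) (λ n m → χP m * G n m * ((s ^ n - t ^ n) * (s - t) ^ m)) ∎

  frobenius : ∀ x y → (x + y) ^ q ≈ x ^ q + y ^ q
  frobenius x y = begin
    (x + y) ^ q
      ≈⟨ binomial q x y ⟩
    B 0 q + anti d (λ k → B (suc k))
      ≈⟨ +-congˡ (anti-last e (λ k → B (suc k))) ⟩
    B 0 q + (anti e (λ k l → B (suc k) (suc l)) + B q 0)
      ≈⟨ +-cong first (+-cong (anti-0′ e λ k l eq → trans (*-congʳ (middle k l eq)) (zeroˡ _)) last) ⟩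
    y ^ q + (0# + x ^ q)
      ≈⟨ solve 2 (λ X Y → Y :+ (con (0 , 0) :+ X) := X :+ Y) refl (x ^ q) (y ^ q) ⟩
    x ^ q + y ^ q ∎
    where
    B : ℕ → ℕ → Carrier
    B k l = natR (q C k) * (x ^ k * y ^ l)
    first : B 0 q ≈ y ^ q
    first = trans (*-cong (+-identityʳ 1#) (*-identityˡ _)) (*-identityˡ _)
    last : B q 0 ≈ x ^ q
    last = trans (*-cong (trans (reflexive (≡.cong natR (nCn≡1 q))) (+-identityʳ 1#)) (*-identityʳ _)) (*-identityˡ _)
    middle : ∀ k l → k +ℕ l ≡ e → natR (q C suc k) ≈ 0#
    middle k l eq = trans (sym (⟦⟧-natR (q C suc k))) (trans (⟦⟧-cong (binomial-q (suc k) (s≤s z≤n) (s≤s (s≤s (ℕₚ.≤-trans (ℕₚ.m≤m+n k l) (ℕₚ.≤-reflexive eq)))))) ⟦⟧-0)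

  -- The Moore determinant and the depth 1 part of the identity for P.

  -- The determinant x^q y - x y^q, in the factored form from which cancellability can be read off.
  Moore : Carrier → Carrier → Carrier
  Moore x y = x * y * (x ^ d - y ^ d)

  private
    Moore-expand : ∀ x y → Moore x y ≈ x ^ q * y - x * y ^ q
    Moore-expand x y = solve 4 (λ x y X Y → x :* y :* (X :- Y) := (x :* X) :* y :- x :* (y :* Y)) refl x y (x ^ d) (y ^ d)

  -- A column operation: the q-th power is additive, so adding y to x does not change the
  -- determinant.
  Moore-+ʳ : ∀ x y → Moore (x + y) y ≈ Moore x y
  Moore-+ʳ x y = begin
    Moore (x + y) y                              ≈⟨ Moore-expand (x + y) y ⟩
    (x + y) ^ q * y - (x + y) * y ^ q            ≈⟨ +-congʳ (*-congʳ (frobenius x y)) ⟩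
    (x ^ q + y ^ q) * y - (x + y) * y ^ q        ≈⟨ solve 4 (λ x y X Y → (X :+ Y) :* y :- (x :+ y) :* Y := X :* y :- x :* Y) refl x y (x ^ q) (y ^ q) ⟩
    x ^ q * y - x * y ^ q                        ≈⟨ Moore-expand x y ⟨
    Moore x y                                    ∎

  Moore-+ˡ : ∀ x y → Moore (x + y) x ≈ - Moore x y
  Moore-+ˡ x y = begin
    Moore (x + y) x                              ≈⟨ Moore-expand (x + y) x ⟩
    (x + y) ^ q * x - (x + y) * x ^ q            ≈⟨ +-congʳ (*-congʳ (frobenius x y)) ⟩
    (x ^ q + y ^ q) * x - (x + y) * x ^ q        ≈⟨ solve 4 (λ x y X Y → (X :+ Y) :* x :- (x :+ y) :* X := :- (X :* y :- x :* Y)) refl x y (x ^ q) (y ^ q) ⟩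
    - (x ^ q * y - x * y ^ q)                    ≈⟨ -‿cong (Moore-expand x y) ⟨
    - Moore x y                                  ∎

  -- The identity for P, multiplied by x y (x + y); here f x y stands for a homogeneous part of Q(x)
  -- Q(y), possibly under a functional.
  Star : (Carrier → Carrier → Carrier) → Carrier → Carrier → Set ℓp
  Star f x y = (x + y) * f x y ≈ y * f (x + y) x + x * f (x + y) y

  -- What remains of a homogeneous part of Q(x) Q(y) when every letter is replaced by 1.
  lattice : ℕ → Carrier → Carrier → Carrier
  lattice N x y = anti N (λ i j → χP i * χP j * (x ^ i * y ^ j))

  -- A geometric sum in x^d and y^d: multiplying by x^d - y^d telescopes and leaves the two ends.
  lattice-closed : ∀ N x y → Moore x y * lattice N x y ≈ x * y * (χP (d +ℕ N) * (x ^ (d +ℕ N) - y ^ (d +ℕ N)))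
  lattice-closed N x y = begin
    x * y * (x ^ d - y ^ d) * lattice N x y
      ≈⟨ solve 5 (λ x y X Y G → x :* y :* (X :- Y) :* G := x :* y :* (X :* G :- Y :* G)) refl x y (x ^ d) (y ^ d) (lattice N x y) ⟩
    x * y * (x ^ d * lattice N x y - y ^ d * lattice N x y)
      ≈⟨ *-congˡ (+-cong stepˣ (-‿cong stepʸ)) ⟩
    x * y * ((A - u 0 (d +ℕ N)) - (A - u (d +ℕ N) 0))
      ≈⟨ *-congˡ (solve 3 (λ A b c → (A :- b) :- (A :- c) := c :- b) refl A _ _) ⟩
    x * y * (u (d +ℕ N) 0 - u 0 (d +ℕ N))
      ≈⟨ *-congˡ (+-cong (*-congʳ (*-congˡ χP0)) (-‿cong (*-congʳ (*-congʳ χP0)))) ⟩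
    x * y * (χP (d +ℕ N) * 1# * (x ^ (d +ℕ N) * 1#) - 1# * χP (d +ℕ N) * (1# * y ^ (d +ℕ N)))
      ≈⟨ *-congˡ (solve 3 (λ k X Y → k :* con (1 , 0) :* (X :* con (1 , 0)) :- con (1 , 0) :* k :* (con (1 , 0) :* Y) := k :* (X :- Y)) refl _ _ _) ⟩
    x * y * (χP (d +ℕ N) * (x ^ (d +ℕ N) - y ^ (d +ℕ N))) ∎
    where
    χP0 : χP 0 ≈ 1#
    χP0 = χP-yes (divides 0 ≡.refl)
    u : ℕ → ℕ → Carrier
    u i j = χP i * χP j * (x ^ i * y ^ j)
    A = anti (d +ℕ N) u
    χd : ∀ i → χP (d +ℕ i) ≈ χP i
    χd i = reflexive (≡.cong ⟦_⟧ (χ-shift i d∣d))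
    -- No index strictly between 0 and d is a multiple of d, so apart from index 0 only those of the
    -- form d + i survive.
    gap : ∀ (v : ℕ → ℕ → Carrier) → (∀ i j → χP i ≈ 0# → v i j ≈ 0#) → anti (d +ℕ N) v ≈ v 0 (d +ℕ N) + anti N (λ i j → v (d +ℕ i) j)
    gap v v0 = +-congˡ (anti-drop e N (λ i → v (suc i)) λ i j i<e → v0 (suc i) j (χP-zero (χ-small i (s≤s i<e))))
    stepˣ : x ^ d * lattice N x y ≈ A - u 0 (d +ℕ N)
    stepˣ = begin
      x ^ d * lattice N x y                            ≈⟨ anti-*ˡ N _ _ ⟩
      anti N (λ i j → x ^ d * u i j)                   ≈⟨ anti-cong N (λ i j → trans (solve 5 (λ D a b X Y → D :* (a :* b :* (X :* Y)) := a :* b :* ((D :* X) :* Y)) refl _ _ _ _ _) (*-cong (*-congʳ (sym (χd i))) (*-congʳ (sym (^-homo-* x d i))))) ⟩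
      anti N (λ i j → u (d +ℕ i) j)                    ≈⟨ solve 2 (λ a b → b := (a :+ b) :- a) refl (u 0 (d +ℕ N)) _ ⟩
      (u 0 (d +ℕ N) + anti N (λ i j → u (d +ℕ i) j)) - u 0 (d +ℕ N)
                                                       ≈⟨ +-congʳ (gap u λ i j z → trans (*-congʳ (trans (*-congʳ z) (zeroˡ _))) (zeroˡ _)) ⟨
      A - u 0 (d +ℕ N) ∎
    stepʸ : y ^ d * lattice N x y ≈ A - u (d +ℕ N) 0
    stepʸ = begin
      y ^ d * lattice N x y                            ≈⟨ anti-*ˡ N _ _ ⟩
      anti N (λ i j → y ^ d * u i j)                   ≈⟨ anti-cong N (λ i j → trans (solve 5 (λ D a b X Y → D :* (a :* b :* (X :* Y)) := a :* b :* (X :* (D :* Y))) refl _ _ _ _ _) (*-cong (*-congˡ (sym (χd j))) (*-congˡ (sym (^-homo-* y d j))))) ⟩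
      anti N (λ i j → u i (d +ℕ j))                    ≈⟨ anti-flip N _ ⟩
      anti N (λ i j → u j (d +ℕ i))                    ≈⟨ solve 2 (λ a b → b := (a :+ b) :- a) refl (u (d +ℕ N) 0) _ ⟩
      (u (d +ℕ N) 0 + anti N (λ i j → u j (d +ℕ i))) - u (d +ℕ N) 0
                                                       ≈⟨ +-congʳ (gap (λ i j → u j i) λ i j z → trans (*-congʳ (trans (*-congˡ z) (zeroʳ _))) (zeroˡ _)) ⟨
      anti (d +ℕ N) (λ i j → u j i) - u (d +ℕ N) 0     ≈⟨ +-congʳ (anti-flip (d +ℕ N) u) ⟨
      A - u (d +ℕ N) 0 ∎

  -- The three determinants involved agree up to sign, so all three sums have the same denominator;
  -- in the numerators the terms with (x + y)^n cancel.
  lattice-star : ∀ N x y → Cancellable (Moore x y) → Star (lattice N) x y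
  lattice-star N x y cM = cancel cM (begin
    M * ((x + y) * L x y)
      ≈⟨ solve 4 (λ M x y L → M :* ((x :+ y) :* L) := (x :+ y) :* (M :* L)) refl M x y (L x y) ⟩
    (x + y) * (M * L x y)
      ≈⟨ *-congˡ (lattice-closed N x y) ⟩
    (x + y) * (x * y * (k * (x ^ n - y ^ n)))
      ≈⟨ solve 6 (λ x y k X Y Z → (x :+ y) :* (x :* y :* (k :* (X :- Y))) := :- (y :* ((x :+ y) :* x :* (k :* (Z :- X)))) :+ x :* ((x :+ y) :* y :* (k :* (Z :- Y)))) refl x y k (x ^ n) (y ^ n) ((x + y) ^ n) ⟩
    - (y * ((x + y) * x * (k * ((x + y) ^ n - x ^ n)))) + x * ((x + y) * y * (k * ((x + y) ^ n - y ^ n)))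
      ≈⟨ +-cong (-‿cong (*-congˡ (lattice-closed N (x + y) x))) (*-congˡ (lattice-closed N (x + y) y)) ⟨
    - (y * (Moore (x + y) x * L (x + y) x)) + x * (Moore (x + y) y * L (x + y) y)
      ≈⟨ +-cong (-‿cong (*-congˡ (*-congʳ (Moore-+ˡ x y)))) (*-congˡ (*-congʳ (Moore-+ʳ x y))) ⟩
    - (y * (- M * L (x + y) x)) + x * (M * L (x + y) y)
      ≈⟨ solve 5 (λ M x y A B → :- (y :* (:- M :* A)) :+ x :* (M :* B) := M :* (y :* A :+ x :* B)) refl M x y (L (x + y) x) (L (x + y) y) ⟩
    M * (y * L (x + y) x + x * L (x + y) y) ∎)
    where
    M = Moore x y
    L = lattice N
    n = d +ℕ N
    k = χP n

-- The depth 2 part through sums over F_q², and the complete identity for P.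

module StarIdentity {c ℓ p ℓp : Level} (e : ℕ) (F : FiniteField c ℓ (suc (suc e)))
                    (P : CommutativeRing p ℓp) (ι : Hom (FiniteField.ring F) P) where
  open FieldFacts e F using (K; enum; χ; δ; power-sum; ∑; module Over)
  open Gamma e F
  open OverAlgebra e F P ι public
  open RingKit P
  open Hom ι
  private module K = RingKit K
  open Over +-commutativeMonoid
  open MonoidSum +-commutativeMonoid using (sum; ∑-comm)

  ∑∑ : (K.Carrier → K.Carrier → Carrier) → Carrier
  ∑∑ f = ∑F (λ ρ → ∑F (λ σ → f ρ σ))

  ∑∑-cong : ∀ {f g} → (∀ ρ σ → f ρ σ ≈ g ρ σ) → ∑∑ f ≈ ∑∑ g
  ∑∑-cong h = ∑F-cong (λ ρ → ∑F-cong (h ρ))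

  ∑∑-swap : ∀ f → ∑∑ f ≈ ∑∑ (λ ρ σ → f σ ρ)
  ∑∑-swap f = trans (unfold f) (trans (∑-comm (λ i j → f (enum i) (enum j))) (sym (unfold (λ ρ σ → f σ ρ))))
    where
    unfold : ∀ f → ∑∑ f ≈ sum (λ i → sum (λ j → f (enum i) (enum j)))
    unfold f = trans (∑F-cong λ ρ → reflexive (∑F-unfold (f ρ))) (reflexive (∑F-unfold (λ ρ → sum (λ j → f ρ (enum j)))))

  ∑∑-+ : ∀ f g → ∑∑ (λ ρ σ → f ρ σ + g ρ σ) ≈ ∑∑ f + ∑∑ g
  ∑∑-+ f g = trans (∑F-cong (λ ρ → ∑F-distrib (f ρ) (g ρ))) (∑F-distrib _ _)

  ∑F-*ˡ : ∀ x f → ∑F (λ ρ → x * f ρ) ≈ x * ∑F f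
  ∑F-*ˡ x f = trans (reflexive (∑F-unfold (λ ρ → x * f ρ))) (trans (go _ (f ∘ enum)) (*-congˡ (reflexive (≡.sym (∑F-unfold f)))))
    where
    go : ∀ n (g : Fin n → Carrier) → sum (λ i → x * g i) ≈ x * sum g
    go zero    g = sym (zeroʳ x)
    go (suc n) g = trans (+-congˡ (go n (g ∘ suc))) (sym (distribˡ _ _ _))

  ∑F-hom : ∀ f → ∑F (λ ρ → ⟦ f ρ ⟧) ≈ ⟦ ∑ f ⟧
  ∑F-hom f = trans (reflexive (∑F-unfold (λ ρ → ⟦ f ρ ⟧))) (trans (go _ (f ∘ enum)) (⟦⟧-cong (K.reflexive (≡.sym (Over.∑F-unfold K.+-commutativeMonoid f)))))
    where
    go : ∀ n (g : Fin n → K.Carrier) → sum (λ i → ⟦ g i ⟧) ≈ ⟦ MonoidSum.sum K.+-commutativeMonoid g ⟧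
    go zero    g = sym ⟦⟧-0
    go (suc n) g = trans (+-congˡ (go n (g ∘ suc))) (sym (⟦⟧-+ _ _))

  ∑∑-product : ∀ x f g → ∑∑ (λ ρ σ → x * (⟦ f ρ ⟧ * ⟦ g σ ⟧)) ≈ x * (⟦ ∑ f ⟧ * ⟦ ∑ g ⟧)
  ∑∑-product x f g = begin
    ∑∑ (λ ρ σ → x * (⟦ f ρ ⟧ * ⟦ g σ ⟧))
      ≈⟨ ∑F-cong (λ ρ → trans (∑F-*ˡ x _) (*-congˡ (trans (∑F-*ˡ ⟦ f ρ ⟧ _) (trans (*-congˡ (∑F-hom g)) (*-comm _ _))))) ⟩
    ∑F (λ ρ → x * (⟦ ∑ g ⟧ * ⟦ f ρ ⟧))
      ≈⟨ trans (∑F-*ˡ x _) (*-congˡ (trans (∑F-*ˡ ⟦ ∑ g ⟧ _) (trans (*-congˡ (∑F-hom f)) (*-comm _ _)))) ⟩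
    x * (⟦ ∑ f ⟧ * ⟦ ∑ g ⟧) ∎

  ∑∑-anti : ∀ N (f : K.Carrier → K.Carrier → ℕ → ℕ → Carrier) → ∑∑ (λ ρ σ → anti N (f ρ σ)) ≈ anti N (λ k l → ∑∑ (λ ρ σ → f ρ σ k l))
  ∑∑-anti zero    f = refl
  ∑∑-anti (suc N) f = trans (∑∑-+ (λ ρ σ → f ρ σ 0 (suc N)) _) (+-congˡ (∑∑-anti N (λ ρ σ k → f ρ σ (suc k))))

  -- Expanding the m-th power produces power sums in ρ and σ, that is, binomial coefficients
  -- carrying divisibility masks: the data of `γ` in a form that allows linear changes of variables.
  kernel : ℕ → ℕ → Carrier → Carrier → Carrier
  kernel n m x y = ∑∑ (λ ρ σ → (⟦ ρ ⟧ * y ^ n + ⟦ σ ⟧ * x ^ n) * (⟦ ρ ⟧ * x + ⟦ σ ⟧ * y) ^ m)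

  -- The change of variables (ρ,σ) ↦ (ρ+σ,ρ), resp. (ρ,ρ+σ), on F_q².
  kernel-star : ∀ n m x y → kernel n m x y ≈ kernel n m (x + y) x + kernel n m (x + y) y
  kernel-star n m x y = sym (begin
    kernel n m (x + y) x + kernel n m (x + y) y
      ≈⟨ +-cong (∑F-cong (λ ρ → trans (∑F-cong λ σ → sym (at₁ ρ σ)) (shift (λ α → h₁ α ρ) (λ eq → h₁-cong eq) ρ)))
                (∑F-cong (λ ρ → trans (∑F-cong λ σ → sym (at₂ ρ σ)) (shift (h₂ ρ) (λ eq → h₂-cong eq) ρ))) ⟩
    ∑∑ (λ β α → h₁ α β) + ∑∑ h₂
      ≈⟨ +-congʳ (∑∑-swap (λ β α → h₁ α β)) ⟩
    ∑∑ h₁ + ∑∑ h₂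
      ≈⟨ ∑∑-+ h₁ h₂ ⟨
    ∑∑ (λ α β → h₁ α β + h₂ α β)
      -- The terms with (x + y)^n carry the opposite factors α - β and β - α and cancel.
      ≈⟨ ∑∑-cong (λ α β → trans (+-cong (*-congʳ (+-congˡ (*-congʳ (sub α β)))) (*-congʳ (+-congˡ (*-congʳ (sub β α)))))
           (solve 6 (λ a b X Y Z M → (b :* X :+ (a :- b) :* Z) :* M :+ (a :* Y :+ (b :- a) :* Z) :* M := (a :* Y :+ b :* X) :* M) refl ⟦ α ⟧ ⟦ β ⟧ (x ^ n) (y ^ n) ((x + y) ^ n) _)) ⟩
    kernel n m x y ∎)
    where
    sub : ∀ α β → ⟦ α K.- β ⟧ ≈ ⟦ α ⟧ - ⟦ β ⟧
    sub α β = trans (⟦⟧-+ _ _) (+-congˡ (⟦⟧-neg β))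
    h₁ h₂ : K.Carrier → K.Carrier → Carrier
    h₁ α β = (⟦ β ⟧ * x ^ n + ⟦ α K.- β ⟧ * (x + y) ^ n) * (⟦ α ⟧ * x + ⟦ β ⟧ * y) ^ m
    h₂ α β = (⟦ α ⟧ * y ^ n + ⟦ β K.- α ⟧ * (x + y) ^ n) * (⟦ α ⟧ * x + ⟦ β ⟧ * y) ^ m
    h₁-cong : ∀ {α α′ β} → α K.≈ α′ → h₁ α β ≈ h₁ α′ β
    h₁-cong eq = *-cong (+-congˡ (*-congʳ (⟦⟧-cong (K.+-congʳ eq)))) (^-congˡ m (+-congʳ (*-congʳ (⟦⟧-cong eq))))
    h₂-cong : ∀ {α β β′} → β K.≈ β′ → h₂ α β ≈ h₂ α β′
    h₂-cong eq = *-cong (+-congˡ (*-congʳ (⟦⟧-cong (K.+-congʳ eq)))) (^-congˡ m (+-congˡ (*-congʳ (⟦⟧-cong eq))))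
    shift : ∀ f → (∀ {α β} → α K.≈ β → f α ≈ f β) → ∀ ρ → ∑F (λ σ → f (ρ K.+ σ)) ≈ ∑F f
    shift f f-cong ρ = ∑F-reindex f f-cong (ρ K.+_) (K.- ρ K.+_) K.+-congˡ K.+-congˡ
      (λ z → K.solve 2 (λ r z → r K.:+ (K.:- r K.:+ z) K.:= z) K.refl ρ z)
      (λ z → K.solve 2 (λ r z → K.:- r K.:+ (r K.:+ z) K.:= z) K.refl ρ z)
    diff : ∀ ρ σ → (ρ K.+ σ) K.- ρ K.≈ σ
    diff ρ σ = K.solve 2 (λ r s → (r K.:+ s) K.:- r K.:= s) K.refl ρ σ
    at₁ : ∀ ρ σ → h₁ (ρ K.+ σ) ρ ≈ (⟦ ρ ⟧ * x ^ n + ⟦ σ ⟧ * (x + y) ^ n) * (⟦ ρ ⟧ * (x + y) + ⟦ σ ⟧ * x) ^ m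
    at₁ ρ σ = *-cong (+-congˡ (*-congʳ (⟦⟧-cong (diff ρ σ)))) (^-congˡ m (trans (+-congʳ (*-congʳ (⟦⟧-+ ρ σ)))
      (solve 4 (λ r s x y → (r :+ s) :* x :+ r :* y := r :* (x :+ y) :+ s :* x) refl ⟦ ρ ⟧ ⟦ σ ⟧ x y)))
    at₂ : ∀ ρ σ → h₂ ρ (ρ K.+ σ) ≈ (⟦ ρ ⟧ * y ^ n + ⟦ σ ⟧ * (x + y) ^ n) * (⟦ ρ ⟧ * (x + y) + ⟦ σ ⟧ * y) ^ m
    at₂ ρ σ = *-cong (+-congˡ (*-congʳ (⟦⟧-cong (diff ρ σ)))) (^-congˡ m (trans (+-congˡ (*-congʳ (⟦⟧-+ ρ σ)))
      (solve 4 (λ r s x y → r :* x :+ (r :+ s) :* y := r :* (x :+ y) :+ s :* y) refl ⟦ ρ ⟧ ⟦ σ ⟧ x y)))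

  half-kernel : ℕ → ℕ → Carrier → Carrier → Carrier
  half-kernel n m x y = ∑∑ (λ ρ σ → ⟦ ρ ⟧ * y ^ n * (⟦ ρ ⟧ * x + ⟦ σ ⟧ * y) ^ m)

  kernel-halves : ∀ n m x y → kernel n m x y ≈ half-kernel n m x y + half-kernel n m y x
  kernel-halves n m x y = begin
    kernel n m x y
      ≈⟨ ∑∑-cong (λ ρ σ → distribʳ _ _ _) ⟩
    ∑∑ (λ ρ σ → ⟦ ρ ⟧ * y ^ n * (⟦ ρ ⟧ * x + ⟦ σ ⟧ * y) ^ m + ⟦ σ ⟧ * x ^ n * (⟦ ρ ⟧ * x + ⟦ σ ⟧ * y) ^ m)
      ≈⟨ ∑∑-+ _ _ ⟩
    half-kernel n m x y + ∑∑ (λ ρ σ → ⟦ σ ⟧ * x ^ n * (⟦ ρ ⟧ * x + ⟦ σ ⟧ * y) ^ m)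
      ≈⟨ +-congˡ (trans (∑∑-swap _) (∑∑-cong λ ρ σ → *-congˡ (^-congˡ m (+-comm _ _)))) ⟩
    half-kernel n m x y + half-kernel n m y x ∎

  -- The double sum factors into two power sums; the leading factor ρ raises its exponent from k to
  -- k + 1.
  half-kernel-expand : ∀ n m x y → half-kernel n m x y ≈
    anti m (λ k l → natR (m C k) * (x ^ k * y ^ (n +ℕ l)) * (⟦ δ (suc k) K.- χ (suc k) ⟧ * ⟦ δ l K.- χ l ⟧))
  half-kernel-expand n m x y = begin
    half-kernel n m x y
      ≈⟨ ∑∑-cong (λ ρ σ → trans (*-congˡ (binomial m _ _)) (trans (anti-*ˡ m _ _) (anti-cong m (term ρ σ)))) ⟩
    ∑∑ (λ ρ σ → anti m (λ k l → natR (m C k) * (x ^ k * y ^ (n +ℕ l)) * (⟦ ρ K.^ suc k ⟧ * ⟦ σ K.^ l ⟧)))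
      ≈⟨ ∑∑-anti m _ ⟩
    anti m (λ k l → ∑∑ (λ ρ σ → natR (m C k) * (x ^ k * y ^ (n +ℕ l)) * (⟦ ρ K.^ suc k ⟧ * ⟦ σ K.^ l ⟧)))
      ≈⟨ anti-cong m (λ k l → trans (∑∑-product _ (K._^ suc k) (K._^ l)) (*-congˡ (*-cong (⟦⟧-cong (power-sum (suc k))) (⟦⟧-cong (power-sum l))))) ⟩
    anti m (λ k l → natR (m C k) * (x ^ k * y ^ (n +ℕ l)) * (⟦ δ (suc k) K.- χ (suc k) ⟧ * ⟦ δ l K.- χ l ⟧)) ∎
    where
    term : ∀ ρ σ k l → ⟦ ρ ⟧ * y ^ n * (natR (m C k) * ((⟦ ρ ⟧ * x) ^ k * (⟦ σ ⟧ * y) ^ l)) ≈ natR (m C k) * (x ^ k * y ^ (n +ℕ l)) * (⟦ ρ K.^ suc k ⟧ * ⟦ σ K.^ l ⟧)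
    term ρ σ k l = begin
      ⟦ ρ ⟧ * y ^ n * (natR (m C k) * ((⟦ ρ ⟧ * x) ^ k * (⟦ σ ⟧ * y) ^ l))
        ≈⟨ *-congˡ (*-congˡ (*-cong (^-distrib-* ⟦ ρ ⟧ x k) (^-distrib-* ⟦ σ ⟧ y l))) ⟩
      ⟦ ρ ⟧ * y ^ n * (natR (m C k) * ((⟦ ρ ⟧ ^ k * x ^ k) * (⟦ σ ⟧ ^ l * y ^ l)))
        ≈⟨ solve 7 (λ r yn c rk xk sl yl → r :* yn :* (c :* ((rk :* xk) :* (sl :* yl))) := c :* (xk :* (yn :* yl)) :* ((r :* rk) :* sl)) refl ⟦ ρ ⟧ (y ^ n) (natR (m C k)) (⟦ ρ ⟧ ^ k) (x ^ k) (⟦ σ ⟧ ^ l) (y ^ l) ⟩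
      natR (m C k) * (x ^ k * (y ^ n * y ^ l)) * (⟦ ρ ⟧ ^ suc k * ⟦ σ ⟧ ^ l)
        ≈⟨ *-cong (*-congˡ (*-congˡ (^-homo-* y n l))) (*-cong (⟦⟧-^ ρ (suc k)) (⟦⟧-^ σ l)) ⟨
      natR (m C k) * (x ^ k * y ^ (n +ℕ l)) * (⟦ ρ K.^ suc k ⟧ * ⟦ σ K.^ l ⟧) ∎

  anti-δ : ∀ m (f : ℕ → ℕ → Carrier) → anti m (λ k l → f k l * ⟦ δ l ⟧) ≈ f m 0
  anti-δ zero    f = trans (*-congˡ ⟦⟧-1) (*-identityʳ _)
  anti-δ (suc m) f = trans (anti-last m (λ k l → f k l * ⟦ δ l ⟧)) (trans (+-cong (anti-0′ m λ a b _ → trans (*-congˡ ⟦⟧-0) (zeroʳ _)) (trans (*-congˡ ⟦⟧-1) (*-identityʳ _))) (+-identityˡ _))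

  χχ : ℕ → ℕ → Carrier
  χχ n m = χP (suc n) * χP (suc m)

  -- In the product of the two power sums the part with -χ l yields one half of the `γ` sum, while
  -- `δ l` contributes only at l = 0 and yields the extra monomial.
  half-kernel-γ : ∀ n m x y →
    anti (n +ℕ m) (λ a b → χχ a b * (χP (suc m) * (signP a * natR (m C a))) * (x ^ a * y ^ b)) + χχ n m * (x ^ m * y ^ n)
      ≈ - (χχ n m * half-kernel n m x y)
  half-kernel-γ n m x y = sym (begin
    - (χχ n m * half-kernel n m x y)
      ≈⟨ -‿cong (*-congˡ (half-kernel-expand n m x y)) ⟩
    - (χχ n m * anti m (λ k l → natR (m C k) * (x ^ k * y ^ (n +ℕ l)) * (⟦ δ (suc k) K.- χ (suc k) ⟧ * ⟦ δ l K.- χ l ⟧)))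
      ≈⟨ trans (-‿cong (anti-*ˡ m _ _)) (anti-neg m _) ⟩
    anti m (λ k l → - (χχ n m * (natR (m C k) * (x ^ k * y ^ (n +ℕ l)) * (⟦ δ (suc k) K.- χ (suc k) ⟧ * ⟦ δ l K.- χ l ⟧))))
      ≈⟨ anti-cong m (λ k l → trans (-‿cong (*-congˡ (*-congˡ (*-cong (minus-χ k) (sub l)))))
           (solve 5 (λ X c a D b → :- (X :* (c :* (:- a :* (D :- b)))) := (:- (X :* c :* a :* b) :+ X :* c :* a :* D)) refl _ _ _ _ _)) ⟩
    anti m (λ k l → - (χχ n m * V k l * χP (suc k) * χP l) + χχ n m * V k l * χP (suc k) * ⟦ δ l ⟧)
      ≈⟨ trans (anti-+ m _ _) (+-cong left right) ⟩
    anti (n +ℕ m) (λ a b → χχ a b * (χP (suc m) * (signP a * natR (m C a))) * (x ^ a * y ^ b)) + χχ n m * (x ^ m * y ^ n) ∎)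
    where
    V : ℕ → ℕ → Carrier
    V k l = natR (m C k) * (x ^ k * y ^ (n +ℕ l))
    minus-χ : ∀ k → ⟦ δ (suc k) K.- χ (suc k) ⟧ ≈ - χP (suc k)
    minus-χ k = trans (⟦⟧-cong (K.+-identityˡ _)) (⟦⟧-neg _)
    sub : ∀ l → ⟦ δ l K.- χ l ⟧ ≈ ⟦ δ l ⟧ - χP l
    sub l = trans (⟦⟧-+ _ _) (+-congˡ (⟦⟧-neg _))
    right : anti m (λ k l → χχ n m * V k l * χP (suc k) * ⟦ δ l ⟧) ≈ χχ n m * (x ^ m * y ^ n)
    right = begin
      anti m (λ k l → χχ n m * V k l * χP (suc k) * ⟦ δ l ⟧)
        ≈⟨ anti-δ m _ ⟩
      χP (suc n) * χP (suc m) * V m 0 * χP (suc m)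
        ≈⟨ solve 3 (λ a b v → a :* b :* v :* b := a :* (b :* b) :* v) refl _ _ _ ⟩
      χP (suc n) * (χP (suc m) * χP (suc m)) * V m 0
        ≈⟨ *-cong (*-congˡ (χP-idem (suc m))) (trans (*-cong (trans (reflexive (≡.cong natR (nCn≡1 m))) (+-identityʳ 1#)) (*-congˡ (reflexive (≡.cong (y ^_) (ℕₚ.+-identityʳ n))))) (*-identityˡ _)) ⟩
      χχ n m * (x ^ m * y ^ n) ∎
    -- Given k + l = m, both sides express that d divides k + 1, l and n + 1.
    masks : ∀ k l → k +ℕ l ≡ m → χχ n m * χP (suc k) * χP l ≈ χP (suc k) * χP (suc (n +ℕ l)) * χP (suc m)
    masks k l ≡.refl = begin
      χP (suc n) * χP (suc (k +ℕ l)) * χP (suc k) * χP l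
        ≈⟨ solve 4 (λ a b c d → a :* b :* c :* d := (c :* b) :* (a :* d)) refl _ _ _ _ ⟩
      (χP (suc k) * χP (suc (k +ℕ l))) * (χP (suc n) * χP l)
        ≈⟨ *-congʳ (χP-+ (suc k) l) ⟩
      (χP (suc k) * χP l) * (χP (suc n) * χP l)
        ≈⟨ solve 3 (λ c d a → (c :* d) :* (a :* d) := (d :* c) :* (d :* a)) refl _ _ _ ⟩
      (χP l * χP (suc k)) * (χP l * χP (suc n))
        ≈⟨ *-congˡ (trans (sym (χP-+ l (suc n))) (*-congˡ (reflexive (≡.cong χP (ℕₚ.+-comm l (suc n)))))) ⟩
      (χP l * χP (suc k)) * (χP l * χP (suc (n +ℕ l)))
        ≈⟨ solve 3 (λ d c b → (d :* c) :* (d :* b) := c :* (d :* d) :* b) refl _ _ _ ⟩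
      χP (suc k) * (χP l * χP l) * χP (suc (n +ℕ l))
        ≈⟨ *-congʳ (trans (*-congˡ (χP-idem l)) (sym (χP-+ (suc k) l))) ⟩
      χP (suc k) * χP (suc (k +ℕ l)) * χP (suc (n +ℕ l))
        ≈⟨ solve 3 (λ a b c → a :* b :* c := a :* c :* b) refl _ _ _ ⟩
      χP (suc k) * χP (suc (n +ℕ l)) * χP (suc (k +ℕ l)) ∎
    left : anti m (λ k l → - (χχ n m * V k l * χP (suc k) * χP l)) ≈ anti (n +ℕ m) (λ a b → χχ a b * (χP (suc m) * (signP a * natR (m C a))) * (x ^ a * y ^ b))
    left = sym (begin
      anti (n +ℕ m) (λ a b → χχ a b * (χP (suc m) * (signP a * natR (m C a))) * (x ^ a * y ^ b))
        ≈⟨ anti-trunc n m _ (λ a b m<a → trans (*-congʳ (trans (*-congˡ (trans (*-congˡ (trans (*-congˡ (natC-0 m<a)) (zeroʳ _))) (zeroʳ _))) (zeroʳ _))) (zeroˡ _)) ⟩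
      anti m (λ k l → χP (suc k) * χP (suc (n +ℕ l)) * (χP (suc m) * (signP k * natR (m C k))) * (x ^ k * y ^ (n +ℕ l)))
        ≈⟨ anti-cong′ m (λ k l eq → begin
             χP (suc k) * χP (suc (n +ℕ l)) * (χP (suc m) * (signP k * natR (m C k))) * (x ^ k * y ^ (n +ℕ l))
               ≈⟨ solve 6 (λ a b c s C p → a :* b :* (c :* (s :* C)) :* p := a :* (s :* (b :* c :* (C :* p)))) refl _ _ _ _ _ _ ⟩
             χP (suc k) * (signP k * (χP (suc (n +ℕ l)) * χP (suc m) * V k l))
               ≈⟨ χP-cong (suc k) (λ h → *-congʳ (sign-pred h)) ⟩
             χP (suc k) * (- 1# * (χP (suc (n +ℕ l)) * χP (suc m) * V k l))
               ≈⟨ solve 4 (λ a b c v → a :* (:- con (1 , 0) :* (b :* c :* v)) := :- (a :* b :* c :* v)) refl _ _ _ _ ⟩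
             - (χP (suc k) * χP (suc (n +ℕ l)) * χP (suc m) * V k l)
               ≈⟨ -‿cong (*-congʳ (masks k l eq)) ⟨
             - (χχ n m * χP (suc k) * χP l * V k l)
               ≈⟨ -‿cong (solve 4 (λ a b c v → a :* b :* c :* v := a :* v :* b :* c) refl _ _ _ _) ⟩
             - (χχ n m * V k l * χP (suc k) * χP l) ∎) ⟩
      anti m (λ k l → - (χχ n m * V k l * χP (suc k) * χP l)) ∎)

  -- The coefficient of the word x_{n+1} x_{m+1} in Q(x) ⧢ Q(y), divided by x y: the two
  -- concatenations first, then the contributions of the diamond product.
  depth2 : ℕ → ℕ → Carrier → Carrier → Carrier
  depth2 n m x y = χχ n m * (x ^ n * y ^ m + x ^ m * y ^ n) + anti (n +ℕ m) (λ a b → χχ a b * ⟦ γ a b m ⟧ * (x ^ a * y ^ b))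

  depth2-kernel : ∀ n m x y → depth2 n m x y ≈ - (χχ n m * kernel n m x y)
  depth2-kernel n m x y = begin
    depth2 n m x y
      ≈⟨ +-cong refl (trans (anti-cong (n +ℕ m) λ a b → trans (*-congʳ (*-congˡ (⟦γ⟧ a b m)))
           (solve 7 (λ a b c A B X Y → a :* b :* (c :* (A :+ B)) :* (X :* Y) := a :* b :* (c :* A) :* (X :* Y) :+ b :* a :* (c :* B) :* (Y :* X)) refl _ _ _ _ _ _ _)) (anti-+ (n +ℕ m) _ _)) ⟩
    χχ n m * (x ^ n * y ^ m + x ^ m * y ^ n) + (T x y + anti (n +ℕ m) (λ a b → χχ b a * (χP (suc m) * (signP b * natR (m C b))) * (y ^ b * x ^ a)))
      ≈⟨ +-congˡ (+-congˡ (anti-flip (n +ℕ m) _)) ⟩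
    χχ n m * (x ^ n * y ^ m + x ^ m * y ^ n) + (T x y + T y x)
      ≈⟨ solve 7 (λ c a b a′ b′ S U → c :* (a :* b :+ a′ :* b′) :+ (S :+ U) := (S :+ c :* (a′ :* b′)) :+ (U :+ c :* (b :* a))) refl _ _ _ _ _ _ _ ⟩
    (T x y + χχ n m * (x ^ m * y ^ n)) + (T y x + χχ n m * (y ^ m * x ^ n))
      ≈⟨ +-cong (half-kernel-γ n m x y) (half-kernel-γ n m y x) ⟩
    - (χχ n m * half-kernel n m x y) + - (χχ n m * half-kernel n m y x)
      ≈⟨ solve 3 (λ c a b → :- (c :* a) :+ :- (c :* b) := :- (c :* (a :+ b))) refl _ _ _ ⟩
    - (χχ n m * (half-kernel n m x y + half-kernel n m y x))
      ≈⟨ -‿cong (*-congˡ (kernel-halves n m x y)) ⟨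
    - (χχ n m * kernel n m x y) ∎
    where
    T : Carrier → Carrier → Carrier
    T x y = anti (n +ℕ m) (λ a b → χχ a b * (χP (suc m) * (signP a * natR (m C a))) * (x ^ a * y ^ b))

  depth2-star : ∀ n m x y → depth2 n m x y ≈ depth2 n m (x + y) x + depth2 n m (x + y) y
  depth2-star n m x y = begin
    depth2 n m x y ≈⟨ depth2-kernel n m x y ⟩
    - (χχ n m * kernel n m x y) ≈⟨ -‿cong (*-congˡ (kernel-star n m x y)) ⟩
    - (χχ n m * (kernel n m (x + y) x + kernel n m (x + y) y))
      ≈⟨ solve 3 (λ c a b → :- (c :* (a :+ b)) := :- (c :* a) :+ :- (c :* b)) refl _ _ _ ⟩
    - (χχ n m * kernel n m (x + y) x) + - (χχ n m * kernel n m (x + y) y)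
      ≈⟨ +-cong (depth2-kernel n m (x + y) x) (depth2-kernel n m (x + y) y) ⟨
    depth2 n m (x + y) x + depth2 n m (x + y) y ∎

  -- Here g₀, G n 0 and G n (m + 1) stand for the values of a linear functional at the
  -- words 1, x_{n+1} and x_{n+1}x_{m+1}; then pair i j is its value at x_i ⧢ x_j, with x_0 = 1.
  module Pair (g₀ : Carrier) (G : ℕ → ℕ → Carrier) where
    pair : ℕ → ℕ → Carrier
    pair zero    zero    = g₀
    pair zero    (suc b) = G b 0
    pair (suc a) zero    = G a 0
    pair (suc a) (suc b) = G a (suc b) + (G b (suc a) + dia a b G)

    form : ℕ → Carrier → Carrier → Carrier
    form N x y = anti N (λ i j → χP i * χP j * pair i j * (x ^ i * y ^ j))

    private
      -- The value at x_{i+j}, which x_i ⧢ x_j contains with coefficient 1. It depends on i + j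
      -- alone and so leaves the sum as a constant; `d₂` collects depth 2.
      d₁ : ℕ → Carrier
      d₁ zero    = g₀
      d₁ (suc n) = G n 0

      d₂ : ℕ → ℕ → Carrier
      d₂ (suc a) (suc b) = G a (suc b) + (G b (suc a) + anti (a +ℕ b) (λ n m → ⟦ γ a b m ⟧ * G n (suc m)))
      d₂ _       _       = 0#

      pair-split : ∀ i j → pair i j ≈ d₁ (i +ℕ j) + d₂ i j
      pair-split zero    zero    = sym (+-identityʳ _)
      pair-split zero    (suc b) = sym (+-identityʳ _)
      pair-split (suc a) zero    = trans (reflexive (≡.cong (λ n → G n 0) (≡.sym (ℕₚ.+-identityʳ a)))) (sym (+-identityʳ _))
      pair-split (suc a) (suc b) = trans
        (solve 4 (λ p r s t → p :+ (r :+ (s :+ t)) := s :+ (p :+ (r :+ t))) refl _ _ _ _)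
        (+-congʳ (reflexive (≡.cong (λ n → G n 0) (≡.sym (ℕₚ.+-suc a b)))))

      form₂ : ℕ → Carrier → Carrier → Carrier
      form₂ N x y = anti N (λ i j → χP i * χP j * d₂ i j * (x ^ i * y ^ j))

      form-split : ∀ N x y → form N x y ≈ d₁ N * lattice N x y + form₂ N x y
      form-split N x y = begin
        form N x y
          ≈⟨ anti-cong′ N (λ { i j ≡.refl → trans (*-congʳ (*-congˡ (pair-split i j)))
               (solve 5 (λ a b c d p → a :* b :* (c :+ d) :* p := c :* (a :* b :* p) :+ a :* b :* d :* p) refl _ _ _ _ _) }) ⟩
        anti N (λ i j → d₁ (i +ℕ j) * (χP i * χP j * (x ^ i * y ^ j)) + χP i * χP j * d₂ i j * (x ^ i * y ^ j))
          ≈⟨ trans (anti-+ N _ _) (+-congʳ (trans (anti-cong′ N λ { i j ≡.refl → refl }) (sym (anti-*ˡ N (d₁ N) _)))) ⟩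
        d₁ N * lattice N x y + form₂ N x y ∎

      zero-term : ∀ {a b p} → a * b * 0# * p ≈ 0#
      zero-term {a} {b} {p} = solve 3 (λ a b p → a :* b :* con (0 , 0) :* p := con (0 , 0)) refl a b p

      -- The sum is rearranged by resulting words instead of by pairs of letters; depth 2 requires
      -- both indices to be positive, whence the factor x y.
      form₂-depth2 : ∀ M x y → form₂ (suc (suc M)) x y ≈ x * y * anti M (λ n m → G n (suc m) * depth2 n m x y)
      form₂-depth2 M x y = begin
        form₂ (suc (suc M)) x y
          ≈⟨ trans (+-congʳ zero-term) (trans (+-identityˡ _) (trans (anti-last M (λ a j → χP (suc a) * χP j * d₂ (suc a) j * (x ^ suc a * y ^ j))) (trans (+-congˡ zero-term) (+-identityʳ _)))) ⟩
        anti M (λ a b → χχ a b * d₂ (suc a) (suc b) * (x * x ^ a * (y * y ^ b)))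
          ≈⟨ anti-cong′ M (λ { a b ≡.refl → trans
               (solve 8 (λ k A B Γ x y X Y → k :* (A :+ (B :+ Γ)) :* (x :* X :* (y :* Y)) := x :* y :* (A :* (k :* (X :* Y)) :+ (B :* (k :* (X :* Y)) :+ Γ :* (k :* (X :* Y))))) refl _ _ _ _ _ _ _ _) refl }) ⟩
        anti M (λ a b → x * y * (G a (suc b) * W a b + (G b (suc a) * W a b + anti (a +ℕ b) (λ n m → ⟦ γ a b m ⟧ * G n (suc m)) * W a b)))
          ≈⟨ anti-*ˡ M _ _ ⟨
        x * y * anti M (λ a b → G a (suc b) * W a b + (G b (suc a) * W a b + anti (a +ℕ b) (λ n m → ⟦ γ a b m ⟧ * G n (suc m)) * W a b))
          ≈⟨ *-congˡ (trans (anti-+ M _ _) (+-congˡ (anti-+ M _ _))) ⟩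
        x * y * (anti M (λ a b → G a (suc b) * W a b) + (anti M (λ a b → G b (suc a) * W a b) + anti M (λ a b → anti (a +ℕ b) (λ n m → ⟦ γ a b m ⟧ * G n (suc m)) * W a b)))
          ≈⟨ *-congˡ (+-congˡ (+-cong (anti-flip M _) swapped)) ⟩
        x * y * (anti M (λ n m → G n (suc m) * W n m) + (anti M (λ n m → G n (suc m) * W m n) + anti M (λ n m → G n (suc m) * Z n m)))
          ≈⟨ *-congˡ (trans (anti-+ M _ _) (+-congˡ (anti-+ M _ _))) ⟨
        x * y * anti M (λ n m → G n (suc m) * W n m + (G n (suc m) * W m n + G n (suc m) * Z n m))
          ≈⟨ *-congˡ (anti-cong M λ n m →
               solve 8 (λ g a b X Y X′ Y′ Z → g :* (a :* b :* (X :* Y)) :+ (g :* (b :* a :* (X′ :* Y′)) :+ g :* Z) := g :* (a :* b :* (X :* Y :+ X′ :* Y′) :+ Z)) refl _ _ _ _ _ _ _ _) ⟩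
        x * y * anti M (λ n m → G n (suc m) * depth2 n m x y) ∎
        where
        W Z : ℕ → ℕ → Carrier
        W a b = χχ a b * (x ^ a * y ^ b)
        Z n m = anti (n +ℕ m) (λ a b → χχ a b * ⟦ γ a b m ⟧ * (x ^ a * y ^ b))
        swapped : anti M (λ a b → anti (a +ℕ b) (λ n m → ⟦ γ a b m ⟧ * G n (suc m)) * W a b) ≈ anti M (λ n m → G n (suc m) * Z n m)
        swapped = begin
          anti M (λ a b → anti (a +ℕ b) (λ n m → ⟦ γ a b m ⟧ * G n (suc m)) * W a b)
            ≈⟨ anti-cong′ M (λ { a b ≡.refl → trans (anti-*ʳ M _ _) (anti-cong M λ n m → solve 4 (λ g G k p → g :* G :* (k :* p) := G :* (k :* g :* p)) refl _ _ _ _) }) ⟩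
          anti M (λ a b → anti M (λ n m → G n (suc m) * (χχ a b * ⟦ γ a b m ⟧ * (x ^ a * y ^ b))))
            ≈⟨ anti-swap M M (λ a b n m → G n (suc m) * (χχ a b * ⟦ γ a b m ⟧ * (x ^ a * y ^ b))) ⟩
          anti M (λ n m → anti M (λ a b → G n (suc m) * (χχ a b * ⟦ γ a b m ⟧ * (x ^ a * y ^ b))))
            ≈⟨ anti-cong′ M (λ { n m ≡.refl → sym (anti-*ˡ M _ _) }) ⟩
          anti M (λ n m → G n (suc m) * Z n m) ∎

      form₂-star : ∀ N x y → Star (form₂ N) x y
      form₂-star zero x y = trans (*-congˡ zero-term) (trans (zeroʳ _) (sym (trans (+-cong (trans (*-congˡ zero-term) (zeroʳ _)) (trans (*-congˡ zero-term) (zeroʳ _))) (+-identityˡ _))))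
      form₂-star (suc zero) x y = trans (*-congˡ zero₁) (trans (zeroʳ _) (sym (trans (+-cong (trans (*-congˡ zero₁) (zeroʳ _)) (trans (*-congˡ zero₁) (zeroʳ _))) (+-identityˡ _))))
        where
        zero₁ : ∀ {x y} → form₂ 1 x y ≈ 0#
        zero₁ = trans (+-cong zero-term zero-term) (+-identityˡ _)
      form₂-star (suc (suc M)) x y = begin
        (x + y) * form₂ (suc (suc M)) x y
          ≈⟨ *-congˡ (form₂-depth2 M x y) ⟩
        (x + y) * (x * y * anti M (λ n m → G n (suc m) * depth2 n m x y))
          ≈⟨ *-congˡ (*-congˡ (trans (anti-cong M λ n m → trans (*-congˡ (depth2-star n m x y)) (distribˡ _ _ _)) (anti-+ M _ _))) ⟩
        (x + y) * (x * y * (A + B))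
          ≈⟨ solve 4 (λ x y A B → (x :+ y) :* (x :* y :* (A :+ B)) := y :* ((x :+ y) :* x :* A) :+ x :* ((x :+ y) :* y :* B)) refl x y A B ⟩
        y * ((x + y) * x * A) + x * ((x + y) * y * B)
          ≈⟨ +-cong (*-congˡ (form₂-depth2 M (x + y) x)) (*-congˡ (form₂-depth2 M (x + y) y)) ⟨
        y * form₂ (suc (suc M)) (x + y) x + x * form₂ (suc (suc M)) (x + y) y ∎
        where
        A = anti M (λ n m → G n (suc m) * depth2 n m (x + y) x)
        B = anti M (λ n m → G n (suc m) * depth2 n m (x + y) y)

    -- `Star` is linear in f, so the two depths may be added. The cancellable determinant serves the
    -- depth 1 part.
    form-star : ∀ N x y → Cancellable (Moore x y) → Star (form N) x y
    form-star N x y cM = begin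
      (x + y) * form N x y
        ≈⟨ *-congˡ (form-split N x y) ⟩
      (x + y) * (d₁ N * lattice N x y + form₂ N x y)
        ≈⟨ solve 4 (λ s D L F → s :* (D :* L :+ F) := D :* (s :* L) :+ s :* F) refl (x + y) (d₁ N) (lattice N x y) (form₂ N x y) ⟩
      d₁ N * ((x + y) * lattice N x y) + (x + y) * form₂ N x y
        ≈⟨ +-cong (*-congˡ (lattice-star N x y cM)) (form₂-star N x y) ⟩
      d₁ N * (y * lattice N (x + y) x + x * lattice N (x + y) y) + (y * form₂ N (x + y) x + x * form₂ N (x + y) y)
        ≈⟨ solve 7 (λ x y D L L′ F F′ → D :* (y :* L :+ x :* L′) :+ (y :* F :+ x :* F′) := y :* (D :* L :+ F) :+ x :* (D :* L′ :+ F′)) refl x y _ _ _ _ _ ⟩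
      y * (d₁ N * lattice N (x + y) x + form₂ N (x + y) x) + x * (d₁ N * lattice N (x + y) y + form₂ N (x + y) y)
        ≈⟨ +-cong (*-congˡ (form-split N (x + y) x)) (*-congˡ (form-split N (x + y) y)) ⟨
      y * form N (x + y) x + x * form N (x + y) y ∎

    pair-sym : ∀ i j → pair i j ≈ pair j i
    pair-sym zero    zero    = refl
    pair-sym zero    (suc b) = refl
    pair-sym (suc a) zero    = refl
    pair-sym (suc a) (suc b) = trans (solve 3 (λ p r s → p :+ (r :+ s) := r :+ (p :+ s)) refl _ _ _) (+-congˡ (+-congˡ (dia-sym a b G)))
      where
      dia-sym : ∀ a b G → dia a b G ≈ dia b a G
      dia-sym a b G = trans (+-congˡ (anti-cong (a +ℕ b) λ n m → *-congʳ (⟦⟧-cong (γ-sym a b m))))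
        (reflexive (≡.cong (λ N → G (suc N) 0 + anti N (λ n m → ⟦ γ b a m ⟧ * G n (suc m))) (ℕₚ.+-comm a b)))

    form-sym : ∀ N x y → form N x y ≈ form N y x
    form-sym N x y = trans (anti-flip N _) (anti-cong N λ i j → trans (*-congʳ (*-congˡ (pair-sym j i)))
      (solve 5 (λ a b p X Y → b :* a :* p :* (X :* Y) := a :* b :* p :* (Y :* X)) refl _ _ _ _ _))

    -- The mask forces (-1)^i = 1: Q is an even series.
    form-negˡ : ∀ N x y → form N (- x) y ≈ form N x y
    form-negˡ N x y = anti-cong N λ i j → begin
      χP i * χP j * pair i j * ((- x) ^ i * y ^ j)
        ≈⟨ solve 5 (λ a b p X Y → a :* b :* p :* (X :* Y) := a :* (X :* (b :* p :* Y))) refl _ _ _ _ _ ⟩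
      χP i * ((- x) ^ i * (χP j * pair i j * y ^ j))
        ≈⟨ χP-cong i (λ di → *-congʳ (even-^ x di)) ⟩
      χP i * (x ^ i * (χP j * pair i j * y ^ j))
        ≈⟨ solve 5 (λ a b p X Y → a :* (X :* (b :* p :* Y)) := a :* b :* p :* (X :* Y)) refl _ _ _ _ _ ⟩
      χP i * χP j * pair i j * (x ^ i * y ^ j) ∎

-- Formal linear combinations and the shuffle product of words.

module Linear {c ℓ : Level} (R : CommutativeRing c ℓ) where
  open RingKit R

  Free : ∀ {a} → Set a → Set (c ⊔ a)
  Free X = List (Carrier × X)

  -- Identities between formal combinations are stated by pairing with every functional.
  ∫ : ∀ {a} {X : Set a} → Free X → (X → Carrier) → Carrier
  ∫ []            φ = 0#
  ∫ ((k , x) ∷ l) φ = k * φ x + ∫ l φ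

  ret : ∀ {a} {X : Set a} → X → Free X
  ret x = (1# , x) ∷ []

  scl : ∀ {a} {X : Set a} → Carrier → Free X → Free X
  scl k = List.map (λ (k′ , x) → k * k′ , x)

  mapF : ∀ {a b} {X : Set a} {Y : Set b} → (X → Y) → Free X → Free Y
  mapF h = List.map (λ (k , x) → k , h x)

  bind : ∀ {a b} {X : Set a} {Y : Set b} → Free X → (X → Free Y) → Free Y
  bind l f = List.concatMap (λ (k , x) → scl k (f x)) l

  antiL : ∀ {a} {X : Set a} → ℕ → (ℕ → ℕ → Free X) → Free X
  antiL zero    F = F 0 0
  antiL (suc N) F = F 0 (suc N) ++ antiL N (λ a → F (suc a))

  module _ {a} {X : Set a} where
    ∫-cong : ∀ (l : Free X) {φ ψ : X → Carrier} → (∀ x → φ x ≈ ψ x) → ∫ l φ ≈ ∫ l ψ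
    ∫-cong []            h = refl
    ∫-cong ((k , x) ∷ l) h = +-cong (*-congˡ (h x)) (∫-cong l h)

    ∫-+ : ∀ (l : Free X) φ ψ → ∫ l (λ x → φ x + ψ x) ≈ ∫ l φ + ∫ l ψ
    ∫-+ []            φ ψ = sym (+-identityˡ _)
    ∫-+ ((k , x) ∷ l) φ ψ = trans (+-cong (distribˡ _ _ _) (∫-+ l φ ψ)) (+-interchange _ _ _ _)

    ∫-* : ∀ (l : Free X) k φ → ∫ l (λ x → k * φ x) ≈ k * ∫ l φ
    ∫-* []             k φ = sym (zeroʳ k)
    ∫-* ((k′ , x) ∷ l) k φ = trans (+-cong (solve 3 (λ a b c → a :* (b :* c) := b :* (a :* c)) refl _ _ _) (∫-* l k φ)) (sym (distribˡ _ _ _))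

    ∫-0 : ∀ (l : Free X) → ∫ l (λ _ → 0#) ≈ 0#
    ∫-0 []            = refl
    ∫-0 ((k , x) ∷ l) = trans (+-cong (zeroʳ k) (∫-0 l)) (+-identityˡ _)

    ∫-++ : ∀ (l l′ : Free X) φ → ∫ (l ++ l′) φ ≈ ∫ l φ + ∫ l′ φ
    ∫-++ []            l′ φ = sym (+-identityˡ _)
    ∫-++ ((k , x) ∷ l) l′ φ = trans (+-congˡ (∫-++ l l′ φ)) (sym (+-assoc _ _ _))

    ∫-ret : ∀ x (φ : X → Carrier) → ∫ (ret x) φ ≈ φ x
    ∫-ret x φ = trans (+-identityʳ _) (*-identityˡ _)

    ∫-scl : ∀ k (l : Free X) φ → ∫ (scl k l) φ ≈ k * ∫ l φ
    ∫-scl k []             φ = sym (zeroʳ k)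
    ∫-scl k ((k′ , x) ∷ l) φ = trans (+-cong (*-assoc _ _ _) (∫-scl k l φ)) (sym (distribˡ _ _ _))

    ∫-antiL : ∀ N (F : ℕ → ℕ → Free X) φ → ∫ (antiL N F) φ ≈ anti N (λ a b → ∫ (F a b) φ)
    ∫-antiL zero    F φ = refl
    ∫-antiL (suc N) F φ = trans (∫-++ (F 0 (suc N)) _ φ) (+-congˡ (∫-antiL N _ φ))

    ∫-anti : ∀ (l : Free X) N (f : X → ℕ → ℕ → Carrier) → ∫ l (λ x → anti N (f x)) ≈ anti N (λ a b → ∫ l (λ x → f x a b))
    ∫-anti l zero    f = refl
    ∫-anti l (suc N) f = trans (∫-+ l _ _) (+-congˡ (∫-anti l N (λ x a → f x (suc a))))

    ∫-sumTo : ∀ (l : Free X) N (f : X → ℕ → Carrier) → ∫ l (λ x → sumTo N (f x)) ≈ sumTo N (λ k → ∫ l (λ x → f x k))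
    ∫-sumTo l zero    f = refl
    ∫-sumTo l (suc N) f = trans (∫-+ l _ _) (+-congˡ (∫-sumTo l N (λ x k → f x (suc k))))

  module _ {a b} {X : Set a} {Y : Set b} where
    ∫-map : ∀ (h : X → Y) l φ → ∫ (mapF h l) φ ≈ ∫ l (λ x → φ (h x))
    ∫-map h []            φ = refl
    ∫-map h ((k , x) ∷ l) φ = +-congˡ (∫-map h l φ)

    ∫-bind : ∀ l (f : X → Free Y) φ → ∫ (bind l f) φ ≈ ∫ l (λ x → ∫ (f x) φ)
    ∫-bind []            f φ = refl
    ∫-bind ((k , x) ∷ l) f φ = trans (∫-++ (scl k (f x)) _ φ) (+-cong (∫-scl k (f x) φ) (∫-bind l f φ))

    ∫-swap : ∀ (l : Free X) (l′ : Free Y) (φ : X → Y → Carrier) → ∫ l (λ x → ∫ l′ (φ x)) ≈ ∫ l′ (λ y → ∫ l (λ x → φ x y))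
    ∫-swap []            l′ φ = sym (∫-0 l′)
    ∫-swap ((k , x) ∷ l) l′ φ = begin
      k * ∫ l′ (φ x) + ∫ l (λ x → ∫ l′ (φ x))                     ≈⟨ +-cong (sym (∫-* l′ k (φ x))) (∫-swap l l′ φ) ⟩
      ∫ l′ (λ y → k * φ x y) + ∫ l′ (λ y → ∫ l (λ x → φ x y))     ≈⟨ ∫-+ l′ _ _ ⟨
      ∫ l′ (λ y → k * φ x y + ∫ l (λ x → φ x y))                  ∎

-- Letters are shifted: the natural number a stands for x_{a+1}.
module Words {c ℓ : Level} (e : ℕ) (F : FiniteField c ℓ (suc (suc e))) where
  open FieldFacts e F using (K)
  open Gamma e F using (γ; γ-sym)
  open RingKit K
  open Linear K public

  -- x_m, with x_0 = 1
  letter : ℕ → Word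
  letter zero    = []
  letter (suc m) = m ∷ []

  length-letter : ∀ m → length (letter m) ≤ 1
  length-letter zero    = z≤n
  length-letter (suc m) = s≤s z≤n

  abstract
    -- The diamond product of two letters; (n , m) stands for the word x_{n+1} x_m.
    ⋄ : ℕ → ℕ → Free (ℕ × ℕ)
    ⋄ a b = (1# , (suc (a +ℕ b) , 0)) ∷ antiL (a +ℕ b) (λ n m → (γ a b m , (n , suc m)) ∷ [])

    ∫-⋄ : ∀ a b g → ∫ (⋄ a b) g ≈ g (suc (a +ℕ b) , 0) + anti (a +ℕ b) (λ n m → γ a b m * g (n , suc m))
    ∫-⋄ a b g = +-cong (*-identityˡ _) (trans (∫-antiL (a +ℕ b) _ g) (anti-cong (a +ℕ b) λ n m → +-identityʳ _))

  ⋄-sym : ∀ a b g → ∫ (⋄ a b) g ≈ ∫ (⋄ b a) g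
  ⋄-sym a b g = trans (∫-⋄ a b g) (trans (+-congˡ (anti-cong (a +ℕ b) λ n m → *-congʳ (γ-sym a b m)))
    (trans (reflexive (≡.cong (λ N → g (suc N , 0) + anti N (λ n m → γ b a m * g (n , suc m))) (ℕₚ.+-comm a b))) (sym (∫-⋄ b a g))))

  -- With x_0 = 1 all terms of the diamond product have one shape: a letter k followed by `letter m`
  -- shuffled into the product of the tails, m = 0 being the term with leading letter x_{a+b+2}.
  sh : ℕ → Word → Word → Free Word
  sh n       []       b        = ret b
  sh n       (a ∷ as) []       = ret (a ∷ as)
  sh zero    (_ ∷ _)  (_ ∷ _)  = []
  sh (suc n) (a ∷ as) (b ∷ bs) =
    mapF (a ∷_) (sh n as (b ∷ bs)) ++ (mapF (b ∷_) (sh n (a ∷ as) bs)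
      ++ bind (sh n as bs) (λ w → bind (⋄ a b) (λ (k , m) → mapF (k ∷_) (sh n (letter m) w))))

  private
    sh-∷ : ∀ n a as b bs φ → ∫ (sh (suc n) (a ∷ as) (b ∷ bs)) φ ≈
      ∫ (sh n as (b ∷ bs)) (λ w → φ (a ∷ w)) + (∫ (sh n (a ∷ as) bs) (λ w → φ (b ∷ w))
        + ∫ (sh n as bs) (λ w → ∫ (⋄ a b) (λ (k , m) → ∫ (sh n (letter m) w) (λ w′ → φ (k ∷ w′)))))
    sh-∷ n a as b bs φ = trans (∫-++ (mapF (a ∷_) (sh n as (b ∷ bs))) _ φ) (+-cong (∫-map (a ∷_) (sh n as (b ∷ bs)) φ)
      (trans (∫-++ (mapF (b ∷_) (sh n (a ∷ as) bs)) _ φ) (+-cong (∫-map (b ∷_) (sh n (a ∷ as) bs) φ)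
        (trans (∫-bind (sh n as bs) _ φ) (∫-cong (sh n as bs) λ w →
          trans (∫-bind (⋄ a b) _ φ) (∫-cong (⋄ a b) λ (k , m) → ∫-map (k ∷_) (sh n (letter m) w) φ))))))

    inner-≤ : ∀ m (w as bs : Word) → length w ≤ length as +ℕ length bs → length (letter m) +ℕ length w ≤ length as +ℕ suc (length bs)
    inner-≤ m w as bs lw = ℕₚ.≤-trans (ℕₚ.+-mono-≤ (length-letter m) lw) (ℕₚ.≤-reflexive (≡.sym (ℕₚ.+-suc (length as) (length bs))))

    -- No word in the shuffle is longer than both arguments together. Restricting the functionals to
    -- such words is what lets inductions on length rewrite under the product.
    sh-cong : ∀ n a b {φ ψ : Word → Carrier} → (∀ w → length w ≤ length a +ℕ length b → φ w ≈ ψ w) → ∫ (sh n a b) φ ≈ ∫ (sh n a b) ψ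
    sh-cong n       []       b        h = +-congʳ (*-congˡ (h b ℕₚ.≤-refl))
    sh-cong n       (a ∷ as) []       h = +-congʳ (*-congˡ (h (a ∷ as) (ℕₚ.≤-reflexive (≡.sym (ℕₚ.+-identityʳ _)))))
    sh-cong zero    (_ ∷ _)  (_ ∷ _)  h = refl
    sh-cong (suc n) (a ∷ as) (b ∷ bs) {φ} {ψ} h = trans (sh-∷ n a as b bs φ) (trans (+-cong
      (sh-cong n as (b ∷ bs) λ w lw → h (a ∷ w) (s≤s lw)) (+-cong
      (sh-cong n (a ∷ as) bs λ w lw → h (b ∷ w) (ℕₚ.≤-trans (s≤s lw) (ℕₚ.≤-reflexive (≡.sym (ℕₚ.+-suc (suc (length as)) (length bs))))))
      (sh-cong n as bs λ w lw → ∫-cong (⋄ a b) λ (k , m) → sh-cong n (letter m) w λ w′ lw′ →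
        h (k ∷ w′) (s≤s (ℕₚ.≤-trans lw′ (inner-≤ m w as bs lw))))))
      (sym (sh-∷ n a as b bs ψ)))

    -- In the diamond term two heads disappear and at most one letter returns, so every recursive
    -- call, the nested one included, has smaller total length.
    sh-fuel : ∀ n n′ a b φ → length a +ℕ length b ≤ n → length a +ℕ length b ≤ n′ → ∫ (sh n a b) φ ≈ ∫ (sh n′ a b) φ
    sh-fuel n       n′       []       b        φ _ _ = refl
    sh-fuel n       n′       (a ∷ as) []       φ _ _ = refl
    sh-fuel (suc n) (suc n′) (a ∷ as) (b ∷ bs) φ (s≤s p) (s≤s p′) = trans (sh-∷ n a as b bs φ) (trans (+-cong
      (sh-fuel n n′ as (b ∷ bs) _ p p′) (+-cong
      (sh-fuel n n′ (a ∷ as) bs _ (ℕₚ.≤-trans (ℕₚ.≤-reflexive (≡.sym (ℕₚ.+-suc _ _))) p) (ℕₚ.≤-trans (ℕₚ.≤-reflexive (≡.sym (ℕₚ.+-suc _ _))) p′))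
      (trans (sh-fuel n n′ as bs _ (ℕₚ.≤-trans (ℕₚ.+-monoʳ-≤ (length as) (ℕₚ.n≤1+n _)) p) (ℕₚ.≤-trans (ℕₚ.+-monoʳ-≤ (length as) (ℕₚ.n≤1+n _)) p′))
        (sh-cong n′ as bs λ w lw → ∫-cong (⋄ a b) λ (k , m) →
          sh-fuel n n′ (letter m) w _ (ℕₚ.≤-trans (inner-≤ m w as bs lw) p) (ℕₚ.≤-trans (inner-≤ m w as bs lw) p′)))))
      (sym (sh-∷ n′ a as b bs φ)))

  infix 7 _⧢_

  abstract
    _⧢_ : Word → Word → Free Word
    a ⧢ b = sh (length a +ℕ length b) a b

    ⧢-cong′ : ∀ a b {φ ψ : Word → Carrier} → (∀ w → length w ≤ length a +ℕ length b → φ w ≈ ψ w) → ∫ (a ⧢ b) φ ≈ ∫ (a ⧢ b) ψ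
    ⧢-cong′ a b = sh-cong _ a b

    ⧢-[]ˡ : ∀ b φ → ∫ ([] ⧢ b) φ ≈ φ b
    ⧢-[]ˡ b φ = ∫-ret b φ

    ⧢-[]ʳ : ∀ a φ → ∫ (a ⧢ []) φ ≈ φ a
    ⧢-[]ʳ []       φ = ∫-ret [] φ
    ⧢-[]ʳ (a ∷ as) φ = ∫-ret (a ∷ as) φ

    ⧢-∷ : ∀ a as b bs φ → ∫ ((a ∷ as) ⧢ (b ∷ bs)) φ ≈
      ∫ (as ⧢ (b ∷ bs)) (λ w → φ (a ∷ w)) + (∫ ((a ∷ as) ⧢ bs) (λ w → φ (b ∷ w))
        + ∫ (as ⧢ bs) (λ w → ∫ (⋄ a b) (λ (k , m) → ∫ (letter m ⧢ w) (λ w′ → φ (k ∷ w′)))))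
    ⧢-∷ a as b bs φ = trans (sh-∷ N a as b bs φ) (+-congˡ (+-cong
      (sh-fuel N _ (a ∷ as) bs _ (ℕₚ.≤-reflexive (≡.sym (ℕₚ.+-suc _ _))) ℕₚ.≤-refl)
      (trans (sh-fuel N _ as bs _ (ℕₚ.+-monoʳ-≤ (length as) (ℕₚ.n≤1+n _)) ℕₚ.≤-refl)
        (sh-cong _ as bs λ w lw → ∫-cong (⋄ a b) λ (k , m) → sh-fuel N _ (letter m) w _ (inner-≤ m w as bs lw) ℕₚ.≤-refl))))
      where
      N : ℕ
      N = length as +ℕ suc (length bs)

  ⧢-comm : ∀ a b φ → ∫ (a ⧢ b) φ ≈ ∫ (b ⧢ a) φ
  ⧢-comm []       b        φ = trans (⧢-[]ˡ b φ) (sym (⧢-[]ʳ b φ))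
  ⧢-comm (a ∷ as) []       φ = trans (⧢-[]ʳ (a ∷ as) φ) (sym (⧢-[]ˡ (a ∷ as) φ))
  ⧢-comm (a ∷ as) (b ∷ bs) φ = begin
    ∫ ((a ∷ as) ⧢ (b ∷ bs)) φ
      ≈⟨ ⧢-∷ a as b bs φ ⟩
    ∫ (as ⧢ (b ∷ bs)) (λ w → φ (a ∷ w)) + (∫ ((a ∷ as) ⧢ bs) (λ w → φ (b ∷ w)) + ∫ (as ⧢ bs) (λ w → ∫ (⋄ a b) (Ψ w)))
      ≈⟨ solve 3 (λ x y z → x :+ (y :+ z) := y :+ (x :+ z)) refl _ _ _ ⟩
    ∫ ((a ∷ as) ⧢ bs) (λ w → φ (b ∷ w)) + (∫ (as ⧢ (b ∷ bs)) (λ w → φ (a ∷ w)) + ∫ (as ⧢ bs) (λ w → ∫ (⋄ a b) (Ψ w)))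
      ≈⟨ +-cong (⧢-comm (a ∷ as) bs _) (+-cong (⧢-comm as (b ∷ bs) _) (trans (⧢-comm as bs _) (∫-cong (bs ⧢ as) λ w → ⋄-sym a b (Ψ w)))) ⟩
    ∫ (bs ⧢ (a ∷ as)) (λ w → φ (b ∷ w)) + (∫ ((b ∷ bs) ⧢ as) (λ w → φ (a ∷ w)) + ∫ (bs ⧢ as) (λ w → ∫ (⋄ b a) (Ψ w)))
      ≈⟨ ⧢-∷ b bs a as φ ⟨
    ∫ ((b ∷ bs) ⧢ (a ∷ as)) φ ∎
    where
    Ψ : Word → ℕ × ℕ → Carrier
    Ψ w (k , m) = ∫ (letter m ⧢ w) (λ w′ → φ (k ∷ w′))

  letters-⧢ : ∀ a b φ → ∫ ((a ∷ []) ⧢ (b ∷ [])) φ ≈ φ (a ∷ b ∷ []) + (φ (b ∷ a ∷ []) + ∫ (⋄ a b) (λ (k , m) → φ (k ∷ letter m)))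
  letters-⧢ a b φ = trans (⧢-∷ a [] b [] φ) (+-cong (⧢-[]ˡ (b ∷ []) _) (+-cong (⧢-[]ʳ (a ∷ []) _)
    (trans (⧢-[]ˡ [] _) (∫-cong (⋄ a b) λ (k , m) → ⧢-[]ʳ (letter m) _))))

-- Cyclic symmetry of the diamond product of three letters.

module TripleGF {c ℓ p ℓp : Level} (e : ℕ) (F : FiniteField c ℓ (suc (suc e)))
                (P : CommutativeRing p ℓp) (ι : Hom (FiniteField.ring F) P)
                (E : ℕ → ℕ → ℕ → CommutativeRing.Carrier P) where
  open StarIdentity e F P ι
  open RingKit P

  -- E k m′ m is a value at x_{k+1} followed by x_{m′} ⧢ x_m. In the iterated diamond the leading
  -- letter x_{n+1} meets x_{c+1}, while x_m is carried along and shuffled in afterwards.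
  triple : ℕ → ℕ → ℕ → Carrier
  triple a b c = dia a b (λ n m → dia n c (λ k m′ → E k m′ m))

  form₃ : ℕ → ℕ → Carrier → Carrier → Carrier
  form₃ k J x y = anti J (λ m′ m → χP m′ * χP m * E k m′ m * (x ^ m′ * y ^ m))

  -- `dia-GF` is used once for each diamond, and the Vandermonde product clears every pole. What
  -- remains is linear in s^k, t^k, r^k with values of `form₃` at differences as coefficients.
  triple-GF : ∀ N s t r →
    (s - t) * ((s - r) * (t - r)) * anti N (λ M c → anti M (λ a b → triple a b c * (s ^ a * t ^ b)) * r ^ c)
      ≈ anti (suc (suc N)) (λ k J → s ^ k * ((t - r) * form₃ k J (s - r) (s - t)) - t ^ k * ((s - r) * form₃ k J (t - r) (s - t))
            - r ^ k * ((t - r) * form₃ k J (s - r) (s - t) - (s - r) * form₃ k J (t - r) (s - t)))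
  triple-GF N s t r = begin
    (s - t) * ((s - r) * (t - r)) * anti N (λ M c → anti M (λ a b → triple a b c * (s ^ a * t ^ b)) * r ^ c)
      ≈⟨ solve 3 (λ x w A → x :* w :* A := w :* (x :* A)) refl (s - t) _ _ ⟩
    w * ((s - t) * anti N (λ M c → anti M (λ a b → triple a b c * (s ^ a * t ^ b)) * r ^ c))
      ≈⟨ *-congˡ (trans (anti-*ˡ N _ _) (anti-cong N λ M c → trans (sym (*-assoc _ _ _)) (trans (*-congʳ (dia-GF M (λ n m → H n m c) s t)) (anti-*ʳ (suc M) (r ^ c) (λ n m → χP m * H n m c * ((s ^ n - t ^ n) * (s - t) ^ m)))))) ⟩
    w * anti N (λ M c → anti (suc M) (λ n m → V n m c))
      -- Shifting M by one brings in only the term M = 0, which contains s^0 - t^0.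
      ≈⟨ *-congˡ (trans (+-congʳ (trans (*-congʳ (trans (*-congˡ (trans (*-congʳ (-‿inverseʳ 1#)) (zeroˡ _))) (zeroʳ _))) (zeroˡ _))) (+-identityˡ _)) ⟨
    w * anti (suc N) (λ M c → anti M (λ n m → V n m c))
      ≈⟨ *-congˡ (anti-cong (suc N) λ M c → anti-flip M (λ n m → V n m c)) ⟩
    w * anti (suc N) (λ M c → anti M (λ m n → V n m c))
      ≈⟨ *-congˡ (anti-assoc (suc N) (λ m n c → V n m c)) ⟨
    w * anti (suc N) (λ m R → anti R (λ n c → V n m c))
      ≈⟨ trans (anti-*ˡ (suc N) w (λ m R → anti R (λ n c → V n m c))) (anti-cong (suc N) step) ⟩
    anti (suc N) (λ m R → anti (suc R) (λ k m′ → Y k m′ m))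
      ≈⟨ trans (+-congˡ (solve-zero (suc (suc N)))) (+-identityʳ _) ⟨
    anti (suc N) (λ m R → anti (suc R) (λ k m′ → Y k m′ m)) + Y 0 0 (suc (suc N))
      ≈⟨ anti-last (suc N) (λ m R → anti R (λ k m′ → Y k m′ m)) ⟨
    anti (suc (suc N)) (λ m R → anti R (λ k m′ → Y k m′ m))
      ≈⟨ anti-flip (suc (suc N)) (λ m R → anti R (λ k m′ → Y k m′ m)) ⟩
    anti (suc (suc N)) (λ R m → anti R (λ k m′ → Y k m′ m))
      ≈⟨ anti-assoc (suc (suc N)) Y ⟨
    anti (suc (suc N)) (λ k J → anti J (λ m′ m → Y k m′ m))
      ≈⟨ anti-cong (suc (suc N)) collect ⟩
    anti (suc (suc N)) (λ k J → s ^ k * ((t - r) * form₃ k J (s - r) (s - t)) - t ^ k * ((s - r) * form₃ k J (t - r) (s - t))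
            - r ^ k * ((t - r) * form₃ k J (s - r) (s - t) - (s - r) * form₃ k J (t - r) (s - t))) ∎
    where
    w = (s - r) * (t - r)
    H V Y : ℕ → ℕ → ℕ → Carrier
    H n m c = dia n c (λ k m′ → E k m′ m)
    V n m c = χP m * H n m c * ((s ^ n - t ^ n) * (s - t) ^ m) * r ^ c
    Y k m′ m = χP m * (s - t) ^ m * (χP m′ * E k m′ m * ((t - r) * ((s ^ k - r ^ k) * (s - r) ^ m′) - (s - r) * ((t ^ k - r ^ k) * (t - r) ^ m′)))

    solve-zero : ∀ m → Y 0 0 m ≈ 0#
    solve-zero m = solve 5 (λ x y z u v → x :* (y :* (u :* ((con (1 , 0) :- con (1 , 0)) :* con (1 , 0)) :- v :* ((con (1 , 0) :- con (1 , 0)) :* con (1 , 0)))) := con (0 , 0)) refl _ _ 1# (t - r) (s - r)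

    step : ∀ m R → w * anti R (λ n c → V n m c) ≈ anti (suc R) (λ k m′ → Y k m′ m)
    step m R = begin
      w * anti R (λ n c → V n m c)
        ≈⟨ *-congˡ (trans (anti-cong R λ n c → solve 6 (λ x H S T q R → x :* H :* ((S :- T) :* q) :* R := x :* q :* (H :* (S :* R) :- H :* (T :* R))) refl _ _ _ _ _ _) (sym (anti-*ˡ R (χP m * (s - t) ^ m) _))) ⟩
      w * (χP m * (s - t) ^ m * anti R (λ n c → H n m c * (s ^ n * r ^ c) - H n m c * (t ^ n * r ^ c)))
        ≈⟨ *-congˡ (*-congˡ (trans (anti-+ R _ _) (+-congˡ (sym (anti-neg R _))))) ⟩
      w * (χP m * (s - t) ^ m * (A s - A t))
        ≈⟨ solve 5 (λ x y q a b → (x :* y) :* (q :* (a :- b)) := q :* (y :* (x :* a) :- x :* (y :* b))) refl (s - r) (t - r) (χP m * (s - t) ^ m) (A s) (A t) ⟩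
      χP m * (s - t) ^ m * ((t - r) * ((s - r) * A s) - (s - r) * ((t - r) * A t))
        ≈⟨ *-congˡ (+-cong (trans (*-congˡ (dia-GF R (λ k m′ → E k m′ m) s r)) (anti-*ˡ (suc R) (t - r) (λ k m′ → W s k m′)))
                           (trans (-‿cong (trans (*-congˡ (dia-GF R (λ k m′ → E k m′ m) t r)) (anti-*ˡ (suc R) (s - r) (λ k m′ → W t k m′)))) (anti-neg (suc R) (λ k m′ → (s - r) * W t k m′)))) ⟩
      χP m * (s - t) ^ m * (anti (suc R) (λ k m′ → (t - r) * (χP m′ * E k m′ m * ((s ^ k - r ^ k) * (s - r) ^ m′)))
          + anti (suc R) (λ k m′ → - ((s - r) * (χP m′ * E k m′ m * ((t ^ k - r ^ k) * (t - r) ^ m′)))))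
        ≈⟨ trans (*-congˡ (sym (anti-+ (suc R) (λ k m′ → (t - r) * W s k m′) (λ k m′ → - ((s - r) * W t k m′))))) (anti-*ˡ (suc R) (χP m * (s - t) ^ m) (λ k m′ → (t - r) * W s k m′ - (s - r) * W t k m′)) ⟩
      anti (suc R) (λ k m′ → χP m * (s - t) ^ m * ((t - r) * (χP m′ * E k m′ m * ((s ^ k - r ^ k) * (s - r) ^ m′)) - (s - r) * (χP m′ * E k m′ m * ((t ^ k - r ^ k) * (t - r) ^ m′))))
        ≈⟨ anti-cong (suc R) (λ k m′ → *-congˡ {χP m * (s - t) ^ m} (solve 5 (λ y z e p q → y :* (e :* p) :- z :* (e :* q) := e :* (y :* p :- z :* q)) refl (t - r) (s - r) (χP m′ * E k m′ m) ((s ^ k - r ^ k) * (s - r) ^ m′) ((t ^ k - r ^ k) * (t - r) ^ m′))) ⟩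
      anti (suc R) (λ k m′ → Y k m′ m) ∎
      where
      A : Carrier → Carrier
      A x = anti R (λ n c → H n m c * (x ^ n * r ^ c))
      W : Carrier → ℕ → ℕ → Carrier
      W x k m′ = χP m′ * E k m′ m * ((x ^ k - r ^ k) * (x - r) ^ m′)

    collect : ∀ k J → anti J (λ m′ m → Y k m′ m) ≈ s ^ k * ((t - r) * form₃ k J (s - r) (s - t)) - t ^ k * ((s - r) * form₃ k J (t - r) (s - t))
            - r ^ k * ((t - r) * form₃ k J (s - r) (s - t) - (s - r) * form₃ k J (t - r) (s - t))
    collect k J = begin
      anti J (λ m′ m → Y k m′ m)
        ≈⟨ anti-cong J (λ m′ m → solve 11 (λ x q x′ e y z S T R p u → x :* q :* (x′ :* e :* (y :* ((S :- R) :* p) :- z :* ((T :- R) :* u)))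
              := y :* (S :- R) :* (x′ :* x :* e :* (p :* q)) :+ (:- (z :* (T :- R))) :* (x′ :* x :* e :* (u :* q))) refl
              (χP m) ((s - t) ^ m) (χP m′) (E k m′ m) (t - r) (s - r) (s ^ k) (t ^ k) (r ^ k) ((s - r) ^ m′) ((t - r) ^ m′)) ⟩
      anti J (λ m′ m → (t - r) * (s ^ k - r ^ k) * (χP m′ * χP m * E k m′ m * ((s - r) ^ m′ * (s - t) ^ m))
          + (- ((s - r) * (t ^ k - r ^ k))) * (χP m′ * χP m * E k m′ m * ((t - r) ^ m′ * (s - t) ^ m)))
        ≈⟨ trans (anti-+ J _ _) (+-cong (sym (anti-*ˡ J _ _)) (sym (anti-*ˡ J _ _))) ⟩
      (t - r) * (s ^ k - r ^ k) * form₃ k J (s - r) (s - t) + (- ((s - r) * (t ^ k - r ^ k))) * form₃ k J (t - r) (s - t)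
        ≈⟨ solve 7 (λ y z S T R a b → y :* (S :- R) :* a :+ (:- (z :* (T :- R))) :* b := S :* (y :* a) :- T :* (z :* b) :- R :* (y :* a :- z :* b)) refl (t - r) (s - r) (s ^ k) (t ^ k) (r ^ k) (form₃ k J (s - r) (s - t)) (form₃ k J (t - r) (s - t)) ⟩
      s ^ k * ((t - r) * form₃ k J (s - r) (s - t)) - t ^ k * ((s - r) * form₃ k J (t - r) (s - t))
            - r ^ k * ((t - r) * form₃ k J (s - r) (s - t) - (s - r) * form₃ k J (t - r) (s - t)) ∎

  module _ (s t r : Carrier)
           (star : ∀ k J → Star (form₃ k J) (s - t) (t - r))
           (sym₃ : ∀ k J x y → form₃ k J x y ≈ form₃ k J y x)
           (neg₃ : ∀ k J x y → form₃ k J (- x) y ≈ form₃ k J x y) where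
    private
      cong₃ : ∀ k J {x x′ y y′} → x ≈ x′ → y ≈ y′ → form₃ k J x y ≈ form₃ k J x′ y′
      cong₃ k J ex ey = anti-cong J λ i j → *-congˡ (*-cong (^-congˡ i ex) (^-congˡ j ey))

    -- Matching the coefficients of s^k, t^k and r^k uses one instance of `Star`, at (s - t, t - r),
    -- whose sum is s - r; symmetry and evenness of `form₃` align the remaining arguments.
    triple-cyclic : ∀ N →
      (s - t) * ((s - r) * (t - r)) * anti N (λ M c → anti M (λ a b → triple a b c * (s ^ a * t ^ b)) * r ^ c)
        ≈ (s - t) * ((s - r) * (t - r)) * anti N (λ M c → anti M (λ a b → triple a b c * (t ^ a * r ^ b)) * s ^ c)
    triple-cyclic N = begin
      (s - t) * ((s - r) * (t - r)) * anti N (λ M c → anti M (λ a b → triple a b c * (s ^ a * t ^ b)) * r ^ c)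
        ≈⟨ triple-GF N s t r ⟩
      anti (suc (suc N)) (λ k J → s ^ k * ((t - r) * form₃ k J (s - r) (s - t)) - t ^ k * ((s - r) * form₃ k J (t - r) (s - t))
            - r ^ k * ((t - r) * form₃ k J (s - r) (s - t) - (s - r) * form₃ k J (t - r) (s - t)))
        ≈⟨ anti-cong (suc (suc N)) match ⟩
      anti (suc (suc N)) (λ k J → t ^ k * ((r - s) * form₃ k J (t - s) (t - r)) - r ^ k * ((t - s) * form₃ k J (r - s) (t - r))
            - s ^ k * ((r - s) * form₃ k J (t - s) (t - r) - (t - s) * form₃ k J (r - s) (t - r)))
        ≈⟨ triple-GF N t r s ⟨
      (t - r) * ((t - s) * (r - s)) * anti N (λ M c → anti M (λ a b → triple a b c * (t ^ a * r ^ b)) * s ^ c)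
        ≈⟨ *-congʳ (solve 3 (λ s t r → (t :- r) :* ((t :- s) :* (r :- s)) := (s :- t) :* ((s :- r) :* (t :- r))) refl s t r) ⟩
      (s - t) * ((s - r) * (t - r)) * anti N (λ M c → anti M (λ a b → triple a b c * (t ^ a * r ^ b)) * s ^ c) ∎
      where
      match : ∀ k J → s ^ k * ((t - r) * form₃ k J (s - r) (s - t)) - t ^ k * ((s - r) * form₃ k J (t - r) (s - t))
            - r ^ k * ((t - r) * form₃ k J (s - r) (s - t) - (s - r) * form₃ k J (t - r) (s - t))
        ≈ t ^ k * ((r - s) * form₃ k J (t - s) (t - r)) - r ^ k * ((t - s) * form₃ k J (r - s) (t - r))
            - s ^ k * ((r - s) * form₃ k J (t - s) (t - r) - (t - s) * form₃ k J (r - s) (t - r))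
      match k J = begin
        S * ((t - r) * c₁) - T * ((s - r) * form₃ k J (t - r) (s - t)) - R * ((t - r) * c₁ - (s - r) * form₃ k J (t - r) (s - t))
          ≈⟨ +-cong (+-cong (*-congˡ star′) (-‿cong (*-congˡ (*-congˡ (sym₃ k J _ _))))) (-‿cong (*-congˡ (+-cong star′ (-‿cong (*-congˡ (sym₃ k J _ _)))))) ⟩
        S * ((s - r) * c₂ - (s - t) * c₃) - T * ((s - r) * c₂) - R * (((s - r) * c₂ - (s - t) * c₃) - (s - r) * c₂)
          ≈⟨ solve 8 (λ S T R s t r c₂ c₃ → S :* ((s :- r) :* c₂ :- (s :- t) :* c₃) :- T :* ((s :- r) :* c₂) :- R :* (((s :- r) :* c₂ :- (s :- t) :* c₃) :- (s :- r) :* c₂)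
                := T :* ((r :- s) :* c₂) :- R :* ((t :- s) :* c₃) :- S :* ((r :- s) :* c₂ :- (t :- s) :* c₃)) refl S T R s t r c₂ c₃ ⟩
        T * ((r - s) * c₂) - R * ((t - s) * c₃) - S * ((r - s) * c₂ - (t - s) * c₃)
          ≈⟨ +-cong (+-cong (*-congˡ (*-congˡ e₂)) (-‿cong (*-congˡ (*-congˡ e₃)))) (-‿cong (*-congˡ (+-cong (*-congˡ e₂) (-‿cong (*-congˡ e₃))))) ⟨
        T * ((r - s) * form₃ k J (t - s) (t - r)) - R * ((t - s) * form₃ k J (r - s) (t - r)) - S * ((r - s) * form₃ k J (t - s) (t - r) - (t - s) * form₃ k J (r - s) (t - r)) ∎
        where
        S = s ^ k
        T = t ^ k
        R = r ^ k
        c₁ = form₃ k J (s - r) (s - t)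
        c₂ = form₃ k J (s - t) (t - r)
        c₃ = form₃ k J (s - r) (t - r)
        minus : ∀ x y → x - y ≈ - (y - x)
        minus x y = solve 2 (λ x y → x :- y := :- (y :- x)) refl x y
        e₂ : form₃ k J (t - s) (t - r) ≈ c₂
        e₂ = trans (cong₃ k J (minus t s) refl) (neg₃ k J _ _)
        e₃ : form₃ k J (r - s) (t - r) ≈ c₃
        e₃ = trans (cong₃ k J (minus r s) refl) (neg₃ k J _ _)
        sum-sr : (s - t) + (t - r) ≈ s - r
        sum-sr = solve 3 (λ s t r → (s :- t) :+ (t :- r) := s :- r) refl s t r
        star′ : (t - r) * c₁ ≈ (s - r) * c₂ - (s - t) * c₃
        star′ = begin
          (t - r) * c₁
            ≈⟨ solve 2 (λ a b → a := (a :+ b) :- b) refl _ ((s - t) * c₃) ⟩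
          ((t - r) * c₁ + (s - t) * c₃) - (s - t) * c₃
            ≈⟨ +-congʳ (+-cong (*-congˡ (cong₃ k J sum-sr refl)) (*-congˡ (cong₃ k J sum-sr refl))) ⟨
          ((t - r) * form₃ k J ((s - t) + (t - r)) (s - t) + (s - t) * form₃ k J ((s - t) + (t - r)) (t - r)) - (s - t) * c₃
            ≈⟨ +-congʳ (star k J) ⟨
          ((s - t) + (t - r)) * c₂ - (s - t) * c₃
            ≈⟨ +-congʳ (*-congʳ sum-sr) ⟩
          (s - r) * c₂ - (s - t) * c₃ ∎

module WordsOver {c ℓ p ℓp : Level} (e : ℕ) (F : FiniteField c ℓ (suc (suc e)))
                 (P : CommutativeRing p ℓp) (ι : Hom (FiniteField.ring F) P) where
  open StarIdentity e F P ι
  open Words e F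
  open RingKit P
  open Hom ι

  ⟦⋄⟧ : ∀ a b g → ⟦ ∫ (⋄ a b) g ⟧ ≈ dia a b (λ n m → ⟦ g (n , m) ⟧)
  ⟦⋄⟧ a b g = trans (⟦⟧-cong (∫-⋄ a b g)) (trans (⟦⟧-+ _ _) (+-congˡ (trans (⟦⟧-anti (a +ℕ b) _) (anti-cong (a +ℕ b) λ n m → ⟦⟧-* _ _))))

  dia-cong : ∀ a b {G H : ℕ → ℕ → Carrier} → (∀ n m → G n m ≈ H n m) → dia a b G ≈ dia a b H
  dia-cong a b h = +-cong (h _ _) (anti-cong (a +ℕ b) λ n m → *-congˡ (h n (suc m)))

  ⟦pair⟧ : ∀ i j φ → ⟦ ∫ (letter i ⧢ letter j) φ ⟧ ≈ Pair.pair ⟦ φ [] ⟧ (λ n m → ⟦ φ (n ∷ letter m) ⟧) i j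
  ⟦pair⟧ zero    zero    φ = ⟦⟧-cong (⧢-[]ˡ _ φ)
  ⟦pair⟧ zero    (suc b) φ = ⟦⟧-cong (⧢-[]ˡ _ φ)
  ⟦pair⟧ (suc a) zero    φ = ⟦⟧-cong (⧢-[]ʳ _ φ)
  ⟦pair⟧ (suc a) (suc b) φ = trans (⟦⟧-cong (letters-⧢ a b φ)) (trans (⟦⟧-+ _ _) (+-congˡ (trans (⟦⟧-+ _ _) (+-congˡ (⟦⋄⟧ a b _)))))

module MooreCancellable {c ℓ r ℓr : Level} (e : ℕ) (F : FiniteField c ℓ (suc (suc e)))
                        (R : CommutativeRing r ℓr) (ι₀ : Hom (FiniteField.ring F) R) where
  open FieldFacts e F using (d)
  open TwoVar R
  module S₂ = StarIdentity e F P₂.PS (ι ∘ʰ ι₀)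
  private
    module R = RingKit R
    module R₁ = P₁.PS
    module R₂ = P₂.PS

    cancellable-^ : ∀ n → R₁.Cancellable (P₁.X R₁.^ n)
    cancellable-^ zero    y h = R₁.trans (R₁.sym (R₁.*-identityˡ y)) h
    cancellable-^ (suc n) = R₁.Cancellable-* P₁.cancellable-X (cancellable-^ n)

  constant-^ : ∀ n f → (f R₂.^ n) 0 R₁.≈ f 0 R₁.^ n
  constant-^ zero    f = R₁.refl
  constant-^ (suc n) f = R₁.*-congˡ {f 0} (constant-^ n f)

  -- The factors s and t are variables, and the third factor reduces to s^d at t = 0.
  Moore-st : R₂.Cancellable (S₂.Moore s t)
  Moore-st = R₂.Cancellable-* (R₂.Cancellable-* cancellable-s cancellable-t)
    (P₂.cancellable-const (s R₂.^ d R₂.- t R₂.^ d) (R₁.Cancellable-resp (R₁.sym leading) (cancellable-^ d)))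
    where
    leading : (s R₂.^ d R₂.- t R₂.^ d) 0 R₁.≈ P₁.X R₁.^ d
    leading = R₁.trans (R₁.+-cong (constant-^ d s) (R₁.-‿cong (P₂.X-*-zero (t R₂.^ e)))) (R₁.trans (R₁.+-congˡ {P₁.X R₁.^ d} R₁.-0≈0) (R₁.+-identityʳ _))

  s-t+t : (s R₂.- t) R₂.+ t R₂.≈ s
  s-t+t = R₂.solve 2 (λ s t → (s R₂.:- t) R₂.:+ t R₂.:= s) R₂.refl s t

  Moore-cong : ∀ {x x′ y y′} → x R₂.≈ x′ → y R₂.≈ y′ → S₂.Moore x y R₂.≈ S₂.Moore x′ y′
  Moore-cong ex ey = R₂.*-cong (R₂.*-cong ex ey) (R₂.+-cong (R₂.^-congˡ d ex) (R₂.-‿cong (R₂.^-congˡ d ey)))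

  -- By the column operation this is the determinant of s and t.
  Moore-s-t : R₂.Cancellable (S₂.Moore (s R₂.- t) t)
  Moore-s-t = R₂.Cancellable-resp (R₂.trans (Moore-cong (R₂.sym s-t+t) R₂.refl) (S₂.Moore-+ʳ (s R₂.- t) t)) Moore-st

module LetterAssoc {c ℓ : Level} (e : ℕ) (F : FiniteField c ℓ (suc (suc e))) where
  open FieldFacts e F using (K; d)
  open Words e F
  open RingKit K

  triproduct : ℕ → ℕ → ℕ → (ℕ → Word → Carrier) → Carrier
  triproduct a b c g = ∫ (⋄ a b) (λ (n , m) → ∫ (⋄ n c) (λ (k , m′) → ∫ (letter m′ ⧢ letter m) (g k)))

  private
    idʰ : Hom K K
    idʰ = record { ⟦_⟧ = λ x → x ; ⟦⟧-cong = λ h → h ; ⟦⟧-+ = λ _ _ → refl ; ⟦⟧-* = λ _ _ → refl ; ⟦⟧-1 = refl }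

  open ThreeVar K
  private
    module M = MooreCancellable e F K idʰ
    module R₂ = P₂.PS
    module R₃ = P₃.PS
    module S₃ = StarIdentity e F P₃.PS ι₃
    module W₃ = WordsOver e F P₃.PS ι₃

    constant₃-^ : ∀ n f → (f R₃.^ n) 0 R₂.≈ f 0 R₂.^ n
    constant₃-^ zero    f = R₂.refl
    constant₃-^ (suc n) f = R₂.*-congˡ {f 0} (constant₃-^ n f)

    minus-zero : ∀ x → x R₂.- R₂.0# R₂.≈ x
    minus-zero x = R₂.trans (R₂.+-congˡ {x} R₂.-0≈0) (R₂.+-identityʳ x)

    -- Setting r = 0 leaves the determinant of s - t and t.
    cancellable-Moore : R₃.Cancellable (S₃.Moore (s₃ R₃.- t₃) (t₃ R₃.- r₃))
    cancellable-Moore = P₃.cancellable-const (S₃.Moore (s₃ R₃.- t₃) (t₃ R₃.- r₃)) (R₂.Cancellable-resp (R₂.sym (R₂.trans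
      (R₂.*-congˡ {(s R₂.- t) R₂.* (t R₂.- R₂.0#)} (R₂.+-cong (constant₃-^ d (s₃ R₃.- t₃)) (R₂.-‿cong (constant₃-^ d (t₃ R₃.- r₃)))))
      (M.Moore-cong {s R₂.- t} {s R₂.- t} R₂.refl (minus-zero t)))) M.Moore-s-t)

    V : R₃.Carrier
    V = (s₃ R₃.- t₃) R₃.* ((s₃ R₃.- r₃) R₃.* (t₃ R₃.- r₃))

    cancellable-V : R₃.Cancellable V
    cancellable-V = R₃.Cancellable-* (P₃.cancellable-const (s₃ R₃.- t₃) cancellable-s-t) (R₃.Cancellable-*
      (P₃.cancellable-const (s₃ R₃.- r₃) (R₂.Cancellable-resp (R₂.sym (minus-zero s)) cancellable-s))
      (P₃.cancellable-const (t₃ R₃.- r₃) (R₂.Cancellable-resp (R₂.sym (minus-zero t)) cancellable-t)))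

  -- A cyclic shift of the letters is a cyclic shift of s, t, r in the generating function; there
  -- `triple-cyclic` applies and the Vandermonde product cancels.
  triproduct-cyclic : ∀ a b c g → triproduct a b c g ≈ triproduct b c a g
  triproduct-cyclic a b c g = GF₃-injective (λ a b c → triproduct a b c g) (λ a b c → triproduct b c a g) (λ N → R₃.cancel cancellable-V (
    R₃.trans (R₃.*-congˡ {V} (left N)) (R₃.trans (TG.triple-cyclic s₃ t₃ r₃ star sym₃ neg₃ N) (R₃.*-congˡ {V} (R₃.sym (right N)))))) a b c
    where
    open Hom ι₃
    E : ℕ → ℕ → ℕ → R₃.Carrier
    E k m′ m = ⟦ ∫ (letter m′ ⧢ letter m) (g k) ⟧
    module TG = TripleGF e F P₃.PS ι₃ E
    module Pr (k : ℕ) = S₃.Pair ⟦ g k [] ⟧ (λ n m → ⟦ g k (n ∷ letter m) ⟧)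

    form₃-pair : ∀ k J x y → TG.form₃ k J x y R₃.≈ Pr.form k J x y
    form₃-pair k J x y = R₃.anti-cong J λ i j → R₃.*-congʳ (R₃.*-congˡ (W₃.⟦pair⟧ i j (g k)))

    star : ∀ k J → S₃.Star (TG.form₃ k J) (s₃ R₃.- t₃) (t₃ R₃.- r₃)
    star k J = R₃.trans (R₃.*-congˡ (form₃-pair k J _ _)) (R₃.trans (Pr.form-star k J _ _ cancellable-Moore)
      (R₃.sym (R₃.+-cong (R₃.*-congˡ (form₃-pair k J _ _)) (R₃.*-congˡ (form₃-pair k J _ _)))))

    sym₃ : ∀ k J x y → TG.form₃ k J x y R₃.≈ TG.form₃ k J y x
    sym₃ k J x y = R₃.trans (form₃-pair k J x y) (R₃.trans (Pr.form-sym k J x y) (R₃.sym (form₃-pair k J y x)))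

    neg₃ : ∀ k J x y → TG.form₃ k J (R₃.- x) y R₃.≈ TG.form₃ k J x y
    neg₃ k J x y = R₃.trans (form₃-pair k J (R₃.- x) y) (R₃.trans (Pr.form-negˡ k J x y) (R₃.sym (form₃-pair k J x y)))

    ⟦triproduct⟧ : ∀ a b c → ⟦ triproduct a b c g ⟧ R₃.≈ TG.triple a b c
    ⟦triproduct⟧ a b c = R₃.trans (W₃.⟦⋄⟧ a b (λ (n , m) → ∫ (⋄ n c) (inner m))) (W₃.dia-cong a b λ n m → W₃.⟦⋄⟧ n c (inner m))
      where
      inner : ℕ → ℕ × ℕ → Carrier
      inner m (k , m′) = ∫ (letter m′ ⧢ letter m) (g k)

    left : ∀ N → GF₃ N (λ a b c → triproduct a b c g) R₃.≈ R₃.anti N (λ M c → R₃.anti M (λ a b → TG.triple a b c R₃.* (s₃ R₃.^ a R₃.* t₃ R₃.^ b)) R₃.* r₃ R₃.^ c)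
    left N = R₃.anti-cong N λ M c → R₃.*-congʳ (R₃.anti-cong M λ a b → R₃.*-congʳ (⟦triproduct⟧ a b c))

    right : ∀ N → GF₃ N (λ a b c → triproduct b c a g) R₃.≈ R₃.anti N (λ M a → R₃.anti M (λ b c → TG.triple b c a R₃.* (t₃ R₃.^ b R₃.* r₃ R₃.^ c)) R₃.* s₃ R₃.^ a)
    right N = R₃.trans (R₃.anti-cong N λ M c → R₃.trans (R₃.anti-*ʳ M _ _) (R₃.anti-cong M λ a b → R₃.trans (R₃.*-congʳ (R₃.*-congʳ (⟦triproduct⟧ b c a)))
        (R₃.solve 4 (λ x s t r → x R₃.:* (s R₃.:* t) R₃.:* r R₃.:= x R₃.:* (t R₃.:* r) R₃.:* s) R₃.refl (TG.triple b c a) (s₃ R₃.^ a) (t₃ R₃.^ b) (r₃ R₃.^ c))))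
      (R₃.trans (R₃.sym (R₃.anti-assoc N X)) (R₃.trans (R₃.anti-flip N (λ a M → R₃.anti M (λ b c → X a b c))) (R₃.anti-cong N λ M a → R₃.sym (R₃.anti-*ʳ M _ _))))
      where
      X : ℕ → ℕ → ℕ → R₃.Carrier
      X a b c = TG.triple b c a R₃.* (t₃ R₃.^ b R₃.* r₃ R₃.^ c) R₃.* s₃ R₃.^ a

-- Associativity of the shuffle product.

module Assoc {c ℓ : Level} (e : ℕ) (F : FiniteField c ℓ (suc (suc e))) where
  open FieldFacts e F using (K)
  open Words e F
  open LetterAssoc e F
  open RingKit K
  private module N = +-*-Solver

  T₃ : Word → Word → Word → (Word → Carrier) → Carrier
  T₃ a b c φ = ∫ (a ⧢ b) (λ u → ∫ (u ⧢ c) φ)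

  graft : ℕ → ℕ → (Word → Carrier) → Word → Carrier
  graft a b φ w = ∫ (⋄ a b) (λ (k , m) → ∫ (letter m ⧢ w) (λ w′ → φ (k ∷ w′)))

  private
    -- Together with commutativity this amounts to associativity, but it treats the three words
    -- alike: a cyclic shift merely permutes the terms of one expansion.
    Cyclic : ℕ → Set (c Level.⊔ ℓ)
    Cyclic N = ∀ a b c φ → length a +ℕ (length b +ℕ length c) ≤ N → T₃ a b c φ ≈ T₃ b c a φ

    rotate : ∀ {N} → Cyclic N → ∀ z w c ψ → length z +ℕ (length w +ℕ length c) ≤ N →
      ∫ (z ⧢ w) (λ w′ → ∫ (w′ ⧢ c) ψ) ≈ ∫ (w ⧢ c) (λ v → ∫ (z ⧢ v) ψ)
    rotate ih z w c ψ h = trans (ih z w c ψ h) (∫-cong (w ⧢ c) λ v → ⧢-comm v z ψ)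

    module Expand (N : ℕ) (ih : Cyclic N) (a : ℕ) (as : Word) (b : ℕ) (bs : Word) (c₀ : ℕ) (cs : Word)
                  (bound : 2 +ℕ (length as +ℕ length bs +ℕ length cs) ≤ N) (φ : Word → Carrier) where
      A B C′ : Word
      A = a ∷ as
      B = b ∷ bs
      C′ = c₀ ∷ cs

      -- One term for each nonempty set of heads merged into the new first letter: a, b, c₀, then
      -- the pairs a c₀, b c₀, a b, then all three.
      t₁ t₂ t₃ t₄ t₅ t₆ t₇ : Carrier
      t₁ = T₃ as B C′ (λ w → φ (a ∷ w))
      t₂ = T₃ A bs C′ (λ w → φ (b ∷ w))
      t₃ = T₃ A B cs (λ w → φ (c₀ ∷ w))
      t₄ = T₃ as B cs (graft a c₀ φ)
      t₅ = T₃ A bs cs (graft b c₀ φ)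
      t₆ = T₃ as bs C′ (graft a b φ)
      t₇ = T₃ as bs cs (λ v → triproduct a b c₀ (λ k y → ∫ (y ⧢ v) (λ w → φ (k ∷ w))))

      private
        p : ℕ → Word → Carrier
        p k u = ∫ ((k ∷ u) ⧢ cs) (λ w → φ (c₀ ∷ w))

        p₁ p₂ p₃ : Carrier
        p₁ = ∫ (as ⧢ B) (p a)
        p₂ = ∫ (A ⧢ bs) (p b)
        -- The value at the empty word is arbitrary: `graft` evaluates its functional at nonempty
        -- words only.
        p₃ = ∫ (as ⧢ bs) (graft a b (λ { [] → 0# ; (k ∷ u) → p k u }))

        split : ∀ (l : Free Word) (f g h : Word → Carrier) → ∫ l (λ u → f u + (g u + h u)) ≈ ∫ l f + (∫ l g + ∫ l h)
        split l f g h = trans (∫-+ l f _) (+-congˡ (∫-+ l g h))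

        head-expand : ∀ k u → ∫ ((k ∷ u) ⧢ C′) φ ≈ ∫ (u ⧢ C′) (λ w → φ (k ∷ w)) + (p k u + ∫ (u ⧢ cs) (graft k c₀ φ))
        head-expand k u = ⧢-∷ k u c₀ cs φ

        r₁ r₇ : Carrier
        r₁ = ∫ (as ⧢ bs) (λ w → ∫ (⋄ a b) (λ (k , m) → ∫ (letter m ⧢ w) (λ w′ → ∫ (w′ ⧢ C′) (λ v → φ (k ∷ v)))))
        r₇ = ∫ (as ⧢ bs) (λ w → ∫ (⋄ a b) (λ (k , m) → ∫ (letter m ⧢ w) (λ w′ → ∫ (w′ ⧢ cs) (graft k c₀ φ))))

        third : ∫ (as ⧢ bs) (λ w → ∫ (⋄ a b) (λ (k , m) → ∫ (letter m ⧢ w) (λ w′ → ∫ ((k ∷ w′) ⧢ C′) φ))) ≈ r₁ + (p₃ + r₇)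
        third = trans (∫-cong (as ⧢ bs) λ w → trans (∫-cong (⋄ a b) λ (k , m) → trans (∫-cong (letter m ⧢ w) (head-expand k)) (split (letter m ⧢ w) _ _ _))
            (trans (∫-+ (⋄ a b) _ _) (+-congˡ (∫-+ (⋄ a b) _ _))))
          (split (as ⧢ bs) _ _ _)

        -- Two heads are gone and at most one letter x_m has come back, so the induction hypothesis
        -- still covers the triple.
        bound₁ : ∀ m (w : Word) → length w ≤ length as +ℕ length bs → length (letter m) +ℕ (length w +ℕ length C′) ≤ N
        bound₁ m w lw = ℕₚ.≤-trans (ℕₚ.+-mono-≤ (length-letter m) (ℕₚ.+-monoˡ-≤ (length C′) lw))
          (ℕₚ.≤-trans (ℕₚ.≤-reflexive (N.solve 3 (λ x y z → N.con 1 N.:+ (x N.:+ y N.:+ (N.con 1 N.:+ z)) N.:= N.con 2 N.:+ (x N.:+ y N.:+ z)) ≡.refl (length as) (length bs) (length cs))) bound)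

        bound₂ : ∀ m (w : Word) → length w ≤ length as +ℕ length bs → length (letter m) +ℕ (length w +ℕ length cs) ≤ N
        bound₂ m w lw = ℕₚ.≤-trans (ℕₚ.+-monoʳ-≤ (length (letter m)) (ℕₚ.+-monoʳ-≤ (length w) (ℕₚ.n≤1+n _))) (bound₁ m w lw)

        bound₃ : ∀ m′ m (w v : Word) → length w ≤ length as +ℕ length bs → length v ≤ length w +ℕ length cs → length (letter m′) +ℕ (length (letter m) +ℕ length v) ≤ N
        bound₃ m′ m w v lw lv = ℕₚ.≤-trans (ℕₚ.+-mono-≤ (length-letter m′) (ℕₚ.+-mono-≤ (length-letter m) (ℕₚ.≤-trans lv (ℕₚ.+-monoˡ-≤ (length cs) lw)))) bound

        r₁≈t₆ : r₁ ≈ t₆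
        r₁≈t₆ = ⧢-cong′ as bs λ w lw → trans
          (∫-cong (⋄ a b) λ (k , m) → rotate ih (letter m) w C′ (λ v → φ (k ∷ v)) (bound₁ m w lw))
          (∫-swap (⋄ a b) (w ⧢ C′) (λ (k , m) v → ∫ (letter m ⧢ v) (λ v′ → φ (k ∷ v′))))

        r₇≈t₇ : r₇ ≈ t₇
        r₇≈t₇ = ⧢-cong′ as bs λ w lw → trans
          (∫-cong (⋄ a b) λ (k , m) → trans (rotate ih (letter m) w cs (graft k c₀ φ) (bound₂ m w lw))
            (⧢-cong′ w cs λ v lv → trans (∫-swap (letter m ⧢ v) (⋄ k c₀) (λ v′ (k′ , m′) → ∫ (letter m′ ⧢ v′) (λ w′ → φ (k′ ∷ w′))))
              (∫-cong (⋄ k c₀) λ (k′ , m′) → sym (rotate ih (letter m′) (letter m) v (λ w′ → φ (k′ ∷ w′)) (bound₃ m′ m w v lw lv)))))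
          (∫-swap (⋄ a b) (w ⧢ cs) (λ (k , m) v → ∫ (⋄ k c₀) (λ (k′ , m′) → ∫ (letter m′ ⧢ letter m) (λ y → ∫ (y ⧢ v) (λ w′ → φ (k′ ∷ w′))))))

        -- The terms in which c₀ comes first recombine: they are the recursion for A ⧢ B read
        -- backwards.
        p≈t₃ : p₁ + (p₂ + p₃) ≈ t₃
        p≈t₃ = sym (⧢-∷ a as b bs (λ u → ∫ (u ⧢ cs) (λ w → φ (c₀ ∷ w))))

      expand : T₃ A B C′ φ ≈ t₁ + (t₂ + (t₃ + (t₄ + (t₅ + (t₆ + t₇)))))
      expand = begin
        T₃ A B C′ φ
          ≈⟨ ⧢-∷ a as b bs (λ u → ∫ (u ⧢ C′) φ) ⟩
        ∫ (as ⧢ B) (λ u → ∫ ((a ∷ u) ⧢ C′) φ) + (∫ (A ⧢ bs) (λ u → ∫ ((b ∷ u) ⧢ C′) φ)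
            + ∫ (as ⧢ bs) (λ w → ∫ (⋄ a b) (λ (k , m) → ∫ (letter m ⧢ w) (λ w′ → ∫ ((k ∷ w′) ⧢ C′) φ))))
          ≈⟨ +-cong (trans (∫-cong (as ⧢ B) (head-expand a)) (split (as ⧢ B) _ _ _)) (+-cong (trans (∫-cong (A ⧢ bs) (head-expand b)) (split (A ⧢ bs) _ _ _)) third) ⟩
        (t₁ + (p₁ + t₄)) + ((t₂ + (p₂ + t₅)) + (r₁ + (p₃ + r₇)))
          ≈⟨ solve 9 (λ t₁ p₁ t₄ t₂ p₂ t₅ r₁ p₃ r₇ → (t₁ :+ (p₁ :+ t₄)) :+ ((t₂ :+ (p₂ :+ t₅)) :+ (r₁ :+ (p₃ :+ r₇)))
               := t₁ :+ (t₂ :+ ((p₁ :+ (p₂ :+ p₃)) :+ (t₄ :+ (t₅ :+ (r₁ :+ r₇)))))) refl t₁ p₁ t₄ t₂ p₂ t₅ r₁ p₃ r₇ ⟩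
        t₁ + (t₂ + ((p₁ + (p₂ + p₃)) + (t₄ + (t₅ + (r₁ + r₇)))))
          ≈⟨ +-congˡ (+-congˡ (+-cong p≈t₃ (+-congˡ (+-congˡ (+-cong r₁≈t₆ r₇≈t₇))))) ⟩
        t₁ + (t₂ + (t₃ + (t₄ + (t₅ + (t₆ + t₇))))) ∎

    T₃-cong : ∀ a b c {φ ψ} → (∀ w → φ w ≈ ψ w) → T₃ a b c φ ≈ T₃ a b c ψ
    T₃-cong a b c h = ∫-cong (a ⧢ b) λ u → ∫-cong (u ⧢ c) h

    graft-sym : ∀ a b φ w → graft a b φ w ≈ graft b a φ w
    graft-sym a b φ w = ⋄-sym a b _

    cyclic : ∀ N → Cyclic N
    cyclic N [] b c φ _ = trans (⧢-[]ˡ b _) (∫-cong (b ⧢ c) λ u → sym (⧢-[]ʳ u φ))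
    cyclic N a@(_ ∷ _) [] c φ _ = trans (⧢-[]ʳ a _) (trans (⧢-comm a c φ) (sym (⧢-[]ˡ c _)))
    cyclic N a@(_ ∷ _) b@(_ ∷ _) [] φ _ = trans (∫-cong (a ⧢ b) λ u → ⧢-[]ʳ u φ) (trans (⧢-comm a b φ) (sym (⧢-[]ʳ b _)))
    cyclic (suc N) (a ∷ as) (b ∷ bs) (c₀ ∷ cs) φ (s≤s h) = begin
      T₃ A B C′ φ
        ≈⟨ E.expand ⟩
      E.t₁ + (E.t₂ + (E.t₃ + (E.t₄ + (E.t₅ + (E.t₆ + E.t₇)))))
        -- Beyond the induction hypothesis the pair terms need at most the symmetry of `⋄`; only the
        -- term merging all three heads needs the identity for letters.
        ≈⟨ +-cong (ih as B C′ _ h) (+-cong (ih A bs C′ _ b₂) (+-cong (ih A B cs _ b₃) (+-cong (trans (ih as B cs _ b₄) (T₃-cong B cs as (graft-sym a c₀ φ)))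
             (+-cong (ih A bs cs _ b₅) (+-cong (trans (ih as bs C′ _ b₆) (T₃-cong bs C′ as (graft-sym a b φ)))
               (trans (ih as bs cs _ b₇) (T₃-cong bs cs as λ v → triproduct-cyclic a b c₀ _))))))) ⟩
      E′.t₃ + (E′.t₁ + (E′.t₂ + (E′.t₅ + (E′.t₆ + (E′.t₄ + E′.t₇)))))
        ≈⟨ solve 7 (λ t₁ t₂ t₃ t₄ t₅ t₆ t₇ → t₃ :+ (t₁ :+ (t₂ :+ (t₅ :+ (t₆ :+ (t₄ :+ t₇))))) := t₁ :+ (t₂ :+ (t₃ :+ (t₄ :+ (t₅ :+ (t₆ :+ t₇)))))) refl E′.t₁ E′.t₂ E′.t₃ E′.t₄ E′.t₅ E′.t₆ E′.t₇ ⟩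
      E′.t₁ + (E′.t₂ + (E′.t₃ + (E′.t₄ + (E′.t₅ + (E′.t₆ + E′.t₇)))))
        ≈⟨ E′.expand ⟨
      T₃ B C′ A φ ∎
      where
      A = a ∷ as
      B = b ∷ bs
      C′ = c₀ ∷ cs
      ih = cyclic N
      x = length as
      y = length bs
      z = length cs
      le : ∀ {m n} → m ≡ n → n ≤ N → m ≤ N
      le ≡.refl p = p
      bound : 2 +ℕ (x +ℕ y +ℕ z) ≤ N
      bound = le (N.solve 3 (λ x y z → N.con 2 N.:+ (x N.:+ y N.:+ z) N.:= x N.:+ ((N.con 1 N.:+ y) N.:+ (N.con 1 N.:+ z))) ≡.refl x y z) h
      bound′ : 2 +ℕ (y +ℕ z +ℕ x) ≤ N
      bound′ = le (N.solve 3 (λ x y z → N.con 2 N.:+ (y N.:+ z N.:+ x) N.:= N.con 2 N.:+ (x N.:+ y N.:+ z)) ≡.refl x y z) bound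
      b₂ : suc x +ℕ (y +ℕ suc z) ≤ N
      b₂ = le (N.solve 3 (λ x y z → N.con 1 N.:+ x N.:+ (y N.:+ (N.con 1 N.:+ z)) N.:= N.con 2 N.:+ (x N.:+ y N.:+ z)) ≡.refl x y z) bound
      b₃ : suc x +ℕ (suc y +ℕ z) ≤ N
      b₃ = le (N.solve 3 (λ x y z → N.con 1 N.:+ x N.:+ ((N.con 1 N.:+ y) N.:+ z) N.:= N.con 2 N.:+ (x N.:+ y N.:+ z)) ≡.refl x y z) bound
      bound₁ : 1 +ℕ (x +ℕ y +ℕ z) ≤ N
      bound₁ = ℕₚ.≤-trans (ℕₚ.n≤1+n _) bound
      b₄ : x +ℕ (suc y +ℕ z) ≤ N
      b₄ = le (N.solve 3 (λ x y z → x N.:+ ((N.con 1 N.:+ y) N.:+ z) N.:= N.con 1 N.:+ (x N.:+ y N.:+ z)) ≡.refl x y z) bound₁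
      b₅ : suc x +ℕ (y +ℕ z) ≤ N
      b₅ = le (N.solve 3 (λ x y z → N.con 1 N.:+ x N.:+ (y N.:+ z) N.:= N.con 1 N.:+ (x N.:+ y N.:+ z)) ≡.refl x y z) bound₁
      b₆ : x +ℕ (y +ℕ suc z) ≤ N
      b₆ = le (N.solve 3 (λ x y z → x N.:+ (y N.:+ (N.con 1 N.:+ z)) N.:= N.con 1 N.:+ (x N.:+ y N.:+ z)) ≡.refl x y z) bound₁
      b₇ : x +ℕ (y +ℕ z) ≤ N
      b₇ = ℕₚ.≤-trans (ℕₚ.n≤1+n _) b₅
      module E = Expand N ih a as b bs c₀ cs bound φ
      module E′ = Expand N ih b bs c₀ cs a as bound′ φ

  ⧢-assoc : ∀ a b c φ → ∫ (a ⧢ b) (λ u → ∫ (u ⧢ c) φ) ≈ ∫ (b ⧢ c) (λ v → ∫ (a ⧢ v) φ)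
  ⧢-assoc a b c φ = rotate (cyclic (length a +ℕ (length b +ℕ length c))) a b c φ ℕₚ.≤-refl

-- Inverse power series, the additive series E and its powers.

module Inverse {c ℓ : Level} (R : CommutativeRing c ℓ) where
  open RingKit R
  open PowerSeries R

  private
    tail : PS.Carrier → PS.Carrier
    tail f n = f (suc n)

    -- Iterates of g ↦ 1 - X (tail f) g, whose fixed point is 1/f when f has constant term 1. The
    -- k-th iterate is final up to degree k, so `inv` reads off the diagonal.
    approx : PS.Carrier → ℕ → PS.Carrier
    approx f zero    = PS.1#
    approx f (suc k) = PS.1# PS.- X PS.* (tail f PS.* approx f k)

    approx-zero : ∀ f k → approx f k 0 ≈ 1#
    approx-zero f zero    = refl
    approx-zero f (suc k) = trans (+-congˡ (trans (-‿cong (X-*-zero (tail f PS.* approx f k))) -0≈0)) (+-identityʳ 1#)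

    approx-suc : ∀ f k n → approx f (suc k) (suc n) ≈ - (tail f PS.* approx f k) n
    approx-suc f k n = trans (+-identityˡ _) (-‿cong (X-*-suc (tail f PS.* approx f k) n))

    approx-stable : ∀ f k n → n ≤ k → approx f (suc k) n ≈ approx f k n
    approx-stable f k       zero    _         = trans (approx-zero f (suc k)) (sym (approx-zero f k))
    approx-stable f (suc k) (suc n) (s≤s n≤k) = trans (approx-suc f (suc k) n) (trans (-‿cong (anti-cong′ n λ a b eq →
      *-congˡ (approx-stable f k b (ℕₚ.≤-trans (ℕₚ.≤-trans (ℕₚ.m≤n+m b a) (ℕₚ.≤-reflexive eq)) n≤k)))) (sym (approx-suc f k n)))

  inv : PS.Carrier → PS.Carrier
  inv f n = approx f n n

  private
    approx-inv : ∀ f n j → approx f (j +ℕ n) n ≈ inv f n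
    approx-inv f n zero    = refl
    approx-inv f n (suc j) = trans (approx-stable f (j +ℕ n) n (ℕₚ.m≤n+m n j)) (approx-inv f n j)

  inv-inverse : ∀ f → f 0 ≈ 1# → f PS.* inv f PS.≈ PS.1#
  inv-inverse f f0 zero    = trans (*-congʳ f0) (*-identityˡ _)
  inv-inverse f f0 (suc n) = begin
    f 0 * inv f (suc n) + (tail f PS.* inv f) n
      ≈⟨ +-congʳ (trans (*-congʳ f0) (trans (*-identityˡ _) (approx-suc f n n))) ⟩
    - (tail f PS.* approx f n) n + (tail f PS.* inv f) n
      ≈⟨ +-congʳ (-‿cong (anti-cong′ n λ { a b ≡.refl → *-congˡ (approx-inv f b a) })) ⟩
    - (tail f PS.* inv f) n + (tail f PS.* inv f) n
      ≈⟨ -‿inverseˡ _ ⟩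
    0# ∎

  module Support (d : ℕ) where
    Supported : PS.Carrier → Set ℓ
    Supported f = ∀ n → ¬ (d ∣ n) → f n ≈ 0#

    supported-* : ∀ {f g} → Supported f → Supported g → Supported (f PS.* g)
    supported-* {f} {g} sf sg n d∤n = anti-0′ n term
      where
      term : ∀ a b → a +ℕ b ≡ n → f a * g b ≈ 0#
      term a b eq with d ∣? a
      ... | no d∤a  = trans (*-congʳ (sf a d∤a)) (zeroˡ _)
      ... | yes d∣a = trans (*-congˡ (sg b (λ d∣b → d∤n (≡.subst (d ∣_) eq (∣m∣n⇒∣m+n d∣a d∣b))))) (zeroʳ _)

    supported-1 : Supported PS.1#
    supported-1 zero    h = ⊥-elim (h (divides 0 ≡.refl))
    supported-1 (suc n) h = refl

    supported-^ : ∀ {f} k → Supported f → Supported (f PS.^ k)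
    supported-^     zero    sf = supported-1
    supported-^ {f} (suc k) sf = supported-* {f} {f PS.^ k} sf (supported-^ {f} k sf)

    -- `X * tail f` is f without its constant term, hence again supported on multiples of d, and so
    -- is every iterate.
    supported-inv : ∀ {f} → Supported f → Supported (inv f)
    supported-inv {f} sf n = approx-supported n n
      where
      u : PS.Carrier
      u = X PS.* tail f
      su : Supported u
      su zero    h = ⊥-elim (h (divides 0 ≡.refl))
      su (suc n) h = trans (X-*-suc (tail f) n) (sf (suc n) h)
      approx-supported : ∀ k → Supported (approx f k)
      approx-supported zero    = supported-1
      approx-supported (suc k) n h = trans (+-cong (supported-1 n h) (trans (-‿cong (trans (sym (PS.*-assoc X (tail f) (approx f k) n)) (supported-* {u} {approx f k} su (approx-supported k) n h))) -0≈0)) (+-identityʳ 0#)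

module Additive {c ℓ : Level} (R : CommutativeRing c ℓ) where
  open RingKit R

  -- With E = ug, g = 1/Q, this turns the identity for Q into additivity of E.
  reciprocal-additive : ∀ {x y qx qy qz gx gy gz} → qx * gx ≈ 1# → qy * gy ≈ 1# → qz * gz ≈ 1# →
    (x + y) * (qx * qy) ≈ y * (qz * qx) + x * (qz * qy) → (x + y) * gz ≈ x * gx + y * gy
  reciprocal-additive {x} {y} {qx} {qy} {qz} {gx} {gy} {gz} ex ey ez h = begin
    (x + y) * gz
      ≈⟨ *-congʳ (trans (*-congˡ (trans (*-cong ex ey) (*-identityˡ 1#))) (*-identityʳ _)) ⟨
    (x + y) * ((qx * gx) * (qy * gy)) * gz
      ≈⟨ solve 6 (λ z a b c d e → z :* ((a :* b) :* (c :* d)) :* e := (z :* (a :* c)) :* (b :* d :* e)) refl (x + y) qx gx qy gy gz ⟩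
    ((x + y) * (qx * qy)) * (gx * gy * gz)
      ≈⟨ *-congʳ h ⟩
    (y * (qz * qx) + x * (qz * qy)) * (gx * gy * gz)
      ≈⟨ solve 8 (λ x y qx qy qz gx gy gz → (y :* (qz :* qx) :+ x :* (qz :* qy)) :* (gx :* gy :* gz) := x :* gx :* ((qy :* gy) :* (qz :* gz)) :+ y :* gy :* ((qx :* gx) :* (qz :* gz))) refl x y qx qy qz gx gy gz ⟩
    x * gx * ((qy * gy) * (qz * gz)) + y * gy * ((qx * gx) * (qz * gz))
      ≈⟨ +-cong (trans (*-congˡ (trans (*-cong ey ez) (*-identityˡ 1#))) (*-identityʳ _)) (trans (*-congˡ (trans (*-cong ex ez) (*-identityˡ 1#))) (*-identityʳ _)) ⟩
    x * gx + y * gy ∎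

-- A is an algebra in which the letters L m multiply by the shuffle rule; the words of depth 2 are G n (m + 1).
module Exponential {c ℓ r ℓr : Level} (e : ℕ) (F : FiniteField c ℓ (suc (suc e)))
                   (A : CommutativeRing r ℓr) (ιA : Hom (FiniteField.ring F) A)
                   (L : ℕ → CommutativeRing.Carrier A) (G : ℕ → ℕ → CommutativeRing.Carrier A)
                   (L0 : CommutativeRing._≈_ A (L 0) (CommutativeRing.1# A))
                   (L-pair : ∀ i j → CommutativeRing._≈_ A (CommutativeRing._*_ A (L i) (L j)) (StarIdentity.Pair.pair e F A ιA (L 0) G i j)) where
  open FieldFacts e F using (d; χ)
  open Gamma e F using (γ; χ-0; χ-shift)
  module SA = StarIdentity e F A ιA
  module A = RingKit A
  open TwoVar A
  module PA = PowerSeries A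
  private
    module PSA = PA.PS
    module P = P₂.PS
    ιP = ι ∘ʰ ιA
    module SP = StarIdentity e F P₂.PS ιP
    module MC = MooreCancellable e F A ιA
    module PP = PowerSeries P₂.PS
    module Z = PP.PS
    ιZ = PP.constʰ ∘ʰ ιP
    module SZ = StarIdentity e F PP.PS ιZ
    open Hom ι
    module ιA = Hom ιA
    module ιP = Hom ιP
    module I = Inverse A
    open I.Support d

  Q E : PSA.Carrier
  Q m = ιA.⟦ χ m ⟧ A.* L m
  E = PA.X PSA.* I.inv Q

  B : ℕ → ℕ → A.Carrier
  B a k = (E PSA.^ k) a

  private
    Q0 : Q 0 A.≈ A.1#
    Q0 = A.trans (A.*-cong (A.trans (A.reflexive (≡.cong ιA.⟦_⟧ χ-0)) ιA.⟦⟧-1) L0) (A.*-identityˡ _)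

    Q-supported : Supported Q
    Q-supported n h = A.trans (A.*-congʳ (SA.χP-zero (FieldFacts.χ-no e F h))) (A.zeroˡ _)

    E^ : ∀ k → E PSA.^ k PSA.≈ PA.X PSA.^ k PSA.* I.inv Q PSA.^ k
    E^ k = PSA.^-distrib-* PA.X (I.inv Q) k

  B-above : ∀ a k → a ℕ.< k → B a k A.≈ A.0#
  B-above a k a<k = A.trans (E^ k a) (A.anti-0′ a λ i j eq → A.trans (A.*-congʳ (PA.X^-above k i (ℕₚ.≤-<-trans (ℕₚ.≤-trans (ℕₚ.m≤m+n i j) (ℕₚ.≤-reflexive eq)) a<k))) (A.zeroˡ _))

  private
    X^-shift : ∀ k f n → (PA.X PSA.^ k PSA.* f) (k +ℕ n) A.≈ f n
    X^-shift zero    f n = PSA.*-identityˡ f n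
    X^-shift (suc k) f n = A.trans (PSA.*-assoc PA.X (PA.X PSA.^ k) f (suc (k +ℕ n))) (A.trans (PA.X-*-suc (PA.X PSA.^ k PSA.* f) (k +ℕ n)) (X^-shift k f n))

  -- E is u times a series in u^d, so E^j has only exponents congruent to j modulo d. This trades a
  -- mask depending on m for one depending on j.
  B-mask : ∀ m j → SA.χP (suc m) A.* B m j A.≈ SA.χP (suc j) A.* B m j
  B-mask m j with m ℕₚ.<? j
  ... | yes m<j = A.trans (zero-r _) (A.sym (zero-r _))
    where
    zero-r : ∀ x → x A.* B m j A.≈ A.0#
    zero-r x = A.trans (A.*-congˡ (B-above m j m<j)) (A.zeroʳ x)
  ... | no m≮j with m ℕ.∸ j | ℕₚ.m+[n∸m]≡n (ℕₚ.≮⇒≥ m≮j)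
  ... | n | ≡.refl with d ∣? n
  ... | yes d∣n = A.*-congʳ (A.reflexive (≡.cong ιA.⟦_⟧ (≡.trans (≡.cong χ (ℕₚ.+-comm (suc j) n)) (χ-shift (suc j) d∣n))))
  ... | no d∤n = A.trans (zero-r _) (A.sym (zero-r _))
    where
    zero-r : ∀ x → x A.* B (j +ℕ n) j A.≈ A.0#
    zero-r x = A.trans (A.*-congˡ (A.trans (E^ j (j +ℕ n)) (A.trans (X^-shift j (I.inv Q PSA.^ j) n) (supported-^ {I.inv Q} j (supported-inv {Q} Q-supported) n d∤n)))) (A.zeroʳ x)

  private
    -- The series f(τ h) in an auxiliary variable h that records the degree; sums such as s - t can
    -- then be substituted without any question of convergence.
    ev : P.Carrier → PSA.Carrier → Z.Carrier
    ev τ f = PP.at τ (λ n → ⟦ f n ⟧)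

    ev-cong : ∀ τ {f g} → f PSA.≈ g → ev τ f Z.≈ ev τ g
    ev-cong τ h = PP.at-cong τ (λ n → ⟦⟧-cong (h n))

    ev-* : ∀ τ f g → ev τ (f PSA.* g) Z.≈ ev τ f Z.* ev τ g
    ev-* τ f g = Z.trans (PP.at-cong τ λ n → P.trans (⟦⟧-anti n _) (P.anti-cong n λ a b → ⟦⟧-* (f a) (g b))) (PP.at-* τ (λ n → ⟦ f n ⟧) (λ n → ⟦ g n ⟧))

    ev-1 : ∀ τ → ev τ PSA.1# Z.≈ Z.1#
    ev-1 τ = Z.trans (PP.at-cong τ λ { zero → ⟦⟧-1 ; (suc n) → ⟦⟧-0 }) (PP.at-1 τ)

    ev-^ : ∀ τ f k → ev τ (f PSA.^ k) Z.≈ ev τ f Z.^ k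
    ev-^ τ f zero    = ev-1 τ
    ev-^ τ f (suc k) = Z.trans (ev-* τ f (f PSA.^ k)) (Z.*-congˡ (ev-^ τ f k))

    ev-X : ∀ τ → ev τ PA.X Z.≈ PP.const τ Z.* PP.X
    ev-X τ = Z.trans (PP.at-cong τ λ { zero → ⟦⟧-0 ; (suc zero) → ⟦⟧-1 ; (suc (suc n)) → ⟦⟧-0 }) (PP.at-X τ)

    QG : ∀ τ → ev τ Q Z.* ev τ (I.inv Q) Z.≈ Z.1#
    QG τ = Z.trans (Z.sym (ev-* τ Q (I.inv Q))) (Z.trans (ev-cong τ (I.inv-inverse Q Q0)) (ev-1 τ))

    ev-E : ∀ τ → ev τ E Z.≈ (PP.const τ Z.* PP.X) Z.* ev τ (I.inv Q)
    ev-E τ = Z.trans (ev-* τ PA.X (I.inv Q)) (Z.*-congʳ (ev-X τ))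

    ⟦dia⟧ : ∀ a b H → ⟦ SA.dia a b H ⟧ P.≈ SP.dia a b (λ n m → ⟦ H n m ⟧)
    ⟦dia⟧ a b H = P.trans (⟦⟧-+ _ _) (P.+-congˡ (P.trans (⟦⟧-anti (a +ℕ b) _) (P.anti-cong (a +ℕ b) λ n m → ⟦⟧-* _ _)))

    module Pr = SP.Pair ⟦ L 0 ⟧ (λ n m → ⟦ G n m ⟧)

    ⟦pair⟧ : ∀ i j → ⟦ SA.Pair.pair (L 0) G i j ⟧ P.≈ Pr.pair i j
    ⟦pair⟧ zero    zero    = P.refl
    ⟦pair⟧ zero    (suc b) = P.refl
    ⟦pair⟧ (suc a) zero    = P.refl
    ⟦pair⟧ (suc a) (suc b) = P.trans (⟦⟧-+ _ _) (P.+-congˡ (P.trans (⟦⟧-+ _ _) (P.+-congˡ (⟦dia⟧ a b G))))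

    form-Q : ∀ N x y → Pr.form N x y P.≈ (ev x Q Z.* ev y Q) N
    form-Q N x y = P.anti-cong N λ i j → P.trans (P.*-congʳ (P.*-congˡ (P.trans (P.sym (⟦pair⟧ i j)) (P.trans (⟦⟧-cong (A.sym (L-pair i j))) (⟦⟧-* _ _)))))
      (P.trans (P.solve 6 (λ a b p r X Y → a P.:* b P.:* (p P.:* r) P.:* (X P.:* Y) P.:= (a P.:* p) P.:* X P.:* ((b P.:* r) P.:* Y)) P.refl _ _ _ _ _ _)
        (P.sym (P.*-cong (P.*-congʳ (⟦⟧-* _ _)) (P.*-congʳ (⟦⟧-* _ _)))))

    -- Chosen so that x + y = s: additivity is wanted for s, t and the difference s - t occurring in
    -- `dia-GF`, and for this pair the Moore determinant is cancellable.
    x y : P.Carrier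
    x = s P.- t
    y = t

    -- In degree N of h this is `Star` for the N-th form, since products of two letters are given by
    -- `pair`.
    Q-star : (PP.const x Z.+ PP.const y) Z.* (ev x Q Z.* ev y Q) Z.≈ PP.const y Z.* (ev (x P.+ y) Q Z.* ev x Q) Z.+ PP.const x Z.* (ev (x P.+ y) Q Z.* ev y Q)
    Q-star N = P.trans (Z.*-congʳ {ev x Q Z.* ev y Q} (Z.sym (Hom.⟦⟧-+ PP.constʰ x y)) N)
      (P.trans (PP.const-* (x P.+ y) (ev x Q Z.* ev y Q) N) (P.trans (P.*-congˡ {x P.+ y} (P.sym (form-Q N x y)))
      (P.trans (Pr.form-star N x y MC.Moore-s-t) (P.sym (P.+-cong
        (P.trans (PP.const-* y (ev (x P.+ y) Q Z.* ev x Q) N) (P.*-congˡ {y} (P.sym (form-Q N (x P.+ y) x))))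
        (P.trans (PP.const-* x (ev (x P.+ y) Q Z.* ev y Q) N) (P.*-congˡ {x} (P.sym (form-Q N (x P.+ y) y)))))))))

    Es Et Eu : Z.Carrier
    Es = ev s E
    Et = ev t E
    Eu = ev x E

    E-additive : Es Z.≈ Eu Z.+ Et
    E-additive = begin
      ev s E
        ≈⟨ PP.at-cong-τ (λ n → ⟦ E n ⟧) (P.sym MC.s-t+t) ⟩
      ev (x P.+ y) E
        ≈⟨ ev-E (x P.+ y) ⟩
      (PP.const (x P.+ y) Z.* PP.X) Z.* g (x P.+ y)
        ≈⟨ Z.*-congʳ (Z.*-congʳ (Hom.⟦⟧-+ PP.constʰ x y)) ⟩
      ((PP.const x Z.+ PP.const y) Z.* PP.X) Z.* g (x P.+ y)
        ≈⟨ Z.solve 3 (λ a b c → (a Z.:* b) Z.:* c Z.:= b Z.:* (a Z.:* c)) Z.refl (PP.const x Z.+ PP.const y) PP.X (g (x P.+ y)) ⟩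
      PP.X Z.* ((PP.const x Z.+ PP.const y) Z.* g (x P.+ y))
        ≈⟨ Z.*-congˡ (Additive.reciprocal-additive PP.PS (QG x) (QG y) (QG (x P.+ y)) Q-star) ⟩
      PP.X Z.* (PP.const x Z.* g x Z.+ PP.const y Z.* g y)
        ≈⟨ Z.solve 5 (λ X a b c d → X Z.:* (a Z.:* b Z.:+ c Z.:* d) Z.:= (a Z.:* X) Z.:* b Z.:+ (c Z.:* X) Z.:* d) Z.refl PP.X (PP.const x) (g x) (PP.const y) (g y) ⟩
      (PP.const x Z.* PP.X) Z.* g x Z.+ (PP.const y Z.* PP.X) Z.* g y
        ≈⟨ Z.+-cong (ev-E x) (ev-E y) ⟨
      ev x E Z.+ ev y E ∎
      where
      open Z using (begin_; step-≈-⟩; step-≈-⟨; _∎)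
      g : P.Carrier → Z.Carrier
      g τ = ev τ (I.inv Q)

    Es-Et : Es Z.- Et Z.≈ Eu
    Es-Et = Z.trans (Z.+-congʳ E-additive) (Z.solve 2 (λ a b → (a Z.:+ b) Z.:- b Z.:= a) Z.refl Eu Et)

    Eu-Q : Eu Z.* ev x Q Z.≈ PP.const x Z.* PP.X
    Eu-Q = Z.trans (Z.*-congʳ (ev-E x)) (Z.trans (Z.solve 3 (λ a g q → (a Z.:* g) Z.:* q Z.:= a Z.:* (q Z.:* g)) Z.refl (PP.const x Z.* PP.X) (ev x (I.inv Q)) (ev x Q)) (Z.trans (Z.*-congˡ (QG x)) (Z.*-identityʳ _)))

    product-GF : ∀ N k l → P.anti N (λ a b → ⟦ B a k A.* B b l ⟧ P.* (s P.^ a P.* t P.^ b)) P.≈ (Es Z.^ k Z.* Et Z.^ l) N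
    product-GF N k l = P.trans (P.anti-cong N λ a b → P.trans (P.*-congʳ (⟦⟧-* _ _)) (P.solve 4 (λ p r X Y → (p P.:* r) P.:* (X P.:* Y) P.:= (p P.:* X) P.:* (r P.:* Y)) P.refl _ _ _ _))
      (Z.*-cong {ev s (E PSA.^ k)} {Es Z.^ k} {ev t (E PSA.^ l)} {Et Z.^ l} (ev-^ s E k) (ev-^ t E l) N)

  -- The coefficient of s^a t^b in the difference quotient (E(s)^i - E(t)^i) / (E(s) - E(t)), which
  -- is zero for i = 0.
  depth1 : ℕ → ℕ → ℕ → A.Carrier
  depth1 zero    a b = A.0#
  depth1 (suc p) a b = A.anti p (λ k l → B a k A.* B b l)

  private
    x*N : ∀ (f : Z.Carrier) N → x P.* f N P.≈ ((PP.const x Z.* PP.X) Z.* f) (suc N)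
    x*N f N = P.sym (P.trans (Z.*-assoc (PP.const x) PP.X f (suc N)) (P.trans (PP.const-* x (PP.X Z.* f) (suc N)) (P.*-congˡ {x} (PP.X-*-suc f N))))

    left₁ : ∀ N i → x P.* GF N (λ a b → SA.dia a b (λ n m → B n i A.* L m)) P.≈ ((Es Z.^ i Z.- Et Z.^ i) Z.* ev x Q) (suc N)
    left₁ N i = begin
      x P.* GF N (λ a b → SA.dia a b (λ n m → B n i A.* L m))
        ≈⟨ P.*-congˡ {x} (P.anti-cong N λ a b → P.*-congʳ (⟦dia⟧ a b (λ n m → B n i A.* L m))) ⟩
      x P.* P.anti N (λ a b → SP.dia a b (λ n m → ⟦ B n i A.* L m ⟧) P.* (s P.^ a P.* t P.^ b))
        ≈⟨ SP.dia-GF N (λ n m → ⟦ B n i A.* L m ⟧) s t ⟩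
      P.anti (suc N) (λ n m → SP.χP m P.* ⟦ B n i A.* L m ⟧ P.* ((s P.^ n P.- t P.^ n) P.* x P.^ m))
        ≈⟨ P.anti-cong (suc N) (λ n m → P.trans (P.*-congʳ (P.*-congˡ (⟦⟧-* (B n i) (L m))))
             (P.trans (P.solve 6 (λ k b l S T U → k P.:* (b P.:* l) P.:* ((S P.:- T) P.:* U) P.:= (b P.:* S P.:- b P.:* T) P.:* ((k P.:* l) P.:* U)) P.refl (SP.χP m) ⟦ B n i ⟧ ⟦ L m ⟧ (s P.^ n) (t P.^ n) (x P.^ m))
               (P.*-congˡ (P.*-congʳ (P.sym (⟦⟧-* ιA.⟦ χ m ⟧ (L m))))))) ⟩
      ((ev s (E PSA.^ i) Z.- ev t (E PSA.^ i)) Z.* ev x Q) (suc N)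
        ≈⟨ Z.*-congʳ {ev x Q} {ev s (E PSA.^ i) Z.- ev t (E PSA.^ i)} {Es Z.^ i Z.- Et Z.^ i} (Z.+-cong (ev-^ s E i) (Z.-‿cong (ev-^ t E i))) (suc N) ⟩
      ((Es Z.^ i Z.- Et Z.^ i) Z.* ev x Q) (suc N) ∎
      where open P using (begin_; step-≈-⟩; step-≈-⟨; _∎)

    right₁ : ∀ N i → x P.* GF N (depth1 i) P.≈ ((Es Z.^ i Z.- Et Z.^ i) Z.* ev x Q) (suc N)
    right₁ N zero = P.trans (P.*-congˡ {x} (P.anti-0′ N λ a b _ → P.trans (P.*-congʳ ⟦⟧-0) (P.zeroˡ _))) (P.trans (P.zeroʳ x)
      (P.sym (Z.trans (Z.*-congʳ {ev x Q} {Z.1# Z.- Z.1#} {Z.0#} (Z.-‿inverseʳ Z.1#)) (Z.zeroˡ (ev x Q)) (suc N))))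
    right₁ N (suc p) = begin
      x P.* GF N (depth1 (suc p))
        ≈⟨ P.*-congˡ {x} (P.anti-cong N λ a b → P.trans (P.*-congʳ (⟦⟧-anti p _)) (P.anti-*ʳ p _ _)) ⟩
      x P.* P.anti N (λ a b → P.anti p (λ k l → ⟦ B a k A.* B b l ⟧ P.* (s P.^ a P.* t P.^ b)))
        ≈⟨ P.*-congˡ {x} (P.trans (P.anti-swap N p (λ a b k l → ⟦ B a k A.* B b l ⟧ P.* (s P.^ a P.* t P.^ b))) (P.anti-cong p λ k l → product-GF N k l)) ⟩
      x P.* P.anti p (λ k l → (Es Z.^ k Z.* Et Z.^ l) N)
        ≈⟨ P.*-congˡ {x} (P.reflexive (≡.sym (PP.anti-coeff p _ N))) ⟩
      x P.* W N
        ≈⟨ x*N W N ⟩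
      ((PP.const x Z.* PP.X) Z.* W) (suc N)
        ≈⟨ Z.*-congʳ {W} (Z.sym Eu-Q) (suc N) ⟩
      ((Eu Z.* ev x Q) Z.* W) (suc N)
        ≈⟨ Z.solve 3 (λ u q w → (u Z.:* q) Z.:* w Z.:= (u Z.:* w) Z.:* q) Z.refl Eu (ev x Q) W (suc N) ⟩
      ((Eu Z.* W) Z.* ev x Q) (suc N)
        ≈⟨ Z.*-congʳ {ev x Q} {Eu Z.* W} {Es Z.^ suc p Z.- Et Z.^ suc p} (Z.trans (Z.*-congʳ (Z.sym Es-Et)) (Z.geometric p Es Et)) (suc N) ⟩
      ((Es Z.^ suc p Z.- Et Z.^ suc p) Z.* ev x Q) (suc N) ∎
      where
      open P using (begin_; step-≈-⟩; step-≈-⟨; _∎)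
      W : Z.Carrier
      W = Z.anti p (λ k l → Es Z.^ k Z.* Et Z.^ l)

  -- By `dia-GF` the left side has generating function (E(s)^i - E(t)^i) Q(s - t) / (s - t). Here
  -- Q(u)/u = 1/E(u), and E(s - t) = E(s) - E(t).
  depth1-identity : ∀ i a b → SA.dia a b (λ n m → B n i A.* L m) A.≈ depth1 i a b
  depth1-identity i = GF-injective _ _ λ N → P.cancel cancellable-s-t (P.trans (left₁ N i) (P.sym (right₁ N i)))

  -- Both sides have generating function χ(j + 1) (E(s)^i - E(t)^i) (E(s) - E(t))^j.
  depth2-identity : ∀ i j a b → A.anti (a +ℕ b) (λ n m → ιA.⟦ γ a b m ⟧ A.* (B n i A.* B m j))
    A.≈ A.anti (i +ℕ j) (λ k l → ιA.⟦ γ k l j ⟧ A.* (B a k A.* B b l))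
  depth2-identity i j = GF-injective _ _ λ N → P.trans (left N) (P.sym (right N))
    where
    open P using (begin_; step-≈-⟩; step-≈-⟨; _∎)
    left : ∀ N → GF N (λ a b → A.anti (a +ℕ b) (λ n m → ιA.⟦ γ a b m ⟧ A.* (B n i A.* B m j))) P.≈ SP.χP (suc j) P.* ((Es Z.^ i Z.- Et Z.^ i) Z.* (Es Z.- Et) Z.^ j) N
    left N = begin
      GF N (λ a b → A.anti (a +ℕ b) (λ n m → ιA.⟦ γ a b m ⟧ A.* (B n i A.* B m j)))
        ≈⟨ P.anti-cong′ N (λ { a b ≡.refl → P.*-congʳ (P.trans (⟦⟧-anti (a +ℕ b) _) (P.anti-cong (a +ℕ b) λ n m → ⟦⟧-* _ _)) }) ⟩
      P.anti N (λ a b → P.anti N (λ n m → ιP.⟦ γ a b m ⟧ P.* ⟦ B n i A.* B m j ⟧) P.* (s P.^ a P.* t P.^ b))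
        ≈⟨ SP.γ-GF N (λ n m → ⟦ B n i A.* B m j ⟧) s t ⟩
      P.anti N (λ n m → SP.χP (suc m) P.* ⟦ B n i A.* B m j ⟧ P.* ((s P.^ n P.- t P.^ n) P.* x P.^ m))
        -- After the exchange of masks the factor is constant, and the sum splits into a product of
        -- two series in h.
        ≈⟨ P.anti-cong N (λ n m → P.trans (P.*-congʳ (mask n m))
             (P.solve 6 (λ k b l S T U → k P.:* (b P.:* l) P.:* ((S P.:- T) P.:* U) P.:= k P.:* ((b P.:* S P.:- b P.:* T) P.:* (l P.:* U))) P.refl (SP.χP (suc j)) ⟦ B n i ⟧ ⟦ B m j ⟧ (s P.^ n) (t P.^ n) (x P.^ m))) ⟩
      P.anti N (λ n m → SP.χP (suc j) P.* ((⟦ B n i ⟧ P.* s P.^ n P.- ⟦ B n i ⟧ P.* t P.^ n) P.* (⟦ B m j ⟧ P.* x P.^ m)))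
        ≈⟨ P.anti-*ˡ N (SP.χP (suc j)) _ ⟨
      SP.χP (suc j) P.* ((ev s (E PSA.^ i) Z.- ev t (E PSA.^ i)) Z.* ev x (E PSA.^ j)) N
        ≈⟨ P.*-congˡ {SP.χP (suc j)} (Z.*-cong {ev s (E PSA.^ i) Z.- ev t (E PSA.^ i)} {Es Z.^ i Z.- Et Z.^ i} {ev x (E PSA.^ j)} {(Es Z.- Et) Z.^ j}
             (Z.+-cong (ev-^ s E i) (Z.-‿cong (ev-^ t E i))) (Z.trans (ev-^ x E j) (Z.^-congˡ j (Z.sym Es-Et))) N) ⟩
      SP.χP (suc j) P.* ((Es Z.^ i Z.- Et Z.^ i) Z.* (Es Z.- Et) Z.^ j) N ∎
      where
      mask : ∀ n m → SP.χP (suc m) P.* ⟦ B n i A.* B m j ⟧ P.≈ SP.χP (suc j) P.* (⟦ B n i ⟧ P.* ⟦ B m j ⟧)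
      mask n m = P.trans (P.sym (⟦⟧-* _ _)) (P.trans (⟦⟧-cong (A.trans (A.solve 3 (λ k b c → k A.:* (b A.:* c) A.:= b A.:* (k A.:* c)) A.refl (SA.χP (suc m)) (B n i) (B m j))
        (A.trans (A.*-congˡ (B-mask m j)) (A.solve 3 (λ k b c → b A.:* (k A.:* c) A.:= k A.:* (b A.:* c)) A.refl (SA.χP (suc j)) (B n i) (B m j)))))
        (P.trans (⟦⟧-* _ _) (P.*-congˡ (⟦⟧-* _ _))))
    right : ∀ N → GF N (λ a b → A.anti (i +ℕ j) (λ k l → ιA.⟦ γ k l j ⟧ A.* (B a k A.* B b l))) P.≈ SP.χP (suc j) P.* ((Es Z.^ i Z.- Et Z.^ i) Z.* (Es Z.- Et) Z.^ j) N
    right N = begin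
      GF N (λ a b → A.anti (i +ℕ j) (λ k l → ιA.⟦ γ k l j ⟧ A.* (B a k A.* B b l)))
        ≈⟨ P.anti-cong N (λ a b → P.trans (P.*-congʳ (⟦⟧-anti (i +ℕ j) _)) (P.trans (P.anti-*ʳ (i +ℕ j) _ _) (P.anti-cong (i +ℕ j) λ k l → P.trans (P.*-congʳ (⟦⟧-* _ _)) (P.*-assoc _ _ _)))) ⟩
      P.anti N (λ a b → P.anti (i +ℕ j) (λ k l → ιP.⟦ γ k l j ⟧ P.* (⟦ B a k A.* B b l ⟧ P.* (s P.^ a P.* t P.^ b))))
        ≈⟨ P.anti-swap N (i +ℕ j) (λ a b k l → ιP.⟦ γ k l j ⟧ P.* (⟦ B a k A.* B b l ⟧ P.* (s P.^ a P.* t P.^ b))) ⟩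
      P.anti (i +ℕ j) (λ k l → P.anti N (λ a b → ιP.⟦ γ k l j ⟧ P.* (⟦ B a k A.* B b l ⟧ P.* (s P.^ a P.* t P.^ b))))
        ≈⟨ P.anti-cong (i +ℕ j) (λ k l → P.trans (P.sym (P.anti-*ˡ N ιP.⟦ γ k l j ⟧ _)) (P.trans (P.*-congˡ (product-GF N k l)) (P.sym (PP.const-* ιP.⟦ γ k l j ⟧ (Es Z.^ k Z.* Et Z.^ l) N)))) ⟩
      P.anti (i +ℕ j) (λ k l → (PP.const ιP.⟦ γ k l j ⟧ Z.* (Es Z.^ k Z.* Et Z.^ l)) N)
        ≈⟨ P.reflexive (≡.sym (PP.anti-coeff (i +ℕ j) _ N)) ⟩
      Z.anti (i +ℕ j) (λ k l → PP.const ιP.⟦ γ k l j ⟧ Z.* (Es Z.^ k Z.* Et Z.^ l)) N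
        -- The formula for `γ` holds in every commutative F_q-algebra; here it is evaluated at E(s)
        -- and E(t) instead of s and t.
        ≈⟨ SZ.γ-formula i j Es Et N ⟩
      (PP.const (SP.χP (suc j)) Z.* ((Es Z.^ i Z.- Et Z.^ i) Z.* (Es Z.- Et) Z.^ j)) N
        ≈⟨ PP.const-* (SP.χP (suc j)) ((Es Z.^ i Z.- Et Z.^ i) Z.* (Es Z.- Et) Z.^ j) N ⟩
      SP.χP (suc j) P.* ((Es Z.^ i Z.- Et Z.^ i) Z.* (Es Z.- Et) Z.^ j) N ∎

-- The shuffle algebra as a commutative ring.

module ShuffleAlgebra {c ℓ : Level} (e : ℕ) (F : FiniteField c ℓ (suc (suc e))) where
  open FieldFacts e F using (K)
  open Gamma e F using (γ)
  open Words e F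
  open Assoc e F using (⧢-assoc)
  open RingKit K

  mul : Free Word → Free Word → Free Word
  mul l l′ = bind l (λ u → bind l′ (λ v → u ⧢ v))

  ∫-mul : ∀ l l′ φ → ∫ (mul l l′) φ ≈ ∫ l (λ u → ∫ l′ (λ v → ∫ (u ⧢ v) φ))
  ∫-mul l l′ φ = trans (∫-bind l _ φ) (∫-cong l λ u → ∫-bind l′ _ φ)

  private
    mul-assoc : ∀ l m n φ → ∫ (mul (mul l m) n) φ ≈ ∫ (mul l (mul m n)) φ
    mul-assoc l m n φ = begin
      ∫ (mul (mul l m) n) φ
        ≈⟨ trans (∫-mul (mul l m) n φ) (∫-mul l m _) ⟩
      ∫ l (λ u → ∫ m (λ v → ∫ (u ⧢ v) (λ x → ∫ n (λ w → ∫ (x ⧢ w) φ))))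
        ≈⟨ ∫-cong l (λ u → ∫-cong m λ v → trans (∫-swap (u ⧢ v) n _) (∫-cong n λ w → ⧢-assoc u v w φ)) ⟩
      ∫ l (λ u → ∫ m (λ v → ∫ n (λ w → ∫ (v ⧢ w) (λ x → ∫ (u ⧢ x) φ))))
        ≈⟨ trans (∫-mul l (mul m n) φ) (∫-cong l λ u → ∫-mul m n _) ⟨
      ∫ (mul l (mul m n)) φ ∎

    mul-comm : ∀ l m φ → ∫ (mul l m) φ ≈ ∫ (mul m l) φ
    mul-comm l m φ = trans (∫-mul l m φ) (trans (∫-swap l m _) (trans (∫-cong m λ v → ∫-cong l λ u → ⧢-comm u v φ) (sym (∫-mul m l φ))))

    mul-congˡ : ∀ l {m n} → (∀ φ → ∫ m φ ≈ ∫ n φ) → ∀ φ → ∫ (mul l m) φ ≈ ∫ (mul l n) φ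
    mul-congˡ l {m} {n} h φ = trans (∫-mul l m φ) (trans (∫-cong l λ u → h _) (sym (∫-mul l n φ)))

    mul-identityˡ : ∀ l φ → ∫ (mul (ret []) l) φ ≈ ∫ l φ
    mul-identityˡ l φ = trans (∫-mul (ret []) l φ) (trans (∫-ret {X = Word} [] (λ u → ∫ l (λ v → ∫ (u ⧢ v) φ))) (∫-cong l λ v → ⧢-[]ˡ v φ))

    mul-distribˡ : ∀ l m n φ → ∫ (mul l (m ++ n)) φ ≈ ∫ (mul l m ++ mul l n) φ
    mul-distribˡ l m n φ = trans (∫-mul l (m ++ n) φ) (trans (∫-cong l λ u → ∫-++ m n _) (trans (∫-+ l _ _)
      (trans (+-cong (sym (∫-mul l m φ)) (sym (∫-mul l n φ))) (sym (∫-++ (mul l m) (mul l n) φ)))))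

  -- Lists of terms are never normalised; taking agreement under every functional as equality makes
  -- them a ring.
  A : CommutativeRing c (c ⊔ ℓ)
  A = record
    { Carrier = Free Word
    ; _≈_ = λ l m → ∀ φ → ∫ l φ ≈ ∫ m φ
    ; _+_ = _++_
    ; _*_ = mul
    ; -_ = scl (- 1#)
    ; 0# = []
    ; 1# = ret []
    ; isCommutativeRing = record
      { isRing = record
        { +-isAbelianGroup = record
          { isGroup = record
            { isMonoid = record
              { isSemigroup = record
                { isMagma = record
                  { isEquivalence = record
                    { refl = λ φ → refl
                    ; sym = λ h φ → sym (h φ)
                    ; trans = λ h h′ φ → trans (h φ) (h′ φ)
                    }
                  ; ∙-cong = λ {l} {l′} {m} {m′} h h′ φ → trans (∫-++ l m φ) (trans (+-cong (h φ) (h′ φ)) (sym (∫-++ l′ m′ φ)))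
                  }
                ; assoc = λ l m n φ → trans (∫-++ (l ++ m) n φ) (trans (+-congʳ (∫-++ l m φ)) (trans (+-assoc _ _ _)
                    (trans (+-congˡ (sym (∫-++ m n φ))) (sym (∫-++ l (m ++ n) φ)))))
                }
              ; identity = (λ l φ → refl) , (λ l φ → trans (∫-++ l [] φ) (+-identityʳ _))
              }
            ; inverse = (λ l φ → trans (∫-++ (scl (- 1#) l) l φ) (trans (+-congʳ (neg l φ)) (-‿inverseˡ _)))
                      , (λ l φ → trans (∫-++ l (scl (- 1#) l) φ) (trans (+-congˡ (neg l φ)) (-‿inverseʳ _)))
            ; ⁻¹-cong = λ {l} {m} h φ → trans (∫-scl (- 1#) l φ) (trans (*-congˡ (h φ)) (sym (∫-scl (- 1#) m φ)))
            }
          ; comm = λ l m φ → trans (∫-++ l m φ) (trans (+-comm _ _) (sym (∫-++ m l φ)))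
          }
        ; *-cong = λ {l} {l′} {m} {m′} h h′ φ → trans (mul-congˡ l {m} {m′} h′ φ) (trans (mul-comm l m′ φ) (trans (mul-congˡ m′ {l} {l′} h φ) (mul-comm m′ l′ φ)))
        ; *-assoc = mul-assoc
        ; *-identity = mul-identityˡ , (λ l φ → trans (mul-comm l (ret []) φ) (mul-identityˡ l φ))
        ; distrib = mul-distribˡ , (λ l m n φ → trans (mul-comm (m ++ n) l φ) (trans (mul-distribˡ l m n φ)
            (trans (∫-++ (mul l m) (mul l n) φ) (trans (+-cong (mul-comm l m φ) (mul-comm l n φ)) (sym (∫-++ (mul m l) (mul n l) φ))))))
        }
      ; *-comm = mul-comm
      }
    }
    where
    neg : ∀ l φ → ∫ (scl (- 1#) l) φ ≈ - ∫ l φ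
    neg l φ = trans (∫-scl (- 1#) l φ) (-1*x≈-x _)

  private module A = RingKit A

  ιA : Hom K A
  ιA = record
    { ⟦_⟧ = λ k → (k , []) ∷ []
    ; ⟦⟧-cong = λ h φ → +-congʳ (*-congʳ h)
    ; ⟦⟧-+ = λ x y φ → solve 3 (λ x y p → (x :+ y) :* p :+ con (0 , 0) := x :* p :+ (y :* p :+ con (0 , 0))) refl x y (φ [])
    ; ⟦⟧-* = λ x y φ → sym (trans (∫-mul ((x , []) ∷ []) ((y , []) ∷ []) φ)
        (trans (+-congʳ (*-congˡ (+-congʳ (*-congˡ (⧢-[]ˡ [] φ)))))
          (solve 3 (λ x y p → x :* (y :* p :+ con (0 , 0)) :+ con (0 , 0) := (x :* y) :* p :+ con (0 , 0)) refl x y (φ []))))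
    ; ⟦⟧-1 = λ φ → refl
    }
  private
    module ιA = Hom ιA
    module SA = StarIdentity e F A ιA

  ∫-ι* : ∀ k l φ → ∫ (mul ιA.⟦ k ⟧ l) φ ≈ k * ∫ l φ
  ∫-ι* k l φ = trans (∫-mul ιA.⟦ k ⟧ l φ) (trans (+-identityʳ _) (*-congˡ (∫-cong l λ v → ⧢-[]ˡ v φ)))

  ∫-Aanti : ∀ N F φ → ∫ (A.anti N F) φ ≈ anti N (λ a b → ∫ (F a b) φ)
  ∫-Aanti zero    F φ = refl
  ∫-Aanti (suc N) F φ = trans (∫-++ (F 0 (suc N)) _ φ) (+-congˡ (∫-Aanti N _ φ))

  ∫-dia : ∀ a b H φ → ∫ (SA.dia a b H) φ ≈ ∫ (⋄ a b) (λ (n , m) → ∫ (H n m) φ)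
  ∫-dia a b H φ = trans (∫-++ (H (suc (a +ℕ b)) 0) _ φ) (trans (+-congˡ (trans (∫-Aanti (a +ℕ b) _ φ) (anti-cong (a +ℕ b) λ n m → ∫-ι* (γ a b m) (H n (suc m)) φ)))
    (sym (∫-⋄ a b _)))

  L : ℕ → Free Word
  L m = ret (letter m)

  L₂ : ℕ → ℕ → Free Word
  L₂ n m = ret (n ∷ letter m)

  private
    ∫-LL : ∀ i j φ → ∫ (mul (L i) (L j)) φ ≈ ∫ (letter i ⧢ letter j) φ
    ∫-LL i j φ = trans (∫-mul (L i) (L j) φ) (trans (∫-ret (letter i) (λ u → ∫ (L j) (λ v → ∫ (u ⧢ v) φ))) (∫-ret (letter j) (λ v → ∫ (letter i ⧢ v) φ)))

  L-pair : ∀ i j → mul (L i) (L j) A.≈ SA.Pair.pair (L 0) L₂ i j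
  L-pair zero    zero    φ = trans (∫-LL 0 0 φ) (trans (⧢-[]ˡ [] φ) (sym (∫-ret [] φ)))
  L-pair zero    (suc b) φ = trans (∫-LL 0 (suc b) φ) (trans (⧢-[]ˡ (b ∷ []) φ) (sym (∫-ret (b ∷ []) φ)))
  L-pair (suc a) zero    φ = trans (∫-LL (suc a) 0 φ) (trans (⧢-[]ʳ (a ∷ []) φ) (sym (∫-ret (a ∷ []) φ)))
  L-pair (suc a) (suc b) φ = trans (∫-LL (suc a) (suc b) φ) (trans (letters-⧢ a b φ) (sym (begin
    ∫ (L₂ a (suc b) ++ (L₂ b (suc a) ++ SA.dia a b L₂)) φ
      ≈⟨ trans (∫-++ (L₂ a (suc b)) (L₂ b (suc a) ++ SA.dia a b L₂) φ) (+-cong (∫-ret (a ∷ b ∷ []) φ) (trans (∫-++ (L₂ b (suc a)) (SA.dia a b L₂) φ) (+-cong (∫-ret (b ∷ a ∷ []) φ) (∫-dia a b L₂ φ)))) ⟩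
    φ (a ∷ b ∷ []) + (φ (b ∷ a ∷ []) + ∫ (⋄ a b) (λ (n , m) → ∫ (L₂ n m) φ))
      ≈⟨ +-congˡ (+-congˡ (∫-cong (⋄ a b) λ (n , m) → ∫-ret (n ∷ letter m) φ)) ⟩
    φ (a ∷ b ∷ []) + (φ (b ∷ a ∷ []) + ∫ (⋄ a b) (λ (n , m) → φ (n ∷ letter m))) ∎)))

  private
    module Ex = Exponential e F A ιA L L₂ (λ φ → refl) L-pair

  abstract
    -- B a k is the coefficient of u^a in E(u)^k, where E(u) = u / Σ_m x_m u^m over (q-1) ∣ m.
    B : ℕ → ℕ → Free Word
    B = Ex.B

    B-above : ∀ a k → a ℕ.< k → ∀ φ → ∫ (B a k) φ ≈ 0#
    B-above = Ex.B-above

    B-zero : ∀ φ → ∫ (B 0 0) φ ≈ φ []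
    B-zero φ = ∫-ret [] φ

    B-identity₁ : ∀ i a b φ → ∫ (⋄ a b) (λ (n , m) → ∫ (mul (B n i) (L m)) φ) ≈ ∫ (Ex.depth1 i a b) φ
    B-identity₁ i a b φ = trans (sym (∫-dia a b (λ n m → mul (B n i) (L m)) φ)) (Ex.depth1-identity i a b φ)

    depth1-zero : ∀ a b φ → ∫ (Ex.depth1 0 a b) φ ≈ 0#
    depth1-zero a b φ = refl

    depth1-suc : ∀ p a b φ → ∫ (Ex.depth1 (suc p) a b) φ ≈ anti p (λ k l → ∫ (mul (B a k) (B b l)) φ)
    depth1-suc p a b φ = ∫-Aanti p _ φ

    B-identity₂ : ∀ i j a b φ → anti (a +ℕ b) (λ n m → γ a b m * ∫ (mul (B n i) (B m j)) φ) ≈ anti (i +ℕ j) (λ k l → γ k l j * ∫ (mul (B a k) (B b l)) φ)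
    B-identity₂ i j a b φ = trans (sym (out (a +ℕ b) (λ n m → γ a b m) (λ n m → mul (B n i) (B m j)))) (trans (Ex.depth2-identity i j a b φ) (out (i +ℕ j) (λ k l → γ k l j) (λ k l → mul (B a k) (B b l))))
      where
      out : ∀ N (g : ℕ → ℕ → Carrier) (H : ℕ → ℕ → Free Word) → ∫ (A.anti N (λ n m → mul ιA.⟦ g n m ⟧ (H n m))) φ ≈ anti N (λ n m → g n m * ∫ (H n m) φ)
      out N g H = trans (∫-Aanti N _ φ) (anti-cong N λ n m → ∫-ι* (g n m) (H n m) φ)

  -- The coproduct in closed form, and its compatibility with the diamond product of letters.

  abstract
    -- Δ(x_{a+1}) - 1 ⊗ x_{a+1}; (k , w) stands for x_{k+1} ⊗ w.
    D₁ : ℕ → Free (ℕ × Word)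
    D₁ a = antiL a (λ k _ → mapF (k ,_) (B a k))

    ∫-D₁ : ∀ a g → ∫ (D₁ a) g ≈ sumTo a (λ k → ∫ (B a k) (λ w → g (k , w)))
    ∫-D₁ a g = trans (∫-antiL a _ g) (trans (anti-cong a λ k _ → ∫-map (k ,_) (B a k) g) (anti-fst a _))

    term : ℕ × Word → Word × Word → Free (Word × Word)
    term (k , β) (u , w) = mapF (k ∷ u ,_) (β ⧢ w)

    -- Single letters need no clause of their own, because `D []` is 1 ⊗ 1. The left factors of `D₁`
    -- are letters, so the triangle product is mere prefixing.
    D : Word → Free (Word × Word)
    D []      = ret ([] , [])
    D (a ∷ v) = ret ([] , a ∷ v) ++ bind (D₁ a) (λ kβ → bind (D v) (term kβ))

    ∫-D-[] : ∀ φ → ∫ (D []) φ ≈ φ ([] , [])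
    ∫-D-[] φ = ∫-ret ([] , []) φ

    ∫-D-∷ : ∀ a v φ → ∫ (D (a ∷ v)) φ ≈ φ ([] , a ∷ v) + ∫ (D₁ a) (λ (k , β) → ∫ (D v) (λ (u , w) → ∫ (β ⧢ w) (λ r → φ (k ∷ u , r))))
    ∫-D-∷ a v φ = trans (∫-++ (ret ([] , a ∷ v)) (bind (D₁ a) (λ kβ → bind (D v) (term kβ))) φ) (+-cong (∫-ret ([] , a ∷ v) φ)
      (trans (∫-bind (D₁ a) (λ kβ → bind (D v) (term kβ)) φ) (∫-cong (D₁ a) λ (k , β) →
        trans (∫-bind (D v) (term (k , β)) φ) (∫-cong (D v) λ (u , w) → ∫-map (k ∷ u ,_) (β ⧢ w) φ))))

  ∫-D-letter : ∀ a φ → ∫ (D (a ∷ [])) φ ≈ φ ([] , a ∷ []) + ∫ (D₁ a) (λ (k , β) → φ (k ∷ [] , β))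
  ∫-D-letter a φ = trans (∫-D-∷ a [] φ) (+-congˡ (∫-cong (D₁ a) λ (k , β) → trans (∫-D-[] _) (⧢-[]ʳ β _)))

  -- Values at Δ⁺(x_{a+1} ⋄ x_{b+1}) and at Δ⁺(x_{a+1}) ⋄ Δ⁺(x_{b+1}); g receives the first letter
  -- of the left factor, the rest of it, and the right factor.
  left-letter right-letter : ℕ → ℕ → (ℕ → Word → Word → Carrier) → Carrier
  left-letter a b g = ∫ (⋄ a b) (λ (k , m) → ∫ (D₁ k) (λ (k′ , β) → ∫ (D (letter m)) (λ (u , w) → ∫ (β ⧢ w) (g k′ u))))
  right-letter a b g = ∫ (D₁ a) (λ (k , β) → ∫ (D₁ b) (λ (l , β′) → ∫ (⋄ k l) (λ (k′ , m) → ∫ (β ⧢ β′) (g k′ (letter m)))))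

  private
    mul-0ˡ : ∀ a k l φ → a ℕ.< k → ∫ (mul (B a k) l) φ ≈ 0#
    mul-0ˡ a k l φ a<k = trans (∫-mul (B a k) l φ) (B-above a k a<k _)

    mul-0ʳ : ∀ b l m φ → b ℕ.< l → ∫ (mul m (B b l)) φ ≈ 0#
    mul-0ʳ b l m φ b<l = trans (∫-mul m (B b l) φ) (trans (∫-cong m λ u → B-above b l b<l _) (∫-0 m))

    -- The two independent exponents are sorted by their sum p = k + l, the quantity fixed in the
    -- identities for powers of E.
    D₁-D₁ : ∀ n m (ψ : ℕ → ℕ → Word → Carrier) → ∫ (D₁ n) (λ (k , β) → ∫ (D₁ m) (λ (l , β′) → ∫ (β ⧢ β′) (ψ k l)))
      ≈ sumTo (n +ℕ m) (λ p → anti p (λ k l → ∫ (mul (B n k) (B m l)) (ψ k l)))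
    D₁-D₁ n m ψ = begin
      ∫ (D₁ n) (λ (k , β) → ∫ (D₁ m) (λ (l , β′) → ∫ (β ⧢ β′) (ψ k l)))
        ≈⟨ trans (∫-D₁ n _) (sumTo-cong n λ k → trans (∫-cong (B n k) λ β → ∫-D₁ m _) (∫-sumTo (B n k) m _)) ⟩
      sumTo n (λ k → sumTo m (λ l → ∫ (B n k) (λ β → ∫ (B m l) (λ β′ → ∫ (β ⧢ β′) (ψ k l)))))
        ≈⟨ sumTo-cong n (λ k → sumTo-cong m λ l → sym (∫-mul (B n k) (B m l) (ψ k l))) ⟩
      sumTo n (λ k → sumTo m (λ l → ∫ (mul (B n k) (B m l)) (ψ k l)))
        ≈⟨ rectangle n m _ (λ k l n<k → mul-0ˡ n k (B m l) (ψ k l) n<k) (λ k l m<l → mul-0ʳ m l (B n k) (ψ k l) m<l) ⟩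
      sumTo (n +ℕ m) (λ p → anti p (λ k l → ∫ (mul (B n k) (B m l)) (ψ k l))) ∎

  module _ (a b : ℕ) (g : ℕ → Word → Word → Carrier) where
    private
      N : ℕ
      N = a +ℕ b

      -- the part of D (letter m) whose first tensor factor has depth 1
      upper : ℕ → ℕ → Carrier
      upper k zero    = 0#
      upper k (suc m) = ∫ (D₁ k) (λ (k′ , β) → ∫ (D₁ m) (λ (l , β′) → ∫ (β ⧢ β′) (g k′ (l ∷ []))))

      lower : ℕ → ℕ → Carrier
      lower k m = ∫ (D₁ k) (λ (k′ , β) → ∫ (β ⧢ letter m) (g k′ []))

      split : ∀ k m → ∫ (D₁ k) (λ (k′ , β) → ∫ (D (letter m)) (λ (u , w) → ∫ (β ⧢ w) (g k′ u))) ≈ lower k m + upper k m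
      split k zero    = trans (∫-cong (D₁ k) λ (k′ , β) → ∫-D-[] _) (sym (+-identityʳ _))
      split k (suc m) = trans (∫-cong (D₁ k) λ (k′ , β) → ∫-D-letter m _) (∫-+ (D₁ k) _ _)

      -- The range of i depends on the letter k; padding with the vanishing B k i for i > k makes it
      -- uniform, so that the sum can be moved outside `⋄`.
      lower-sum : ∀ k m → k ≤ suc N → lower k m ≈ sumTo (suc N) (λ i → ∫ (mul (B k i) (L m)) (g i []))
      lower-sum k m k≤ = begin
        lower k m
          ≈⟨ ∫-D₁ k _ ⟩
        sumTo k (λ i → ∫ (B k i) (λ β → ∫ (β ⧢ letter m) (g i [])))
          ≈⟨ sumTo-cong k (λ i → sym (trans (∫-mul (B k i) (L m) (g i [])) (∫-cong (B k i) λ u → ∫-ret (letter m) (λ v → ∫ (u ⧢ v) (g i []))))) ⟩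
        sumTo k (λ i → ∫ (mul (B k i) (L m)) (g i []))
          ≈⟨ sumTo-extend k (suc N ℕ.∸ k) _ (λ i k<i → mul-0ˡ k i (L m) (g i []) k<i) ⟨
        sumTo (k +ℕ (suc N ℕ.∸ k)) (λ i → ∫ (mul (B k i) (L m)) (g i []))
          ≈⟨ reflexive (≡.cong (λ n → sumTo n (λ i → ∫ (mul (B k i) (L m)) (g i []))) (ℕₚ.m+[n∸m]≡n k≤)) ⟩
        sumTo (suc N) (λ i → ∫ (mul (B k i) (L m)) (g i [])) ∎

      ⋄-cong : ∀ {φ ψ : ℕ × ℕ → Carrier} → (∀ k m → k ≤ suc N → φ (k , m) ≈ ψ (k , m)) → ∫ (⋄ a b) φ ≈ ∫ (⋄ a b) ψ
      ⋄-cong {φ} {ψ} h = trans (∫-⋄ a b φ) (trans (+-cong (h (suc N) 0 ℕₚ.≤-refl) (anti-cong′ N λ n m eq →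
        *-congˡ (h n (suc m) (ℕₚ.≤-trans (ℕₚ.≤-trans (ℕₚ.m≤m+n n m) (ℕₚ.≤-reflexive eq)) (ℕₚ.n≤1+n N))))) (sym (∫-⋄ a b ψ)))

      lower-part : ∫ (⋄ a b) (λ (k , m) → lower k m) ≈ sumTo N (λ p → anti p (λ k l → ∫ (mul (B a k) (B b l)) (g (suc p) [])))
      lower-part = begin
        ∫ (⋄ a b) (λ (k , m) → lower k m)
          ≈⟨ ⋄-cong lower-sum ⟩
        ∫ (⋄ a b) (λ (k , m) → sumTo (suc N) (λ i → ∫ (mul (B k i) (L m)) (g i [])))
          ≈⟨ ∫-sumTo (⋄ a b) (suc N) (λ (k , m) i → ∫ (mul (B k i) (L m)) (g i [])) ⟩
        sumTo (suc N) (λ i → ∫ (⋄ a b) (λ (k , m) → ∫ (mul (B k i) (L m)) (g i [])))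
          ≈⟨ sumTo-cong (suc N) (λ i → B-identity₁ i a b (g i [])) ⟩
        sumTo (suc N) (λ i → ∫ (Ex.depth1 i a b) (g i []))
          -- The difference quotient vanishes for i = 0, so the index continues as i = p + 1.
          ≈⟨ trans (+-congʳ (depth1-zero a b (g 0 []))) (+-identityˡ _) ⟩
        sumTo N (λ p → ∫ (Ex.depth1 (suc p) a b) (g (suc p) []))
          ≈⟨ sumTo-cong N (λ p → depth1-suc p a b (g (suc p) [])) ⟩
        sumTo N (λ p → anti p (λ k l → ∫ (mul (B a k) (B b l)) (g (suc p) []))) ∎

      U : ℕ → ℕ → Carrier
      U i j = anti (i +ℕ j) (λ k l → γ k l j * ∫ (mul (B a k) (B b l)) (g i (j ∷ [])))

      upper-part : ∫ (⋄ a b) (λ (k , m) → upper k m) ≈ sumTo N (λ p → anti p U)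
      upper-part = begin
        ∫ (⋄ a b) (λ (k , m) → upper k m)
          ≈⟨ trans (∫-⋄ a b _) (+-identityˡ _) ⟩
        anti N (λ n m → γ a b m * upper n (suc m))
          ≈⟨ anti-cong′ N (λ n m eq → *-congˡ (trans (D₁-D₁ n m (λ i j → g i (j ∷ []))) (reflexive (≡.cong (λ N → sumTo N (λ p → anti p (λ i j → ∫ (mul (B n i) (B m j)) (g i (j ∷ []))))) eq)))) ⟩
        anti N (λ n m → γ a b m * sumTo N (λ p → anti p (λ i j → ∫ (mul (B n i) (B m j)) (g i (j ∷ [])))))
          ≈⟨ anti-cong N (λ n m → trans (*-sumTo N (γ a b m) _) (sumTo-cong N λ p → anti-*ˡ p (γ a b m) _)) ⟩
        anti N (λ n m → sumTo N (λ p → anti p (λ i j → γ a b m * ∫ (mul (B n i) (B m j)) (g i (j ∷ [])))))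
          ≈⟨ anti-sumTo N N _ ⟩
        sumTo N (λ p → anti N (λ n m → anti p (λ i j → γ a b m * ∫ (mul (B n i) (B m j)) (g i (j ∷ [])))))
          ≈⟨ sumTo-cong N (λ p → anti-swap N p (λ n m i j → γ a b m * ∫ (mul (B n i) (B m j)) (g i (j ∷ [])))) ⟩
        sumTo N (λ p → anti p (λ i j → anti N (λ n m → γ a b m * ∫ (mul (B n i) (B m j)) (g i (j ∷ [])))))
          ≈⟨ sumTo-cong N (λ p → anti-cong p λ i j → B-identity₂ i j a b (g i (j ∷ []))) ⟩
        sumTo N (λ p → anti p U) ∎
        where
        *-sumTo : ∀ N x f → x * sumTo N f ≈ sumTo N (λ k → x * f k)
        *-sumTo zero    x f = refl
        *-sumTo (suc N) x f = trans (distribˡ _ _ _) (+-congˡ (*-sumTo N x _))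
        anti-sumTo : ∀ N M (f : ℕ → ℕ → ℕ → Carrier) → anti N (λ n m → sumTo M (f n m)) ≈ sumTo M (λ p → anti N (λ n m → f n m p))
        anti-sumTo N zero    f = refl
        anti-sumTo N (suc M) f = trans (anti-+ N (λ n m → f n m 0) _) (+-congˡ (anti-sumTo N M (λ n m k → f n m (suc k))))

      right-sum : right-letter a b g ≈ sumTo N (λ p → anti p (λ k l → ∫ (mul (B a k) (B b l)) (λ y → ∫ (⋄ k l) (λ (k′ , m) → g k′ (letter m) y))))
      right-sum = trans (∫-cong (D₁ a) λ (k , β) → ∫-cong (D₁ b) λ (l , β′) → ∫-swap (⋄ k l) (β ⧢ β′) _) (D₁-D₁ a b (λ k l y → ∫ (⋄ k l) (λ (k′ , m) → g k′ (letter m) y)))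

      right-term : ∀ p k l → k +ℕ l ≡ p → ∫ (mul (B a k) (B b l)) (λ y → ∫ (⋄ k l) (λ (k′ , m) → g k′ (letter m) y))
        ≈ ∫ (mul (B a k) (B b l)) (g (suc p) []) + anti p (λ i j → γ k l j * ∫ (mul (B a k) (B b l)) (g i (j ∷ [])))
      right-term p k l ≡.refl = trans (∫-cong M λ y → ∫-⋄ k l _) (trans (∫-+ M _ _) (+-congˡ (trans (∫-anti M p _) (anti-cong p λ i j → ∫-* M (γ k l j) _))))
        where
        M : Free Word
        M = mul (B a k) (B b l)

    -- Sorted by the depth of the left tensor factor: `B-identity₁` handles depth 1 and
    -- `B-identity₂` depth 2, matching the two kinds of terms in `⋄ k l` on the right.
    letter-identity : left-letter a b g ≈ right-letter a b g
    letter-identity = begin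
      left-letter a b g
        ≈⟨ trans (∫-cong (⋄ a b) λ (k , m) → split k m) (∫-+ (⋄ a b) _ _) ⟩
      ∫ (⋄ a b) (λ (k , m) → lower k m) + ∫ (⋄ a b) (λ (k , m) → upper k m)
        ≈⟨ +-cong lower-part upper-part ⟩
      sumTo N (λ p → anti p (λ k l → ∫ (mul (B a k) (B b l)) (g (suc p) []))) + sumTo N (λ p → anti p U)
        ≈⟨ +-congˡ (sumTo-cong N λ p → trans (anti-cong′ p λ { i j ≡.refl → refl }) (anti-swap p p (λ i j k l → γ k l j * ∫ (mul (B a k) (B b l)) (g i (j ∷ []))))) ⟩
      sumTo N (λ p → anti p (λ k l → ∫ (mul (B a k) (B b l)) (g (suc p) []))) + sumTo N (λ p → anti p (λ k l → anti p (λ i j → γ k l j * ∫ (mul (B a k) (B b l)) (g i (j ∷ [])))))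
        ≈⟨ trans (sumTo-cong N λ p → anti-+ p _ _) (sumTo-+ N _ _) ⟨
      sumTo N (λ p → anti p (λ k l → ∫ (mul (B a k) (B b l)) (g (suc p) []) + anti p (λ i j → γ k l j * ∫ (mul (B a k) (B b l)) (g i (j ∷ [])))))
        ≈⟨ trans right-sum (sumTo-cong N λ p → anti-cong′ p λ k l → right-term p k l) ⟨
      right-letter a b g ∎

-- Multiplicativity of the closed form.

module Multiplicative {c ℓ : Level} (e : ℕ) (F : FiniteField c ℓ (suc (suc e))) where
  open FieldFacts e F using (K)
  open Words e F
  open Assoc e F using (⧢-assoc)
  open ShuffleAlgebra e F using (D; D₁; ∫-D-[]; ∫-D-∷; left-letter; letter-identity)
  open RingKit K

  ⊛ : Free (Word × Word) → Free (Word × Word) → (Word × Word → Carrier) → Carrier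
  ⊛ X Y φ = ∫ X (λ (u , v) → ∫ Y (λ (u′ , v′) → ∫ (u ⧢ u′) (λ p → ∫ (v ⧢ v′) (λ r → φ (p , r)))))

  ⧢-left-comm : ∀ a b c ψ → ∫ (b ⧢ c) (λ r → ∫ (a ⧢ r) ψ) ≈ ∫ (a ⧢ c) (λ r → ∫ (b ⧢ r) ψ)
  ⧢-left-comm a b c ψ = trans (sym (⧢-assoc a b c ψ)) (trans (⧢-comm a b _) (⧢-assoc b a c ψ))

  ⧢-medial : ∀ a b c d ψ → ∫ (a ⧢ b) (λ u → ∫ (c ⧢ d) (λ v → ∫ (u ⧢ v) ψ)) ≈ ∫ (a ⧢ c) (λ u → ∫ (b ⧢ d) (λ v → ∫ (u ⧢ v) ψ))
  ⧢-medial a b c d ψ = begin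
    ∫ (a ⧢ b) (λ u → ∫ (c ⧢ d) (λ v → ∫ (u ⧢ v) ψ))   ≈⟨ ∫-swap (a ⧢ b) (c ⧢ d) _ ⟩
    ∫ (c ⧢ d) (λ v → ∫ (a ⧢ b) (λ u → ∫ (u ⧢ v) ψ))   ≈⟨ ∫-cong (c ⧢ d) (λ v → ⧢-assoc a b v ψ) ⟩
    ∫ (c ⧢ d) (λ v → ∫ (b ⧢ v) (λ w → ∫ (a ⧢ w) ψ))   ≈⟨ ⧢-left-comm b c d _ ⟩
    ∫ (b ⧢ d) (λ v → ∫ (c ⧢ v) (λ w → ∫ (a ⧢ w) ψ))   ≈⟨ ∫-cong (b ⧢ d) (λ v → ⧢-assoc a c v ψ) ⟨
    ∫ (b ⧢ d) (λ v → ∫ (a ⧢ c) (λ u → ∫ (u ⧢ v) ψ))   ≈⟨ ∫-swap (b ⧢ d) (a ⧢ c) _ ⟩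
    ∫ (a ⧢ c) (λ u → ∫ (b ⧢ d) (λ v → ∫ (u ⧢ v) ψ))   ∎

  -- x_{k+1} ⊗ β acting on C ⊗ C
  graft : (Word × Word → Carrier) → ℕ × Word → Word × Word → Carrier
  graft φ (k , β) (u , v) = ∫ (β ⧢ v) (λ r → φ (k ∷ u , r))

  D-∷ : ∀ a v φ → ∫ (D (a ∷ v)) φ ≈ φ ([] , a ∷ v) + ∫ (D₁ a) (λ kβ → ∫ (D v) (graft φ kβ))
  D-∷ = ∫-D-∷

  private
    Mult : ℕ → Set (c Level.⊔ ℓ)
    Mult N = ∀ a b φ → length a +ℕ length b ≤ N → ∫ (a ⧢ b) (λ w → ∫ (D w) φ) ≈ ⊛ (D a) (D b) φ

    module Step (N : ℕ) (ih : Mult N) (a : ℕ) (as : Word) (b : ℕ) (bs : Word) (bound : length as +ℕ suc (length bs) ≤ N) (φ : Word × Word → Carrier) where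
      A B : Word
      A = a ∷ as
      B = b ∷ bs

      lower : Carrier
      lower = ∫ (A ⧢ B) (λ w → φ ([] , w))

      -- The three terms of the recursion for A ⧢ B, with Δ⁺ applied to the new first letter and the
      -- induction hypothesis to what follows; `lower` gathers all 1 ⊗ w.
      m₁ m₂ m₃ : Carrier
      m₁ = ∫ (D₁ a) (λ kβ → ⊛ (D as) (D B) (graft φ kβ))
      m₂ = ∫ (D₁ b) (λ kβ → ⊛ (D A) (D bs) (graft φ kβ))
      m₃ = ⊛ (D as) (D bs) (λ (w , s) → left-letter a b (λ k z y → ∫ (z ⧢ w) (λ p → ∫ (y ⧢ s) (λ r → φ (k ∷ p , r)))))

      bound-A-bs : length A +ℕ length bs ≤ N
      bound-A-bs = ℕₚ.≤-trans (ℕₚ.≤-reflexive (≡.sym (ℕₚ.+-suc (length as) (length bs)))) bound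

      l₃ : Carrier
      l₃ = ∫ (as ⧢ bs) (λ w → ∫ (⋄ a b) (λ (k , m) → ∫ (letter m ⧢ w) (λ w′ → ∫ (D₁ k) (λ kβ → ∫ (D w′) (graft φ kβ)))))

      -- The induction hypothesis acts twice: on the leftover letter x_m against w, and, once
      -- everything about letters is isolated in `left-letter`, on as against bs.
      l₃≈m₃ : l₃ ≈ m₃
      l₃≈m₃ = begin
        l₃
          ≈⟨ ⧢-cong′ as bs (λ w lw → ∫-cong (⋄ a b) λ (k , m) → trans (∫-swap (letter m ⧢ w) (D₁ k) _) (∫-cong (D₁ k) λ kβ → ih (letter m) w (graft φ kβ)
               (ℕₚ.≤-trans (ℕₚ.+-mono-≤ (length-letter m) lw) bound-A-bs))) ⟩
        ∫ (as ⧢ bs) (λ w → ∫ (⋄ a b) (λ (k , m) → ∫ (D₁ k) (λ kβ → ⊛ (D (letter m)) (D w) (graft φ kβ))))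
          ≈⟨ ∫-cong (as ⧢ bs) (λ w → ∫-cong (⋄ a b) λ (k , m) → ∫-cong (D₁ k) λ (k′ , β) → trans
               (∫-cong (D (letter m)) λ (u , v) → ∫-cong (D w) λ (u′ , v′) → trans (∫-cong (u ⧢ u′) λ p → sym (⧢-assoc β v v′ _)) (∫-swap (u ⧢ u′) (β ⧢ v) _))
               (∫-cong (D (letter m)) λ (u , v) → ∫-swap (D w) (β ⧢ v) _)) ⟩
        ∫ (as ⧢ bs) (λ w → ∫ (⋄ a b) (λ (k , m) → ∫ (D₁ k) (λ (k′ , β) → ∫ (D (letter m)) (λ (u , v) → ∫ (β ⧢ v) (λ y → ∫ (D w) (λ (u′ , v′) → body k′ u y u′ v′))))))
          ≈⟨ ∫-cong (as ⧢ bs) (λ w → trans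
               (∫-cong (⋄ a b) λ (k , m) → trans (∫-cong (D₁ k) λ (k′ , β) → trans (∫-cong (D (letter m)) λ (u , v) → ∫-swap (β ⧢ v) (D w) _)
                 (∫-swap (D (letter m)) (D w) _)) (∫-swap (D₁ k) (D w) _))
               (∫-swap (⋄ a b) (D w) _)) ⟩
        ∫ (as ⧢ bs) (λ w → ∫ (D w) (λ (u′ , v′) → left-letter a b (λ k′ u y → body k′ u y u′ v′)))
          ≈⟨ ih as bs _ (ℕₚ.≤-trans (ℕₚ.+-monoʳ-≤ (length as) (ℕₚ.n≤1+n _)) bound) ⟩
        m₃ ∎
        where
        body : ℕ → Word → Word → Word → Word → Carrier
        body k z y w s = ∫ (z ⧢ w) (λ p → ∫ (y ⧢ s) (λ r → φ (k ∷ p , r)))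

      D-part : ℕ → Word → Carrier
      D-part x w = ∫ (D₁ x) (λ kβ → ∫ (D w) (graft φ kβ))

      left-side : ∫ (A ⧢ B) (λ w → ∫ (D w) φ) ≈ lower + (m₁ + (m₂ + m₃))
      left-side = begin
        ∫ (A ⧢ B) (λ w → ∫ (D w) φ)
          ≈⟨ ⧢-∷ a as b bs (λ w → ∫ (D w) φ) ⟩
        ∫ (as ⧢ B) (λ w → ∫ (D (a ∷ w)) φ) + (∫ (A ⧢ bs) (λ w → ∫ (D (b ∷ w)) φ) + ∫ (as ⧢ bs) (λ w → ∫ (⋄ a b) (λ (k , m) → ∫ (letter m ⧢ w) (λ w′ → ∫ (D (k ∷ w′)) φ))))
          ≈⟨ +-cong (trans (∫-cong (as ⧢ B) λ w → D-∷ a w φ) (∫-+ (as ⧢ B) _ _)) (+-cong (trans (∫-cong (A ⧢ bs) λ w → D-∷ b w φ) (∫-+ (A ⧢ bs) _ _))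
               (trans (∫-cong (as ⧢ bs) λ w → trans (∫-cong (⋄ a b) λ (k , m) → trans (∫-cong (letter m ⧢ w) λ w′ → D-∷ k w′ φ) (∫-+ (letter m ⧢ w) _ _)) (∫-+ (⋄ a b) _ _)) (∫-+ (as ⧢ bs) _ _))) ⟩
        (c₁ + ∫ (as ⧢ B) (D-part a)) + ((c₂ + ∫ (A ⧢ bs) (D-part b)) + (c₃ + l₃))
          ≈⟨ solve 6 (λ c₁ x c₂ y c₃ z → (c₁ :+ x) :+ ((c₂ :+ y) :+ (c₃ :+ z)) := (c₁ :+ (c₂ :+ c₃)) :+ (x :+ (y :+ z))) refl c₁ _ c₂ _ c₃ _ ⟩
        (c₁ + (c₂ + c₃)) + (∫ (as ⧢ B) (D-part a) + (∫ (A ⧢ bs) (D-part b) + l₃))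
          ≈⟨ +-cong (sym (⧢-∷ a as b bs (λ w → φ ([] , w)))) (+-cong (trans (∫-swap (as ⧢ B) (D₁ a) _) (∫-cong (D₁ a) λ kβ → ih as B (graft φ kβ) bound))
               (+-cong (trans (∫-swap (A ⧢ bs) (D₁ b) _) (∫-cong (D₁ b) λ kβ → ih A bs (graft φ kβ) bound-A-bs)) l₃≈m₃)) ⟩
        lower + (m₁ + (m₂ + m₃)) ∎
        where
        c₁ c₂ c₃ : Carrier
        c₁ = ∫ (as ⧢ B) (λ w → φ ([] , a ∷ w))
        c₂ = ∫ (A ⧢ bs) (λ w → φ ([] , b ∷ w))
        c₃ = ∫ (as ⧢ bs) (λ w → ∫ (⋄ a b) (λ (k , m) → ∫ (letter m ⧢ w) (λ w′ → φ ([] , k ∷ w′))))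

      overA : (ℕ → Word → Word → Carrier) → Carrier
      overA f = ∫ (D₁ a) (λ (k , β) → ∫ (D as) (λ (u , v) → ∫ (β ⧢ v) (λ v₁ → f k u v₁)))

      overB : (ℕ → Word → Word → Carrier) → Carrier
      overB f = ∫ (D₁ b) (λ (k , β) → ∫ (D bs) (λ (u , v) → ∫ (β ⧢ v) (λ v₁ → f k u v₁)))

      overA-cong : ∀ {f g} → (∀ k u v → f k u v ≈ g k u v) → overA f ≈ overA g
      overA-cong h = ∫-cong (D₁ a) λ (k , β) → ∫-cong (D as) λ (u , v) → ∫-cong (β ⧢ v) λ v₁ → h k u v₁

      overB-cong : ∀ {f g} → (∀ k u v → f k u v ≈ g k u v) → overB f ≈ overB g
      overB-cong h = ∫-cong (D₁ b) λ (k , β) → ∫-cong (D bs) λ (u , v) → ∫-cong (β ⧢ v) λ v₁ → h k u v₁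

      overA-+ : ∀ f g → overA (λ k u v → f k u v + g k u v) ≈ overA f + overA g
      overA-+ f g = trans (∫-cong (D₁ a) λ (k , β) → trans (∫-cong (D as) λ (u , v) → ∫-+ (β ⧢ v) _ _) (∫-+ (D as) _ _)) (∫-+ (D₁ a) _ _)

      overB-+ : ∀ f g → overB (λ k u v → f k u v + g k u v) ≈ overB f + overB g
      overB-+ f g = trans (∫-cong (D₁ b) λ (k , β) → trans (∫-cong (D bs) λ (u , v) → ∫-+ (β ⧢ v) _ _) (∫-+ (D bs) _ _)) (∫-+ (D₁ b) _ _)

      -- In `x₁` and `x₂` one of the two coproducts contributes its term 1 ⊗ B or 1 ⊗ A. In the y's
      -- both contribute Δ⁺, and the shuffle of the left factors is expanded by its recursion.
      x₁ x₂ : Carrier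
      x₁ = overA (λ k u v₁ → ∫ (v₁ ⧢ B) (λ r → φ (k ∷ u , r)))
      x₂ = overB (λ k u v₂ → ∫ (A ⧢ v₂) (λ r → φ (k ∷ u , r)))

      y₁ y₂ y₃ : Carrier
      y₁ = overA (λ k u v₁ → overB (λ k′ u′ v₂ → ∫ (u ⧢ (k′ ∷ u′)) (λ p → ∫ (v₁ ⧢ v₂) (λ r → φ (k ∷ p , r)))))
      y₂ = overA (λ k u v₁ → overB (λ k′ u′ v₂ → ∫ ((k ∷ u) ⧢ u′) (λ p → ∫ (v₁ ⧢ v₂) (λ r → φ (k′ ∷ p , r)))))
      y₃ = overA (λ k u v₁ → overB (λ k′ u′ v₂ → ∫ (u ⧢ u′) (λ w → ∫ (⋄ k k′) (λ (k″ , m) → ∫ (letter m ⧢ w) (λ p → ∫ (v₁ ⧢ v₂) (λ r → φ (k″ ∷ p , r)))))))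

      D-B : ∀ ψ → ∫ (D B) ψ ≈ ψ ([] , B) + overB (λ k u v → ψ (k ∷ u , v))
      D-B ψ = D-∷ b bs ψ

      D-A : ∀ ψ → ∫ (D A) ψ ≈ ψ ([] , A) + overA (λ k u v → ψ (k ∷ u , v))
      D-A ψ = D-∷ a as ψ

      right-side : ⊛ (D A) (D B) φ ≈ (lower + x₂) + (x₁ + (y₁ + (y₂ + y₃)))
      right-side = begin
        ⊛ (D A) (D B) φ
          ≈⟨ D-A _ ⟩
        ∫ (D B) (λ (u′ , v′) → ∫ ([] ⧢ u′) (λ p → ∫ (A ⧢ v′) (λ r → φ (p , r))))
          + overA (λ k u v → ∫ (D B) (λ (u′ , v′) → ∫ ((k ∷ u) ⧢ u′) (λ p → ∫ (v ⧢ v′) (λ r → φ (p , r)))))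
          ≈⟨ +-cong (trans (∫-cong (D B) λ (u′ , v′) → ⧢-[]ˡ u′ _) (D-B _))
               (trans (overA-cong λ k u v → trans (D-B _) (+-cong (⧢-[]ʳ (k ∷ u) _) (trans (overB-cong λ k′ u′ v₂ → ⧢-∷ k u k′ u′ _) (trans (overB-+ _ _) (+-congˡ (overB-+ _ _))))))
                 (trans (overA-+ _ _) (+-congˡ (trans (overA-+ _ _) (+-congˡ (overA-+ _ _)))))) ⟩
        (lower + x₂) + (x₁ + (y₁ + (y₂ + y₃))) ∎

      -- Associativity brings β to v; the term 1 ⊗ B of the coproduct of B then gives `x₁`, and the
      -- remainder `y₁`.
      m₁-split : m₁ ≈ x₁ + y₁
      m₁-split = begin
        m₁
          ≈⟨ ∫-cong (D₁ a) (λ (k , β) → ∫-cong (D as) λ (u , v) → trans (∫-cong (D B) λ (u′ , v′) → trans (∫-cong (u ⧢ u′) λ p → sym (⧢-assoc β v v′ _)) (∫-swap (u ⧢ u′) (β ⧢ v) _)) (∫-swap (D B) (β ⧢ v) _)) ⟩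
        overA (λ k u v₁ → ∫ (D B) (λ (u′ , v′) → ∫ (u ⧢ u′) (λ p → ∫ (v₁ ⧢ v′) (λ r → φ (k ∷ p , r)))))
          ≈⟨ trans (overA-cong λ k u v₁ → trans (D-B _) (+-congʳ (⧢-[]ʳ u _))) (overA-+ _ _) ⟩
        x₁ + y₁ ∎

      m₂-split : m₂ ≈ x₂ + y₂
      m₂-split = begin
        m₂
          ≈⟨ ∫-cong (D₁ b) (λ (k , β) → trans (∫-cong (D A) λ (u , v) → ∫-cong (D bs) λ (u′ , v′) → trans (∫-cong (u ⧢ u′) λ p → ⧢-left-comm β v v′ _) (∫-swap (u ⧢ u′) (β ⧢ v′) _))
               (∫-swap (D A) (D bs) _)) ⟩
        ∫ (D₁ b) (λ (k , β) → ∫ (D bs) (λ (u′ , v′) → ∫ (D A) (λ (u , v) → ∫ (β ⧢ v′) (λ v₂ → ∫ (u ⧢ u′) (λ p → ∫ (v ⧢ v₂) (λ r → φ (k ∷ p , r)))))))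
          ≈⟨ ∫-cong (D₁ b) (λ (k , β) → ∫-cong (D bs) λ (u′ , v′) → ∫-swap (D A) (β ⧢ v′) _) ⟩
        overB (λ k u′ v₂ → ∫ (D A) (λ (u , v) → ∫ (u ⧢ u′) (λ p → ∫ (v ⧢ v₂) (λ r → φ (k ∷ p , r)))))
          ≈⟨ trans (overB-cong λ k u′ v₂ → trans (D-A _) (+-congʳ (⧢-[]ˡ u′ _))) (overB-+ _ _) ⟩
        x₂ + overB (λ k′ u′ v₂ → overA (λ k u v₁ → ∫ ((k ∷ u) ⧢ u′) (λ p → ∫ (v₁ ⧢ v₂) (λ r → φ (k′ ∷ p , r)))))
          ≈⟨ +-congˡ (over-swap λ k′ u′ v₂ k u v₁ → ∫ ((k ∷ u) ⧢ u′) (λ p → ∫ (v₁ ⧢ v₂) (λ r → φ (k′ ∷ p , r)))) ⟩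
        x₂ + y₂ ∎
        where
        overA-∫ : ∀ {x} {X : Set x} (l : Free X) (f : X → ℕ → Word → Word → Carrier) → ∫ l (λ i → overA (f i)) ≈ overA (λ k u v → ∫ l (λ i → f i k u v))
        overA-∫ l f = trans (∫-swap l (D₁ a) _) (∫-cong (D₁ a) λ (k , β) → trans (∫-swap l (D as) _) (∫-cong (D as) λ (u , v) → ∫-swap l (β ⧢ v) _))
        over-swap : ∀ (f : ℕ → Word → Word → ℕ → Word → Word → Carrier) → overB (λ k′ u′ v₂ → overA (f k′ u′ v₂)) ≈ overA (λ k u v₁ → overB (λ k′ u′ v₂ → f k′ u′ v₂ k u v₁))
        over-swap f = trans (∫-cong (D₁ b) λ (k′ , β′) → trans (∫-cong (D bs) λ (u′ , v′) → overA-∫ (β′ ⧢ v′) (λ v₂ → f k′ u′ v₂)) (overA-∫ (D bs) _)) (overA-∫ (D₁ b) _)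

      -- `letter-identity` enters here; what follows is exchange of finite sums and the medial law
      -- for the right tensor factors.
      m₃-split : m₃ ≈ y₃
      m₃-split = begin
        m₃
          ≈⟨ ∫-cong (D as) (λ (u , v) → ∫-cong (D bs) λ (u′ , v′) → ∫-cong (u ⧢ u′) λ w → ∫-cong (v ⧢ v′) λ s → letter-identity a b _) ⟩
        ∫ (D as) (λ (u , v) → ∫ (D bs) (λ (u′ , v′) → ∫ (u ⧢ u′) (λ w → ∫ (v ⧢ v′) (λ s → ∫ (D₁ a) (λ (k , β) → ∫ (D₁ b) (λ (k′ , β′) → ∫ (⋄ k k′) (λ (k″ , m) → ∫ (β ⧢ β′) (λ y → Y k″ m w y s))))))))
          ≈⟨ trans (∫-cong (D as) λ (u , v) → trans (∫-cong (D bs) λ (u′ , v′) → trans (∫-cong (u ⧢ u′) λ w → ∫-swap (v ⧢ v′) (D₁ a) _) (∫-swap (u ⧢ u′) (D₁ a) _)) (∫-swap (D bs) (D₁ a) _)) (∫-swap (D as) (D₁ a) _) ⟩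
        ∫ (D₁ a) (λ (k , β) → ∫ (D as) (λ (u , v) → ∫ (D bs) (λ (u′ , v′) → ∫ (u ⧢ u′) (λ w → ∫ (v ⧢ v′) (λ s → ∫ (D₁ b) (λ (k′ , β′) → ∫ (⋄ k k′) (λ (k″ , m) → ∫ (β ⧢ β′) (λ y → Y k″ m w y s))))))))
          ≈⟨ ∫-cong (D₁ a) (λ (k , β) → ∫-cong (D as) λ (u , v) → trans (∫-cong (D bs) λ (u′ , v′) → trans (∫-cong (u ⧢ u′) λ w → ∫-swap (v ⧢ v′) (D₁ b) _) (∫-swap (u ⧢ u′) (D₁ b) _)) (∫-swap (D bs) (D₁ b) _)) ⟩
        ∫ (D₁ a) (λ (k , β) → ∫ (D as) (λ (u , v) → ∫ (D₁ b) (λ (k′ , β′) → ∫ (D bs) (λ (u′ , v′) → ∫ (u ⧢ u′) (λ w → ∫ (v ⧢ v′) (λ s → ∫ (⋄ k k′) (λ (k″ , m) → ∫ (β ⧢ β′) (λ y → Y k″ m w y s))))))))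
          ≈⟨ ∫-cong (D₁ a) (λ (k , β) → ∫-cong (D as) λ (u , v) → ∫-cong (D₁ b) λ (k′ , β′) → ∫-cong (D bs) λ (u′ , v′) → ∫-cong (u ⧢ u′) λ w → inner β v β′ v′ (⋄ k k′) w) ⟩
        ∫ (D₁ a) (λ (k , β) → ∫ (D as) (λ (u , v) → ∫ (D₁ b) (λ (k′ , β′) → ∫ (D bs) (λ (u′ , v′) → ∫ (u ⧢ u′) (λ w → ∫ (β ⧢ v) (λ v₁ → ∫ (β′ ⧢ v′) (λ v₂ → ∫ (⋄ k k′) (λ (k″ , m) → Y k″ m w v₁ v₂))))))))
          ≈⟨ ∫-cong (D₁ a) (λ (k , β) → ∫-cong (D as) λ (u , v) → trans
               (∫-cong (D₁ b) λ (k′ , β′) → trans (∫-cong (D bs) λ (u′ , v′) → trans (∫-swap (u ⧢ u′) (β ⧢ v) _) (∫-cong (β ⧢ v) λ v₁ → ∫-swap (u ⧢ u′) (β′ ⧢ v′) _))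
                 (∫-swap (D bs) (β ⧢ v) _))
               (∫-swap (D₁ b) (β ⧢ v) _)) ⟩
        y₃ ∎
        where
        Y : ℕ → ℕ → Word → Word → Word → Carrier
        Y k m w y s = ∫ (letter m ⧢ w) (λ p → ∫ (y ⧢ s) (λ r → φ (k ∷ p , r)))

        inner : ∀ β v β′ v′ (l : Free (ℕ × ℕ)) w → ∫ (v ⧢ v′) (λ s → ∫ l (λ (k , m) → ∫ (β ⧢ β′) (λ y → Y k m w y s))) ≈ ∫ (β ⧢ v) (λ v₁ → ∫ (β′ ⧢ v′) (λ v₂ → ∫ l (λ (k , m) → Y k m w v₁ v₂)))
        inner β v β′ v′ l w = begin
          ∫ (v ⧢ v′) (λ s → ∫ l (λ (k , m) → ∫ (β ⧢ β′) (λ y → Y k m w y s)))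
            ≈⟨ trans (∫-swap (v ⧢ v′) l _) (∫-cong l λ (k , m) → trans (∫-cong (v ⧢ v′) λ s → ∫-swap (β ⧢ β′) (letter m ⧢ w) _) (trans (∫-swap (v ⧢ v′) (letter m ⧢ w) _)
                 (∫-cong (letter m ⧢ w) λ p → trans (∫-swap (v ⧢ v′) (β ⧢ β′) _) (⧢-medial β β′ v v′ _)))) ⟩
          ∫ l (λ (k , m) → ∫ (letter m ⧢ w) (λ p → ∫ (β ⧢ v) (λ v₁ → ∫ (β′ ⧢ v′) (λ v₂ → ∫ (v₁ ⧢ v₂) (λ r → φ (k ∷ p , r))))))
            ≈⟨ ∫-cong l (λ (k , m) → trans (∫-swap (letter m ⧢ w) (β ⧢ v) _) (∫-cong (β ⧢ v) λ v₁ → ∫-swap (letter m ⧢ w) (β′ ⧢ v′) _)) ⟩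
          ∫ l (λ (k , m) → ∫ (β ⧢ v) (λ v₁ → ∫ (β′ ⧢ v′) (λ v₂ → Y k m w v₁ v₂)))
            ≈⟨ trans (∫-swap l (β ⧢ v) _) (∫-cong (β ⧢ v) λ v₁ → ∫-swap l (β′ ⧢ v′) _) ⟩
          ∫ (β ⧢ v) (λ v₁ → ∫ (β′ ⧢ v′) (λ v₂ → ∫ l (λ (k , m) → Y k m w v₁ v₂))) ∎

      step : ∫ (A ⧢ B) (λ w → ∫ (D w) φ) ≈ ⊛ (D A) (D B) φ
      step = begin
        ∫ (A ⧢ B) (λ w → ∫ (D w) φ)
          ≈⟨ left-side ⟩
        lower + (m₁ + (m₂ + m₃))
          ≈⟨ +-congˡ (+-cong m₁-split (+-cong m₂-split m₃-split)) ⟩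
        lower + ((x₁ + y₁) + ((x₂ + y₂) + y₃))
          ≈⟨ solve 6 (λ l x₁ y₁ x₂ y₂ y₃ → l :+ ((x₁ :+ y₁) :+ ((x₂ :+ y₂) :+ y₃)) := (l :+ x₂) :+ (x₁ :+ (y₁ :+ (y₂ :+ y₃)))) refl lower x₁ y₁ x₂ y₂ y₃ ⟩
        (lower + x₂) + (x₁ + (y₁ + (y₂ + y₃)))
          ≈⟨ right-side ⟨
        ⊛ (D A) (D B) φ ∎

    multiplicative′ : ∀ N → Mult N
    multiplicative′ N [] b φ _ = trans (⧢-[]ˡ b _) (sym (trans (∫-D-[] _) (∫-cong (D b) λ (u , v) → trans (⧢-[]ˡ u _) (⧢-[]ˡ v _))))
    multiplicative′ N A@(_ ∷ _) [] φ _ = trans (⧢-[]ʳ A _) (sym (∫-cong (D A) λ (u , v) → trans (∫-D-[] _) (trans (⧢-[]ʳ u _) (⧢-[]ʳ v _))))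
    multiplicative′ (suc N) (a ∷ as) (b ∷ bs) φ (s≤s h) = Step.step N (multiplicative′ N) a as b bs h φ

  multiplicative : ∀ a b φ → ∫ (a ⧢ b) (λ w → ∫ (D w) φ) ≈ ⊛ (D a) (D b) φ
  multiplicative a b φ = multiplicative′ (length a +ℕ length b) a b φ ℕₚ.≤-refl

-- Comparison with the recursively defined shuffle product and coproduct.

module Transfer {c ℓ : Level} (e : ℕ) (F : FiniteField c ℓ (suc (suc e))) where
  open FieldFacts e F using (K; d; q; χ-yes; χ-no)
  open Gamma e F using (γ; sign)
  open Words e F
  open ShuffleAlgebra e F using (D; D₁; ∫-D-[]; ∫-D-∷; ∫-D-letter; ∫-D₁; B-zero)
  open Multiplicative e F using (⊛; multiplicative)
  open RingKit K
  private
    module C = Coalg K q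

  alt-sign : ∀ k x → C.alt k x ≈ sign k * x
  alt-sign zero    x = sym (*-identityˡ x)
  alt-sign (suc k) x = trans (-‿cong (alt-sign k x)) (solve 2 (λ s x → :- (s :* x) := (:- con (1 , 0) :* s) :* x) refl (sign k) x)

  natR-≡ : ∀ n → C.natR n ≡ natR n
  natR-≡ zero    = ≡.refl
  natR-≡ (suc n) = ≡.cong (1# +_) (natR-≡ n)

  -- For j = m + 1 the hypothesis is exactly the range condition on j, so the divisibility test
  -- alone decides.
  Δc-γ : ∀ a b m → m ≤ a +ℕ b → C.Δc (suc a) (suc b) (suc m) ≈ γ a b m
  Δc-γ a b m m≤ with d ∣? suc m
  ... | yes h = trans (reflexive (≡.cong₂ (λ x y → if x ∧ true ∧ y then body else 0#) (dec-true (d ∣? suc m) h) (dec-true (suc m ℕₚ.<? suc a +ℕ suc b) (s≤s (ℕₚ.≤-<-trans m≤ (ℕₚ.+-monoʳ-< a (ℕₚ.n<1+n b)))))))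
    (trans (+-cong (half a) (half b)) (sym (trans (*-congʳ (reflexive (χ-yes h))) (*-identityˡ _))))
    where
    body : Carrier
    body = C.alt a (C.natR (m C a)) + C.alt b (C.natR (m C b))
    half : ∀ a → C.alt a (C.natR (m C a)) ≈ sign a * natR (m C a)
    half a = trans (alt-sign a _) (*-congˡ (reflexive (natR-≡ (m C a))))
  ... | no h = trans (reflexive (≡.cong (λ x → if x ∧ true ∧ does (suc m ℕₚ.<? suc a +ℕ suc b) then body else 0#) (dec-false (d ∣? suc m) h))) (sym (trans (*-congʳ (reflexive (χ-no h))) (zeroˡ _)))
    where
    body : Carrier
    body = C.alt a (C.natR (m C a)) + C.alt b (C.natR (m C b))

  ∫-scale : ∀ k l φ → ∫ (C.scale k l) φ ≈ k * ∫ l φ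
  ∫-scale k []             φ = sym (zeroʳ k)
  ∫-scale k ((k′ , w) ∷ l) φ = trans (+-cong (*-assoc _ _ _) (∫-scale k l φ)) (sym (distribˡ _ _ _))

  ∫-scaleT : ∀ k t φ → ∫ (C.scaleT k t) φ ≈ k * ∫ t φ
  ∫-scaleT k []                 φ = sym (zeroʳ k)
  ∫-scaleT k ((k′ , u , v) ∷ t) φ = trans (+-cong (*-assoc _ _ _) (∫-scaleT k t φ)) (sym (distribˡ _ _ _))

  ∫-negT : ∀ t φ → ∫ (C.negT t) φ ≈ - ∫ t φ
  ∫-negT t φ = trans (∫-scaleT (- 1#) t φ) (-1*x≈-x _)

  ∫-prefix : ∀ x l φ → ∫ (C.prefix x l) φ ≈ ∫ l (λ w → φ (x ∷ w))
  ∫-prefix x []            φ = refl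
  ∫-prefix x ((k , w) ∷ l) φ = +-congˡ (∫-prefix x l φ)

  ∫-linL : ∀ f l φ → ∫ (C.linL f l) φ ≈ ∫ l (λ w → ∫ (f w) φ)
  ∫-linL f []            φ = refl
  ∫-linL f ((k , w) ∷ l) φ = trans (∫-++ (C.scale k (f w)) _ φ) (+-cong (∫-scale k (f w) φ) (∫-linL f l φ))

  ∫-ΔLin : ∀ l φ → ∫ (C.ΔLin l) φ ≈ ∫ l (λ w → ∫ (C.Δ w) φ)
  ∫-ΔLin []            φ = refl
  ∫-ΔLin ((k , w) ∷ l) φ = trans (∫-++ (C.scaleT k (C.Δ w)) _ φ) (+-cong (∫-scaleT k (C.Δ w) φ) (∫-ΔLin l φ))

  ∫-concatMap : ∀ {a b} {X : Set a} {Y : Set b} (f : Carrier × X → Free Y) (g : X → Carrier) φ →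
    (∀ k x → ∫ (f (k , x)) φ ≈ k * g x) → ∀ l → ∫ (concatMap f l) φ ≈ ∫ l g
  ∫-concatMap f g φ h []            = refl
  ∫-concatMap f g φ h ((k , x) ∷ l) = trans (∫-++ (f (k , x)) _ φ) (+-cong (h k x) (∫-concatMap f g φ h l))

  ∫-⊗L : ∀ l l′ φ → ∫ (l C.⊗L l′) φ ≈ ∫ l (λ u → ∫ l′ (λ v → φ (u , v)))
  ∫-⊗L l l′ φ = ∫-concatMap _ _ φ (λ k u → row k u l′) l
    where
    row : ∀ k u l′ → ∫ (map _ l′) φ ≈ k * ∫ l′ (λ v → φ (u , v))
    row k u []              = sym (zeroʳ k)
    row k u ((k′ , v) ∷ l′) = trans (+-cong (*-assoc _ _ _) (row k u l′)) (sym (distribˡ _ _ _))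

  ∫-bilT : ∀ f g t t′ φ → ∫ (C.bilT f g t t′) φ ≈ ∫ t (λ (u , v) → ∫ t′ (λ (u′ , v′) → ∫ (f u u′) (λ p → ∫ (g v v′) (λ r → φ (p , r)))))
  ∫-bilT f g t t′ φ = ∫-concatMap _ _ φ (λ k (u , v) → trans (∫-concatMap _ (λ (u′ , v′) → k * ∫ (f u u′) (λ p → ∫ (g v v′) (λ r → φ (p , r)))) φ
      (λ k′ (u′ , v′) → trans (∫-scaleT (k * k′) (f u u′ C.⊗L g v v′) φ) (trans (*-congˡ (∫-⊗L (f u u′) (g v v′) φ))
        (solve 3 (λ a b x → (a :* b) :* x := b :* (a :* x)) refl k k′ _))) t′) (∫-* t′ k _)) t

  ∫-indices : ∀ {b} {Y : Set b} (f : ℕ → Free Y) N (h : ℕ → ℕ) φ → ∫ (concatMap f (map suc (applyUpTo h (suc N)))) φ ≈ sumTo N (λ k → ∫ (f (suc (h k))) φ)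
  ∫-indices f zero    h φ = trans (∫-++ (f (suc (h 0))) [] φ) (+-identityʳ _)
  ∫-indices f (suc N) h φ = trans (∫-++ (f (suc (h 0))) _ φ) (+-congˡ (∫-indices f N (λ k → h (suc k)) φ))

  ∫-indices-anti : ∀ {b} {Y : Set b} (f : ℕ → Free Y) N φ → ∫ (concatMap f (map suc (upTo (suc N)))) φ ≈ anti N (λ _ m → ∫ (f (suc m)) φ)
  ∫-indices-anti f N φ = trans (∫-indices f N (λ k → k) φ) (trans (sym (anti-fst N _)) (anti-flip N _))

  -- Undoes the shift: the letter x_{a+1} is a on one side and suc a on the other.
  ↑ : Word → Word
  ↑ = map suc

  ↑² : Word × Word → Word × Word
  ↑² (u , v) = ↑ u , ↑ v

  sh-transfer : ∀ n a b φ → length a +ℕ length b ≤ n → ∫ (C.sh n (↑ a) (↑ b)) φ ≈ ∫ (a ⧢ b) (λ w → φ (↑ w))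
  sh-transfer n []       b  φ _ = trans (∫-ret (↑ b) φ) (sym (⧢-[]ˡ b _))
  sh-transfer n (a ∷ as) [] φ _ = trans (∫-ret (↑ (a ∷ as)) φ) (sym (⧢-[]ʳ (a ∷ as) _))
  sh-transfer (suc n) (a ∷ as) (b ∷ bs) φ (s≤s h) = begin
    ∫ (C.sh (suc n) (↑ (a ∷ as)) (↑ (b ∷ bs))) φ
      ≈⟨ trans (∫-++ (C.prefix (suc a) (C.sh n (↑ as) (↑ (b ∷ bs)))) _ φ) (+-cong (∫-prefix (suc a) (C.sh n (↑ as) (↑ (b ∷ bs))) φ)
          (trans (∫-++ (C.prefix (suc b) (C.sh n (↑ (a ∷ as)) (↑ bs))) _ φ) (+-cong (∫-prefix (suc b) (C.sh n (↑ (a ∷ as)) (↑ bs)) φ)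
            (trans (∫-++ (C.prefix (suc a +ℕ suc b) S) _ φ) (+-cong (∫-prefix (suc a +ℕ suc b) S φ) refl))))) ⟩
    ∫ (C.sh n (↑ as) (↑ (b ∷ bs))) (λ w → φ (suc a ∷ w)) + (∫ (C.sh n (↑ (a ∷ as)) (↑ bs)) (λ w → φ (suc b ∷ w))
      + (∫ S (λ w → φ (suc a +ℕ suc b ∷ w)) + ∫ (concatMap term (map suc (upTo (a +ℕ suc b)))) φ))
      ≈⟨ +-cong (sh-transfer n as (b ∷ bs) _ h) (+-cong (sh-transfer n (a ∷ as) bs _ (ℕₚ.≤-trans (ℕₚ.≤-reflexive (≡.sym (ℕₚ.+-suc (length as) (length bs)))) h)) (+-cong (sh-transfer n as bs _ h₀) sum-part)) ⟩
    ∫ (as ⧢ (b ∷ bs)) (λ w → φ (↑ (a ∷ w))) + (∫ ((a ∷ as) ⧢ bs) (λ w → φ (↑ (b ∷ w)))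
      + (∫ (as ⧢ bs) (λ w → φ (suc a +ℕ suc b ∷ ↑ w)) + anti N (λ k m → ∫ (as ⧢ bs) (λ w → γ a b m * ∫ ((m ∷ []) ⧢ w) (λ w′ → φ (suc k ∷ ↑ w′))))))
      ≈⟨ +-congˡ (+-congˡ (trans (+-cong (∫-cong (as ⧢ bs) λ w → trans (reflexive (≡.cong (λ x → φ (x ∷ ↑ w)) (≡.cong suc (ℕₚ.+-suc a b)))) (sym (⧢-[]ˡ w _))) (sym (∫-anti (as ⧢ bs) N _)))
           (trans (sym (∫-+ (as ⧢ bs) _ _)) (∫-cong (as ⧢ bs) λ w → sym (∫-⋄ a b _))))) ⟩
    ∫ (as ⧢ (b ∷ bs)) (λ w → φ (↑ (a ∷ w))) + (∫ ((a ∷ as) ⧢ bs) (λ w → φ (↑ (b ∷ w)))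
      + ∫ (as ⧢ bs) (λ w → ∫ (⋄ a b) (λ (k , m) → ∫ (letter m ⧢ w) (λ w′ → φ (↑ (k ∷ w′))))))
      ≈⟨ ⧢-∷ a as b bs (λ w → φ (↑ w)) ⟨
    ∫ ((a ∷ as) ⧢ (b ∷ bs)) (λ w → φ (↑ w)) ∎
    where
    N = a +ℕ b
    S = C.sh n (↑ as) (↑ bs)
    h₀ : length as +ℕ length bs ≤ n
    h₀ = ℕₚ.≤-trans (ℕₚ.+-monoʳ-≤ (length as) (ℕₚ.n≤1+n _)) h
    term : ℕ → Free Word
    term j = C.scale (C.Δc (suc a) (suc b) j) (C.prefix ((suc a +ℕ suc b) ℕ.∸ j) (C.linL (C.sh n (j ∷ [])) S))
    term-transfer : ∀ k m → k +ℕ m ≡ N → ∫ (term (suc m)) φ ≈ ∫ (as ⧢ bs) (λ w → γ a b m * ∫ ((m ∷ []) ⧢ w) (λ w′ → φ (suc k ∷ ↑ w′)))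
    term-transfer k m eq = begin
      ∫ (term (suc m)) φ
        ≈⟨ trans (∫-scale (C.Δc (suc a) (suc b) (suc m)) (C.prefix ((suc a +ℕ suc b) ℕ.∸ suc m) (C.linL (C.sh n (suc m ∷ [])) S)) φ) (*-cong (Δc-γ a b m (ℕₚ.≤-trans (ℕₚ.m≤n+m m k) (ℕₚ.≤-reflexive eq)))
             (trans (∫-prefix ((suc a +ℕ suc b) ℕ.∸ suc m) (C.linL (C.sh n (suc m ∷ [])) S) φ) (∫-linL (C.sh n (suc m ∷ [])) S _))) ⟩
      γ a b m * ∫ S (λ w → ∫ (C.sh n (suc m ∷ []) w) (λ w′ → φ ((a +ℕ suc b) ℕ.∸ m ∷ w′)))
        ≈⟨ *-congˡ (trans (sh-transfer n as bs _ h₀) (⧢-cong′ as bs λ w lw → trans (sh-transfer n (m ∷ []) w _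
             (ℕₚ.≤-trans (s≤s lw) (ℕₚ.≤-trans (ℕₚ.≤-reflexive (≡.sym (ℕₚ.+-suc (length as) (length bs)))) h)))
             (∫-cong ((m ∷ []) ⧢ w) λ w′ → reflexive (≡.cong (λ x → φ (x ∷ ↑ w′)) index)))) ⟩
      γ a b m * ∫ (as ⧢ bs) (λ w → ∫ ((m ∷ []) ⧢ w) (λ w′ → φ (suc k ∷ ↑ w′)))
        ≈⟨ ∫-* (as ⧢ bs) (γ a b m) _ ⟨
      ∫ (as ⧢ bs) (λ w → γ a b m * ∫ ((m ∷ []) ⧢ w) (λ w′ → φ (suc k ∷ ↑ w′))) ∎
      where
      index : (a +ℕ suc b) ℕ.∸ m ≡ suc k
      index = ≡.trans (≡.cong (ℕ._∸ m) (≡.trans (ℕₚ.+-suc a b) (≡.cong suc (≡.sym eq)))) (ℕₚ.m+n∸n≡m (suc k) m)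
    sum-part : ∫ (concatMap term (map suc (upTo (a +ℕ suc b)))) φ ≈ anti N (λ k m → ∫ (as ⧢ bs) (λ w → γ a b m * ∫ ((m ∷ []) ⧢ w) (λ w′ → φ (suc k ∷ ↑ w′))))
    sum-part = trans (reflexive (≡.cong (λ M → ∫ (concatMap term (map suc (upTo M))) φ) (ℕₚ.+-suc a b))) (trans (∫-indices-anti term N φ) (anti-cong′ N term-transfer))

  ⧢-transfer : ∀ a b φ → ∫ (↑ a C.⧢ ↑ b) φ ≈ ∫ (a ⧢ b) (λ w → φ (↑ w))
  ⧢-transfer a b φ = sh-transfer _ a b φ (ℕₚ.≤-reflexive (≡.sym (≡.cong₂ _+ℕ_ (length-map suc a) (length-map suc b))))

  -- The left factors of Δ⁺ of a letter are letters, and for those the triangle product only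
  -- prefixes.
  ∫-▷ : ∀ x u φ → ∫ ((x ∷ []) C.▷ u) φ ≈ φ (x ∷ u)
  ∫-▷ x []      φ = ∫-ret (x ∷ []) φ
  ∫-▷ x u@(_ ∷ _) φ = trans (∫-prefix x (C.single u) φ) (∫-ret u (λ w → φ (x ∷ w)))

  Agrees : (ℕ → C.Lin2) → ℕ → Set (c Level.⊔ ℓ)
  Agrees dl a = ∀ φ → ∫ (dl (suc a)) φ ≈ ∫ (D (a ∷ [])) (λ p → φ (↑² p))

  ΔW-transfer : ∀ dl v → All (Agrees dl) v → ∀ φ → ∫ (C.ΔW dl (↑ v)) φ ≈ ∫ (D v) (λ p → φ (↑² p))
  ΔW-transfer dl []          _        φ = trans (∫-ret ([] , []) φ) (sym (∫-D-[] _))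
  ΔW-transfer dl (a ∷ [])    (h ∷ _)  φ = h φ
  ΔW-transfer dl (a ∷ w@(b ∷ v)) (h ∷ hs) φ = begin
    ∫ (C.oneT (↑ (a ∷ w)) ++ C.combT (C.rest (suc a) (dl (suc a))) (C.ΔW dl (↑ w))) φ
      ≈⟨ trans (∫-++ (C.oneT (↑ (a ∷ w))) (C.combT (C.rest (suc a) (dl (suc a))) (C.ΔW dl (↑ w))) φ) (+-cong (∫-ret ([] , ↑ (a ∷ w)) φ) (∫-bilT C._▷_ C._⧢_ (C.rest (suc a) (dl (suc a))) (C.ΔW dl (↑ w)) φ)) ⟩
    φ ([] , ↑ (a ∷ w)) + ∫ (C.rest (suc a) (dl (suc a))) Ψ
      ≈⟨ +-congˡ (trans (∫-++ (C.negT (C.oneT (suc a ∷ []))) (dl (suc a)) Ψ) (+-cong (trans (∫-negT (C.oneT (suc a ∷ [])) Ψ) (-‿cong (∫-ret ([] , suc a ∷ []) Ψ))) (trans (h Ψ) (∫-D-letter a _)))) ⟩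
    φ ([] , ↑ (a ∷ w)) + (- Ψ ([] , suc a ∷ []) + (Ψ ([] , suc a ∷ []) + ∫ (D₁ a) (λ (k , β) → Ψ (suc k ∷ [] , ↑ β))))
      -- `rest` subtracts the summand 1 ⊗ x_{a+1}, which leaves Δ⁺.
      ≈⟨ +-congˡ (solve 2 (λ x y → :- x :+ (x :+ y) := y) refl (Ψ ([] , suc a ∷ [])) _) ⟩
    φ ([] , ↑ (a ∷ w)) + ∫ (D₁ a) (λ (k , β) → Ψ (suc k ∷ [] , ↑ β))
      ≈⟨ +-congˡ (∫-cong (D₁ a) λ (k , β) → trans (ΔW-transfer dl w hs _) (∫-cong (D w) λ (u′ , v′) → trans (∫-▷ (suc k) (↑ u′) _) (⧢-transfer β v′ _))) ⟩
    φ ([] , ↑ (a ∷ w)) + ∫ (D₁ a) (λ (k , β) → ∫ (D w) (λ (u′ , v′) → ∫ (β ⧢ v′) (λ r → φ (↑ (k ∷ u′) , ↑ r))))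
      ≈⟨ ∫-D-∷ a w (λ p → φ (↑² p)) ⟨
    ∫ (D (a ∷ w)) (λ p → φ (↑² p)) ∎
    where
    Ψ : Word × Word → Carrier
    Ψ (U , V) = ∫ (C.ΔW dl (↑ w)) (λ (u′ , v′) → ∫ (U C.▷ u′) (λ p → ∫ (V C.⧢ v′) (λ r → φ (p , r))))

  ⧢T-transfer : ∀ t t′ X Y → (∀ φ → ∫ t φ ≈ ∫ X (λ p → φ (↑² p))) → (∀ φ → ∫ t′ φ ≈ ∫ Y (λ p → φ (↑² p))) → ∀ φ → ∫ (t C.⧢T t′) φ ≈ ⊛ X Y (λ p → φ (↑² p))
  ⧢T-transfer t t′ X Y h h′ φ = trans (∫-bilT C._⧢_ C._⧢_ t t′ φ) (trans (h _) (∫-cong X λ (u , v) → trans (h′ _) (∫-cong Y λ (u′ , v′) →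
    trans (⧢-transfer u u′ _) (∫-cong (u ⧢ u′) λ p → ⧢-transfer v v′ _))))

  -- The recursion for letters is the product x_1 ⧢ x_{w+1} solved for x_{w+2}; the closed form
  -- obeys it because it is already known to be multiplicative.
  ΔLf-transfer : ∀ f a → suc a ≤ f → Agrees (C.ΔLf f) a
  ΔLf-transfer f zero _ φ = begin
    ∫ ((1# , [] , 1 ∷ []) ∷ (1# , 1 ∷ [] , []) ∷ []) φ
      ≈⟨ +-cong (*-identityˡ _) (∫-ret (1 ∷ [] , []) φ) ⟩
    φ ([] , 1 ∷ []) + φ (1 ∷ [] , [])
      ≈⟨ +-congˡ (trans (∫-D₁ 0 _) (B-zero _)) ⟨
    φ ([] , 1 ∷ []) + ∫ (D₁ 0) (λ (k , β) → φ (↑² (k ∷ [] , β)))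
      ≈⟨ ∫-D-letter 0 _ ⟨
    ∫ (D (0 ∷ [])) (λ p → φ (↑² p)) ∎
  ΔLf-transfer (suc f) (suc w) (s≤s h) φ = begin
    ∫ (C.ΔLf (suc f) (suc (suc w))) φ
      ≈⟨ trans (∫-++ (C.ΔLf f 1 C.⧢T C.ΔLf f (suc w)) _ φ) (+-cong (⧢T-transfer (C.ΔLf f 1) (C.ΔLf f (suc w)) (D (0 ∷ [])) (D (w ∷ [])) (good 0 z≤n) (good w ℕₚ.≤-refl) φ)
          (trans (∫-++ (C.negT (C.ΔW (C.ΔLf f) (1 ∷ suc w ∷ []))) _ φ) (+-cong (trans (∫-negT (C.ΔW (C.ΔLf f) (1 ∷ suc w ∷ [])) φ) (-‿cong (two 0 w z≤n ℕₚ.≤-refl)))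
            (trans (∫-++ (C.negT (C.ΔW (C.ΔLf f) (suc w ∷ 1 ∷ []))) _ φ) (+-cong (trans (∫-negT (C.ΔW (C.ΔLf f) (suc w ∷ 1 ∷ [])) φ) (-‿cong (two w 0 ℕₚ.≤-refl z≤n)))
              (trans (∫-negT (concatMap term (map suc (upTo (suc w)))) φ) (-‿cong (trans (∫-indices-anti term w φ) (anti-cong′ w term-transfer))))))))) ⟩
    ⊛ (D (0 ∷ [])) (D (w ∷ [])) φ↑ + (- D₂ 0 w + (- D₂ w 0 + - anti w (λ k m → γ 0 w m * D₂ k m)))
      -- The product of coproducts becomes the coproduct of x_1 ⧢ x_{w+1}, whose depth 2 words are
      -- exactly the ones being subtracted.
      ≈⟨ +-congʳ (trans (sym (multiplicative (0 ∷ []) (w ∷ []) φ↑)) (trans (letters-⧢ 0 w _) (+-congˡ (+-congˡ (∫-⋄ 0 w _))))) ⟩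
    (D₂ 0 w + (D₂ w 0 + (∫ (D (suc w ∷ [])) φ↑ + anti w (λ k m → γ 0 w m * D₂ k m)))) + (- D₂ 0 w + (- D₂ w 0 + - anti w (λ k m → γ 0 w m * D₂ k m)))
      ≈⟨ solve 4 (λ x y z u → (x :+ (y :+ (z :+ u))) :+ (:- x :+ (:- y :+ :- u)) := z) refl (D₂ 0 w) (D₂ w 0) _ _ ⟩
    ∫ (D (suc w ∷ [])) φ↑ ∎
    where
    φ↑ : Word × Word → Carrier
    φ↑ p = φ (↑² p)
    D₂ : ℕ → ℕ → Carrier
    D₂ k m = ∫ (D (k ∷ m ∷ [])) φ↑
    good : ∀ k → k ≤ w → Agrees (C.ΔLf f) k
    good k k≤w = ΔLf-transfer f k (ℕₚ.≤-trans (s≤s k≤w) h)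
    two : ∀ k m → k ≤ w → m ≤ w → ∫ (C.ΔW (C.ΔLf f) (↑ (k ∷ m ∷ []))) φ ≈ D₂ k m
    two k m k≤w m≤w = ΔW-transfer (C.ΔLf f) (k ∷ m ∷ []) (good k k≤w ∷ good m m≤w ∷ []) φ
    term : ℕ → C.Lin2
    term j = C.scaleT (C.Δc 1 (suc w) j) (C.ΔW (C.ΔLf f) ((suc (suc w) ℕ.∸ j) ∷ j ∷ []))
    term-transfer : ∀ k m → k +ℕ m ≡ w → ∫ (term (suc m)) φ ≈ γ 0 w m * D₂ k m
    term-transfer k m eq = trans (∫-scaleT (C.Δc 1 (suc w) (suc m)) (C.ΔW (C.ΔLf f) ((suc w ℕ.∸ m) ∷ suc m ∷ [])) φ) (*-cong (Δc-γ 0 w m m≤w)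
      (trans (reflexive (≡.cong (λ x → ∫ (C.ΔW (C.ΔLf f) (x ∷ suc m ∷ [])) φ) index)) (two k m k≤w m≤w)))
      where
      m≤w : m ≤ w
      m≤w = ℕₚ.≤-trans (ℕₚ.m≤n+m m k) (ℕₚ.≤-reflexive eq)
      k≤w : k ≤ w
      k≤w = ℕₚ.≤-trans (ℕₚ.m≤m+n k m) (ℕₚ.≤-reflexive eq)
      index : suc w ℕ.∸ m ≡ suc k
      index = ≡.trans (≡.cong (λ x → suc x ℕ.∸ m) (≡.sym eq)) (ℕₚ.m+n∸n≡m (suc k) m)

  Δ-transfer : ∀ v φ → ∫ (C.Δ (↑ v)) φ ≈ ∫ (D v) (λ p → φ (↑² p))
  Δ-transfer v φ = ΔW-transfer C.ΔL v (all v) φ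
    where
    all : ∀ v → All (Agrees C.ΔL) v
    all []      = []
    all (a ∷ v) = ΔLf-transfer (suc a) a ℕₚ.≤-refl ∷ all v

  Δ-⧢ : ∀ a b φ → ∫ (C.ΔLin (↑ a C.⧢ ↑ b)) φ ≈ ∫ (C.Δ (↑ a) C.⧢T C.Δ (↑ b)) φ
  Δ-⧢ a b φ = begin
    ∫ (C.ΔLin (↑ a C.⧢ ↑ b)) φ                                ≈⟨ ∫-ΔLin (↑ a C.⧢ ↑ b) φ ⟩
    ∫ (↑ a C.⧢ ↑ b) (λ w → ∫ (C.Δ w) φ)                       ≈⟨ ⧢-transfer a b _ ⟩
    ∫ (a ⧢ b) (λ w → ∫ (C.Δ (↑ w)) φ)                         ≈⟨ ∫-cong (a ⧢ b) (λ w → Δ-transfer w φ) ⟩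
    ∫ (a ⧢ b) (λ w → ∫ (D w) (λ p → φ (↑² p)))                ≈⟨ multiplicative a b _ ⟩
    ⊛ (D a) (D b) (λ p → φ (↑² p))                            ≈⟨ ⧢T-transfer (C.Δ (↑ a)) (C.Δ (↑ b)) (D a) (D b) (Δ-transfer a) (Δ-transfer b) φ ⟨
    ∫ (C.Δ (↑ a) C.⧢T C.Δ (↑ b)) φ                            ∎

  unshift : ∀ a → IsWord a → ∃ λ a′ → a ≡ ↑ a′
  unshift []          []      = [] , ≡.refl
  unshift (suc a ∷ w) (_ ∷ h) with unshift w h
  ... | w′ , ≡.refl = a ∷ w′ , ≡.refl

  -- A coefficient is the value of the functional indicating one pair of words, so agreement under
  -- all functionals implies coefficientwise equality.
  coeff2-∫ : ∀ t w v → C.coeff2 t w v ≈ ∫ t (λ (u , u′) → if does (≡-dec ℕₚ._≟_ u w) ∧ does (≡-dec ℕₚ._≟_ u′ v) then 1# else 0#)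
  coeff2-∫ []                  w v = refl
  coeff2-∫ ((k , u , u′) ∷ t) w v = trans (choose (does (≡-dec ℕₚ._≟_ u w) ∧ does (≡-dec ℕₚ._≟_ u′ v))) (+-congˡ (coeff2-∫ t w v))
    where
    choose : ∀ x → (if x then k + C.coeff2 t w v else C.coeff2 t w v) ≈ k * (if x then 1# else 0#) + C.coeff2 t w v
    choose true  = +-congʳ (sym (*-identityʳ k))
    choose false = sym (trans (+-congʳ (zeroʳ k)) (+-identityˡ _))

  theorem : ∀ a b → IsWord a → IsWord b → C.ΔLin (a C.⧢ b) C.≈T (C.Δ a C.⧢T C.Δ b)
  theorem a b ha hb w v with unshift a ha | unshift b hb
  ... | a′ , ≡.refl | b′ , ≡.refl = trans (coeff2-∫ (C.ΔLin (↑ a′ C.⧢ ↑ b′)) w v) (trans (Δ-⧢ a′ b′ _) (sym (coeff2-∫ (C.Δ (↑ a′) C.⧢T C.Δ (↑ b′)) w v)))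

theorem7p2 : {c ℓ : Level} (q : ℕ) (F : FiniteField c ℓ q) (a b : Word) →
    IsWord a → IsWord b →
    let open Coalg (FiniteField.ring F) q in
    ΔLin (a ⧢ b) ≈T (Δ a ⧢T Δ b)
-- Sizes 0 and 1 are impossible: a field contains 0, and 1 differs from it.
theorem7p2 zero F with FiniteField.enum-surjective F (RingKit.0# (FiniteField.ring F))
... | () , _
theorem7p2 (suc zero) F = ⊥-elim (1≉0 (trivial (enum-surjective 1#) (enum-surjective 0#)))
  where
  open FiniteField F
  open RingKit ring
  trivial : ∃ (λ i → enum i ≈ 1#) → ∃ (λ i → enum i ≈ 0#) → 1# ≈ 0#
  trivial (zero , h) (zero , h′) = trans (sym h) h′
theorem7p2 (suc (suc e)) F = Transfer.theorem e F
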